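{- Let $\alpha,\beta\ge 1$ be real numbers and let $j\in\mathbb{Q}$. For every $X>1$ the following formulas hold: $$\#\mathcal{E}_j(X;H_{\alpha,\beta})=\begin{cases}\dfrac{2}{\beta^{1/2}\zeta(6)}X^{1/2}+O(X^{1/12}) & \text{for } j=0,\\[6pt] \dfrac{2}{\alpha^{1/3}\zeta(4)}X^{1/3}+O(X^{1/12}) & \text{for } j=1728,\\[6pt] \dfrac{2c(j;H_{\alpha,\beta})}{\zeta(2)}X^{1/6}+O(X^{1/12}) & \text{for } j\neq 0,1728,\end{cases}$$ and $$\#\widetilde{\mathcal{E}}_j(X;H_{\alpha,\beta})=\begin{cases}2\left\lfloor\dfrac{X^{1/2}}{\beta^{1/2}}\right\rfloor & \text{for } j=0,\\[6pt] 2\left\lfloor\dfrac{X^{1/3}}{\alpha^{1/3}}\right\rfloor & \text{for } j=1728,\\[6pt] 2\left\lfloor c(j;H_{\alpha,\beta})X^{1/6}\right\rfloor & \text{for } j\neq 0,1728.\end{cases}$$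
   Context: For $(A,B)\in\mathbb{Z}^2$ let $E_{A,B}$ denote the curve $y^2=x^3+Ax+B$; curves are counted by their pairs $(A,B)$. Let $\widetilde{\mathcal{E}}$ be the set of all $E_{A,B}$ with $A,B\in\mathbb{Z}$ and $-16(4A^3+27B^2)\neq 0$, and let $\mathcal{E}$ be the set of $E_{A,B}\in\widetilde{\mathcal{E}}$ such that there is no prime $p$ with $p^4\mid A$ and $p^6\mid B$. The $j$-invariant is $j(E_{A,B})=1728\cdot\frac{4A^3}{4A^3+27B^2}$. For $j\in\mathbb{Q}$, $\widetilde{\mathcal{E}}_j:=\{E_{A,B}\in\widetilde{\mathcal{E}}: j(E_{A,B})=j\}$ and $\mathcal{E}_j:=\{E_{A,B}\in\mathcal{E}: j(E_{A,B})=j\}$. For real $\alpha,\beta\ge1$, $H_{\alpha,\beta}(E_{A,B}):=\max\{\alpha|A|^3,\beta B^2\}$, and for a family $\mathcal{F}$ and $X>0$, $\mathcal{F}(X;H_{\alpha,\beta}):=\{E_{A,B}\in\mathcal{F}: H_{\alpha,\beta}(E_{A,B})\le X\}$. For $a\in\mathbb{Q}^\times$ and a prime $p$, let $\alpha_p(a):=\lceil \operatorname{ord}_p(a)/2\rceil$ if $\operatorname{ord}_p(a)\ge0$ and $\alpha_p(a):=\lceil\operatorname{ord}_p(a)/3\rceil$ if $\operatorname{ord}_p(a)<0$, where $\operatorname{ord}_p$ is the $p$-adic valuation; let $N_a:=\prod_p p^{\alpha_p(a)}\in\mathbb{Q}^\times$ (product over all primes). For $j\in\mathbb{Q}\setminus\{0,1728\}$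 let $a(j):=\frac{4(1728-j)}{27j}$ and $$c(j;H_{\alpha,\beta}):=\min\left\{\frac{|a(j)|^{1/2}}{N_{a(j)}\alpha^{1/6}},\frac{|a(j)|^{1/3}}{N_{a(j)}\beta^{1/6}}\right\}.$$ $\zeta$ is the Riemann zeta function. The parameters $\alpha,\beta,j$ are fixed; implied constants in $O(\cdot)$ may depend on them. -}

module Defs where

open import Level using (0ℓ)
open import Algebra.Bundles using (CommutativeRing)
open import Axiom.ExcludedMiddle using (ExcludedMiddle)
open import Data.Integer as ℤ using (ℤ; +_; -[1+_])
import Data.Integer.Divisibility as ℤ
import Data.Integer.Properties as ℤₚ
open import Data.List using (List; length)
open import Data.List.Membership.Propositional using (_∈_)
open import Data.List.Relation.Unary.Unique.Propositional using (Unique)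
open import Data.Nat as ℕ using (ℕ; zero; suc)
open import Data.Nat.Divisibility using (_∣?_)
open import Data.Nat.Primality using (Prime; prime?)
import Data.Nat.Properties as ℕₚ
open import Data.Product using (∃; ∃-syntax; Σ; _×_; _,_; proj₁)
open import Data.Rational as ℚ using (ℚ; 0ℚ; 1ℚ)
open import Data.Rational.Literals using (fromℤ)
import Data.Rational.Properties as ℚₚ
open import Function using (_⇔_; _∘_)
open import Relation.Binary using (Rel; IsTotalOrder; TotalOrder)
open import Relation.Binary.PropositionalEquality
  using (_≡_; _≢_; refl; cong; trans; module ≡-Reasoning)
open import Relation.Nullary using (¬_; yes; no)
open import Relation.Unary using (Pred)

------------------------------------------------------------------------
-- Curves

-- (A , B) stands for y² = x³ + A x + B.
Curve : Set
Curve = ℤ × ℤ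

4A³+27B² : Curve → ℤ
4A³+27B² (A , B) = + 4 ℤ.* A ℤ.^ 3 ℤ.+ + 27 ℤ.* B ℤ.^ 2

Δ : Curve → ℤ
Δ E = ℤ.- (+ 16) ℤ.* 4A³+27B² E

Ẽ : Pred Curve 0ℓ
Ẽ E = Δ E ≢ + 0

𝓔 : Pred Curve 0ℓ
𝓔 E@(A , B) = Ẽ E ×
  ¬ (∃[ p ] (Prime p × ((+ p) ℤ.^ 4) ℤ.∣ A × ((+ p) ℤ.^ 6) ℤ.∣ B))

4A³+27B²≢0 : ∀ E → Ẽ E → 4A³+27B² E ≢ + 0
4A³+27B²≢0 E Δ≢0 eq =
  Δ≢0 (trans (cong (ℤ.- (+ 16) ℤ.*_) eq) (ℤₚ.*-zeroʳ (ℤ.- (+ 16))))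

fromℤ-nonZero : ∀ {i} → i ≢ + 0 → ℚ.NonZero (fromℤ i)
fromℤ-nonZero {i} i≢0 = ℚ.≢-nonZero {fromℤ i} (i≢0 ∘ cong ℚ.numerator)

1728ℚ : ℚ
1728ℚ = fromℤ (+ 1728)

jInvariant : ∀ E → Ẽ E → ℚ
jInvariant E@(A , B) Δ≢0 =
  1728ℚ ℚ.* (fromℤ (+ 4 ℤ.* A ℤ.^ 3) ℚ.÷ fromℤ (4A³+27B² E))
  where instance _ = fromℤ-nonZero (4A³+27B²≢0 E Δ≢0)

Ẽ[_] : ℚ → Pred Curve 0ℓ
Ẽ[ j ] E = Σ (Ẽ E) λ e → jInvariant E e ≡ j

𝓔[_] : ℚ → Pred Curve 0ℓ
𝓔[ j ] E = Σ (𝓔 E) λ e → jInvariant E (proj₁ e) ≡ j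

------------------------------------------------------------------------
-- #S = n

Card : Pred Curve 0ℓ → ℕ → Set
Card S n = ∃[ xs ] (Unique xs × (∀ E → E ∈ xs ⇔ S E) × length xs ≡ n)

------------------------------------------------------------------------
-- The arithmetic function N

greatestPower : ℕ → ℕ → ℕ → ℕ
greatestPower p n zero = zero
greatestPower p n (suc e) with (p ℕ.^ suc e) ∣? n
... | yes _ = suc e
... | no  _ = greatestPower p n e

-- The largest e ≤ n with p ^ e ∣ n.  For p ≥ 2 and n ≥ 1 the bound e ≤ n
-- is automatic, so this is the p-adic valuation of n.
ordℕ : ℕ → ℕ → ℕ
ordℕ p n = greatestPower p n n

ord : ℕ → ℚ → ℤ
ord p q = + ordℕ p ℤ.∣ ℚ.numerator q ∣ ℤ.- + ordℕ p (ℚ.denominatorℕ q)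

-- ℤ._/ℕ_ rounds towards -∞.
⌈_/ℕ_⌉ : ℤ → (d : ℕ) .{{_ : ℕ.NonZero d}} → ℤ
⌈ i /ℕ d ⌉ = ℤ.- ((ℤ.- i) ℤ./ℕ d)

α-exponent : ℕ → ℚ → ℤ
α-exponent p a with + 0 ℤ.≤? ord p a
... | yes _ = ⌈ ord p a /ℕ 2 ⌉
... | no  _ = ⌈ ord p a /ℕ 3 ⌉

_^ℤ_ : (n : ℕ) .{{_ : ℕ.NonZero n}} → ℤ → ℚ
n ^ℤ (+ k)    = fromℤ (+ (n ℕ.^ k))
n ^ℤ -[1+ k ] = (+ 1) ℚ./ (n ℕ.^ suc k)
  where instance _ = ℕₚ.m^n≢0 n (suc k)

-- ∏ p ^ e p over the primes p ≤ n.
∏[p≤_]p^_ : ℕ → (ℕ → ℤ) → ℚ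
∏[p≤ zero ]p^ e = 1ℚ
∏[p≤ suc n ]p^ e with prime? (suc n)
... | yes _ = (suc n ^ℤ e (suc n)) ℚ.* (∏[p≤ n ]p^ e)
... | no  _ = ∏[p≤ n ]p^ e

-- For a ≠ 0 a prime exceeding both numerator and denominator has exponent 0,
-- so the truncated product is the product over all primes.
N : ℚ → ℚ
N a = ∏[p≤ ℤ.∣ ℚ.numerator a ∣ ℕ.⊔ ℚ.denominatorℕ a ]p^ (λ p → α-exponent p a)

27*≢0 : ∀ {j} → j ≢ 0ℚ → fromℤ (+ 27) ℚ.* j ≢ 0ℚ
27*≢0 {j} j≢0 eq = j≢0 (begin
  j                                 ≡⟨ ℚₚ.*-identityˡ j ⟨
  1ℚ ℚ.* j                          ≡⟨ cong (ℚ._* j) (ℚₚ.*-inverseˡ q) ⟨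
  (ℚ.1/ q ℚ.* q) ℚ.* j              ≡⟨ ℚₚ.*-assoc (ℚ.1/ q) q j ⟩
  ℚ.1/ q ℚ.* (q ℚ.* j)              ≡⟨ cong (ℚ.1/ q ℚ.*_) eq ⟩
  ℚ.1/ q ℚ.* 0ℚ                     ≡⟨ ℚₚ.*-zeroʳ (ℚ.1/ q) ⟩
  0ℚ                                ∎)
  where
  open ≡-Reasoning
  q = fromℤ (+ 27)

a[_] : (j : ℚ) → .(j ≢ 0ℚ) → ℚ
a[ j ] j≢0 =
  ℚ._÷_ (fromℤ (+ 4) ℚ.* (1728ℚ ℚ.- j)) (fromℤ (+ 27) ℚ.* j)
    {{ℚ.≢-nonZero (27*≢0 j≢0)}}

------------------------------------------------------------------------
-- The real numbers

-- Dedekind-complete ordered fields: up to isomorphism, ℝ is the only one.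
record CompleteOrderedField : Set₁ where
  infix  4 _≤_
  infix  8 _⁻¹

  field
    commutativeRing : CommutativeRing 0ℓ 0ℓ

  open CommutativeRing commutativeRing public

  field
    -- The value of _⁻¹ at 0# is unspecified.
    _⁻¹          : Carrier → Carrier
    *-inverseʳ   : ∀ {x} → x ≉ 0# → x * x ⁻¹ ≈ 1#
    0≉1          : 0# ≉ 1#
    _≤_          : Rel Carrier 0ℓ
    isTotalOrder : IsTotalOrder _≈_ _≤_
    +-monoʳ-≤    : ∀ z {x y} → x ≤ y → z + x ≤ z + y
    *-nonNeg     : ∀ {x y} → 0# ≤ x → 0# ≤ y → 0# ≤ x * y

  UpperBound : Pred Carrier 0ℓ → Pred Carrier 0ℓ
  UpperBound S u = ∀ x → S x → x ≤ u

  field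
    supremum : (S : Pred Carrier 0ℓ) → ∃ S → ∃ (UpperBound S) →
               ∃[ s ] (UpperBound S s × (∀ u → UpperBound S u → s ≤ u))

  totalOrder : TotalOrder 0ℓ 0ℓ 0ℓ
  totalOrder = record { isTotalOrder = isTotalOrder }

  open import Relation.Binary.Construct.NonStrictToStrict _≈_ _≤_ public
    using (_<_)
  open import Algebra.Construct.NaturalChoice.Min totalOrder public
    using (_⊓_)
  open import Algebra.Construct.NaturalChoice.Max totalOrder public
    using (_⊔_)
  open import Algebra.Properties.Semiring.Exp semiring public
    using (_^_)
  open import Algebra.Definitions.RawMonoid +-rawMonoid public
    using () renaming (_×_ to _×ⁿ_)

------------------------------------------------------------------------
-- Real-valued quantities

-- Excluded middle supplies the case distinctions of classical analysis.
module Real (lem : ExcludedMiddle 0ℓ) (ℝ : CompleteOrderedField) where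

  open CompleteOrderedField ℝ public

  infix  4 #_≈_+O_ #_≡_
  infixl 7 _/_
  infixl 8 _^1/_

  _/_ : Carrier → Carrier → Carrier
  x / y = x * y ⁻¹

  ∣_∣ : Carrier → Carrier
  ∣ x ∣ = x ⊔ (- x)

  fromNat : ℕ → Carrier
  fromNat n = n ×ⁿ 1#

  fromInt : ℤ → Carrier
  fromInt (+ n)    = fromNat n
  fromInt -[1+ n ] = - fromNat (suc n)

  fromRat : ℚ → Carrier
  fromRat q = fromInt (ℚ.numerator q) / fromNat (ℚ.denominatorℕ q)

  -- An element satisfying P; the default d is returned only when there is
  -- none.  Every P used below has at most one solution up to _≈_.
  the : {A : Set} (d : A) → Pred A 0ℓ → A
  the d P with lem {∃ P}
  ... | yes (x , _) = x
  ... | no  _       = d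

  -- The nonnegative k-th root (of x ≥ 0, for k ≥ 1).
  _^1/_ : Carrier → ℕ → Carrier
  x ^1/ k = the 0# λ y → 0# ≤ y × y ^ k ≈ x

  ⌊_⌋ : Carrier → ℤ
  ⌊ x ⌋ = the (+ 0) λ m → fromInt m ≤ x × x < fromInt m + 1#

  Converges : (ℕ → Carrier) → Carrier → Set
  Converges s l = ∀ ε → 0# < ε →
    ∃[ n₀ ] (∀ n → n₀ ℕ.≤ n → ∣ s n - l ∣ < ε)

  ∑[n≤_]n⁻ : ℕ → ℕ → Carrier
  ∑[n≤ zero  ]n⁻ k = 0#
  ∑[n≤ suc m ]n⁻ k = ∑[n≤ m ]n⁻ k + 1# / fromNat (suc m) ^ k

  -- The Riemann zeta function at the integers k ≥ 2.
  ζ : ℕ → Carrier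
  ζ k = the 0# (Converges (λ m → ∑[n≤ m ]n⁻ k))

  H : (α β : Carrier) → Curve → Carrier
  H α β (A , B) = (α * ∣ fromInt A ∣ ^ 3) ⊔ (β * fromInt B ^ 2)

  -- F(X; h)
  _⟨_⟩ : Pred Curve 0ℓ → (h : Curve → Carrier) → Carrier → Pred Curve 0ℓ
  (F ⟨ h ⟩) X E = F E × h E ≤ X

  c : (j : ℚ) → .(j ≢ 0ℚ) → (α β : Carrier) → Carrier
  c j j≢0 α β =
      (∣a∣ ^1/ 2 / (Nₐ * α ^1/ 6))
    ⊓ (∣a∣ ^1/ 3 / (Nₐ * β ^1/ 6))
    where
    ∣a∣ = fromRat ℚ.∣ a[ j ] j≢0 ∣
    Nₐ  = fromRat (N (a[ j ] j≢0))

  -- #F(X) = main(X) + O(err(X)) for X > 1.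
  #_≈_+O_ : (Carrier → Pred Curve 0ℓ) → (main err : Carrier → Carrier) → Set
  # F ≈ main +O err =
    ∃[ C ] (∀ X → 1# < X →
      ∃[ n ] (Card (F X) n × ∣ fromNat n - main X ∣ ≤ C * err X))

  -- #F(X) = f(X) for X > 1.
  #_≡_ : (Carrier → Pred Curve 0ℓ) → (Carrier → ℤ) → Set
  # F ≡ f = ∀ X → 1# < X → ∃[ n ] (Card (F X) n × + n ≡ f X)

{-# OPTIONS --safe #-}

-- The curves with a given j form a one-parameter family φ(k), 0 ≠ k ∈ ℤ:
-- (0 , k) for j = 0, (k , 0) for j = 1728, and (k²N²/a , k³N³/a) otherwise,
-- where N = N_a, because the solutions of B² = aA³ are A = t²/a, B = t³/a with
-- t = B/A, and these are integers exactly when N ∣ t.  The height bound reads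
-- |k| ≤ Y for a real Y = Y(X), which gives 2⌊Y⌋ curves, and φ(k) is minimal
-- exactly when k is s-th-power-free, with s = 6, 4, 2.
--
-- The s-th-power-free n ≤ Y are counted by sieving with the primes p ≤ D = ⌊Y^(1/s)⌋.
-- Expanding the sieve over the squarefree D-smooth d shows that the count
-- differs from Y ∏_{p ≤ D} (1 − p⁻ˢ) by at most
-- Σ_d min(1, Y/dˢ) ≤ D + Y Σ_{d > D} d⁻ˢ = O(D), and the same sieve applied to
-- ζ(s) shows that ζ(s) ∏_{p ≤ D} (1 − p⁻ˢ), the sum of n⁻ˢ over the n without
-- prime factors ≤ D, is 1 + O(D^(1−s)).
module Submission where

open import Defs
open import Level using (0ℓ)
open import Axiom.ExcludedMiddle using (ExcludedMiddle)
open import Data.Integer as ℤ using (+_)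
open import Data.Product using (_×_; _,_)
open import Data.Rational using (ℚ; 0ℚ)
open import Relation.Binary.PropositionalEquality using (_≡_; _≢_)
import Relation.Binary.PropositionalEquality as ≡

-- The exponents s = 6, 4, 2 come from scaling. Dividing A by p⁴ and B by p⁶ leaves j unchanged, so
-- it moves within the family, and it divides the parameter k by p⁶ for (0 , k), by p⁴ for (k , 0),
-- and by p² in the remaining case, where A grows like k² and B like k³. The single error exponent
-- 1/12 has the same source: in each case Y is of order X^(s/12), so D is O(X^(1/12)) throughout.
-- The obstacle in the sieve is that the primes up to D generate 2^π(D) numbers d, so an error of 1
-- for each d would be useless. What helps is that these d are distinct: at most D of them are ≤ D,
-- and for every other d the floor of N/dˢ vanishes, so that its error is summable. Neither the
-- Möbius function nor an infinite Euler product is needed. The sieve is a recursion over the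
-- primes, run once with weight 1 on s-th powers and once with weight n⁻ˢ on primes, and ζ(s) is
-- compared with the finite product only.

module Arithmetic where

  open import Data.Nat
  open import Data.Nat.Properties
  open import Data.Nat.Divisibility
  open import Data.Nat.Coprimality using (Coprime; coprime-divisor)
  import Data.Nat.Coprimality as Coprime
  open import Data.Nat.DivMod
  open import Data.Nat.GCD
  open import Data.Nat.Primality
  open import Data.Nat.Primality.Factorisation using (factorise)
  open import Data.List using ([]; _∷_)
  open import Data.Nat.ListAction using (product)
  open import Data.List.Relation.Unary.All using (_∷_)
  open import Data.Product using (∃-syntax; _×_; _,_)
  open import Data.Sum using (inj₁; inj₂)
  open import Relation.Nullary using (yes; no; contradiction)
  open import Relation.Binary.PropositionalEquality

  -- Divisibility, valuations, rounded square and cube roots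

  prime>1 : ∀ {p} → Prime p → 1 < p
  prime>1 pr = nonTrivial⇒n>1 _ {{prime⇒nonTrivial pr}}

  ∃-prime-divisor : ∀ n → 1 < n → ∃[ p ] (Prime p × p ∣ n)
  ∃-prime-divisor n@(suc _) 1<n with factorise n
  ... | record { factors = [] ; isFactorisation = eq } =
    contradiction 1<n (subst (1 ≮_) (sym eq) (<-irrefl refl))
  ... | record { factors = p ∷ ps ; isFactorisation = eq ; factorsPrime = pr ∷ _ } =
    p , pr , subst (p ∣_) (sym eq) (m∣m*n (product ps))

  prime∤⇒coprime : ∀ {p m} → Prime p → p ∤ m → Coprime p m
  prime∤⇒coprime pr p∤m (d∣p , d∣m) with prime⇒irreducible pr d∣p
  ... | inj₁ d≡1 = d≡1
  ... | inj₂ refl = contradiction d∣m p∤m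

  coprime-*ˡ : ∀ {a b c} → Coprime a c → Coprime b c → Coprime (a * b) c
  coprime-*ˡ {a} ac bc {d} (d∣ab , d∣c) = bc (coprime-divisor da d∣ab , d∣c)
    where
    da : Coprime d a
    da (e∣d , e∣a) = ac (e∣a , ∣-trans e∣d d∣c)

  coprime-^ˡ : ∀ {a c} k → Coprime a c → Coprime (a ^ k) c
  coprime-^ˡ zero    ac = Coprime.1-coprimeTo _
  coprime-^ˡ (suc k) ac = coprime-*ˡ ac (coprime-^ˡ k ac)

  coprime-^ : ∀ {a c} k l → Coprime a c → Coprime (a ^ k) (c ^ l)
  coprime-^ k l ac = coprime-^ˡ k (Coprime.sym (coprime-^ˡ l (Coprime.sym ac)))

  primes-coprime : ∀ {p q} → Prime p → Prime q → p ≢ q → Coprime p q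
  primes-coprime {p} {q} pp pq p≢q = prime∤⇒coprime pp p∤q
    where
    p∤q : p ∤ q
    p∤q p∣q with prime⇒irreducible pq p∣q
    ... | inj₁ refl = ¬prime[1] pp
    ... | inj₂ p≡q = p≢q p≡q

  coprime-*-∣ : ∀ {a b x} → Coprime a b → a ∣ x → b ∣ x → a * b ∣ x
  coprime-*-∣ {a} {b} ab (divides q refl) b∣x =
    subst (a * b ∣_) (*-comm a q) (*-monoʳ-∣ a (coprime-divisor (Coprime.sym ab) (subst (b ∣_) (*-comm q a) b∣x)))

  ^-monoˡ-∣ : ∀ {m n} k → m ∣ n → m ^ k ∣ n ^ k
  ^-monoˡ-∣ zero    m∣n = ∣-refl
  ^-monoˡ-∣ (suc k) m∣n = *-pres-∣ m∣n (^-monoˡ-∣ k m∣n)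

  ^-monoʳ-∣ : ∀ p {e f} → e ≤ f → p ^ e ∣ p ^ f
  ^-monoʳ-∣ p {e} {f} e≤f = divides (p ^ (f ∸ e))
    (trans (cong (p ^_) (sym (m∸n+n≡m e≤f))) (^-distribˡ-+-* p (f ∸ e) e))

  ^-distribʳ-* : ∀ k m n → (m * n) ^ k ≡ m ^ k * n ^ k
  ^-distribʳ-* zero    m n = refl
  ^-distribʳ-* (suc k) m n = begin
    m * n * (m * n) ^ k         ≡⟨ cong (m * n *_) (^-distribʳ-* k m n) ⟩
    m * n * (m ^ k * n ^ k)     ≡⟨ [m*n]*[o*p]≡[m*o]*[n*p] m n (m ^ k) (n ^ k) ⟩
    m * m ^ k * (n * n ^ k)     ∎
    where open ≡-Reasoning

  n<2^n : ∀ n → n < 2 ^ n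
  n<2^n zero = s≤s z≤n
  n<2^n (suc n) = begin-strict
    suc n           <⟨ s≤s (n<2^n n) ⟩
    1 + 2 ^ n       ≤⟨ +-monoˡ-≤ (2 ^ n) (m^n>0 2 n) ⟩
    2 ^ n + 2 ^ n   ≡⟨ cong (λ t → 2 ^ n + t) (+-identityʳ (2 ^ n)) ⟨
    2 ^ suc n       ∎
    where open ≤-Reasoning

  greatestPower-∣ : ∀ p n b → p ^ greatestPower p n b ∣ n
  greatestPower-∣ p n zero = 1∣ n
  greatestPower-∣ p n (suc b) with (p ^ suc b) ∣? n
  ... | yes d = d
  ... | no  _ = greatestPower-∣ p n b

  greatestPower-max : ∀ p n b {e} → e ≤ b → p ^ e ∣ n → e ≤ greatestPower p n b
  greatestPower-max p n zero    z≤n d = z≤n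
  greatestPower-max p n (suc b) {e} e≤ d with (p ^ suc b) ∣? n
  ... | yes _ = e≤
  ... | no ∤n with m≤n⇒m<n∨m≡n e≤
  ...   | inj₁ (s≤s e≤b) = greatestPower-max p n b e≤b d
  ...   | inj₂ refl = contradiction d ∤n

  ord-∣ : ∀ p n → p ^ ordℕ p n ∣ n
  ord-∣ p n = greatestPower-∣ p n n

  -- The cut-off e ≤ n in `ordℕ` loses nothing, since e < 2^e ≤ p^e ≤ n.
  ord-max : ∀ {p n} .{{_ : NonZero n}} → Prime p → ∀ {e} → p ^ e ∣ n → e ≤ ordℕ p n
  ord-max {p} {n} pr {e} d = greatestPower-max p n n e≤n d
    where
    open ≤-Reasoning
    e≤n : e ≤ n
    e≤n = begin
      e       ≤⟨ <⇒≤ (n<2^n e) ⟩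
      2 ^ e   ≤⟨ ^-monoˡ-≤ e (prime>1 pr) ⟩
      p ^ e   ≤⟨ ∣⇒≤ d ⟩
      n       ∎

  -- Let g be the gcd. If a prime p divided u / g, then p to the power ord_p(g) + 1 would divide u,
  -- hence w by hypothesis, hence g, which contradicts the maximality of the order.
  ∣-of-prime-powers : ∀ u w .{{_ : NonZero u}} →
    (∀ p e → Prime p → p ^ e ∣ u → p ^ e ∣ w) → u ∣ w
  ∣-of-prime-powers u w hyp with gcd[m,n]∣m u w
  ... | divides u′ u≡ = ∣-trans (∣-reflexive u≡g) (gcd[m,n]∣n u w)
    where
    g = gcd u w
    instance
      g≢0 : NonZero g
      g≢0 = ≢-nonZero (gcd[m,n]≢0 u w (inj₁ (≢-nonZero⁻¹ u)))
    u′<2 : u′ ≤ 1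
    u′<2 with 2 ≤? u′
    ... | no ≱2 = ≤-pred (≰⇒> ≱2)
    ... | yes ≥2 with ∃-prime-divisor u′ ≥2
    ...   | p , pr , p∣u′ = contradiction (ord-max pr p^1+e∣g) (<⇒≱ (n<1+n e))
      where
      instance
        _ = prime⇒nonZero pr
      e = ordℕ p g
      p^e∣g = ord-∣ p g
      p^1+e∣u : p ^ suc e ∣ u
      p^1+e∣u = subst (p ^ suc e ∣_) (sym u≡) (*-pres-∣ p∣u′ p^e∣g)
      p^1+e∣g : p ^ suc e ∣ g
      p^1+e∣g = gcd-greatest p^1+e∣u (hyp p (suc e) pr p^1+e∣u)
    u≡g : u ≡ g
    u≡g = trans u≡ (trans (cong (_* g) (≤-antisym u′<2 (n≢0⇒n>0 u′≢0))) (+-identityʳ g))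
      where
      u′≢0 : u′ ≢ 0
      u′≢0 eq = ≢-nonZero⁻¹ u (trans u≡ (cong (_* g) eq))

  -- Write n = p^g m with p not dividing m. If e exceeded g k, cancelling p^(g k) would leave p
  -- dividing m^k, hence m.
  ord-*-≤ : ∀ {p} n k .{{_ : NonZero n}} → Prime p → ∀ {e} → p ^ e ∣ n ^ k → e ≤ ordℕ p n * k
  ord-*-≤ {p} n k pr {e} d with ord-∣ p n
  ... | divides m n≡ with e ≤? ordℕ p n * k
  ...   | yes le = le
  ...   | no ≰ = contradiction p∣m p∤m
    where
    instance
      _ = prime⇒nonZero pr
    g = ordℕ p n
    p∤m : p ∤ m
    p∤m p∣m = <⇒≱ (n<1+n g) (ord-max {n = n} pr (subst (p ^ suc g ∣_) (sym n≡) (*-pres-∣ p∣m (∣-refl {p ^ g}))))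
    n^k≡ : n ^ k ≡ p ^ (g * k) * m ^ k
    n^k≡ = begin
      n ^ k                 ≡⟨ cong (_^ k) (trans n≡ (*-comm m (p ^ g))) ⟩
      (p ^ g * m) ^ k       ≡⟨ ^-distribʳ-* k (p ^ g) m ⟩
      (p ^ g) ^ k * m ^ k   ≡⟨ cong (_* m ^ k) (^-*-assoc p g k) ⟩
      p ^ (g * k) * m ^ k   ∎
      where open ≡-Reasoning
    p∣m^k : p ∣ m ^ k
    p∣m^k = *-cancelˡ-∣ (p ^ (g * k)) {{m^n≢0 p (g * k)}}
      (subst₂ _∣_ (*-comm p (p ^ (g * k))) n^k≡ (∣-trans (^-monoʳ-∣ p (≰⇒> ≰)) d))
    p∣^ : ∀ l → p ∣ m ^ l → p ∣ m
    p∣^ zero    d = contradiction (subst Prime (∣1⇒≡1 d) pr) ¬prime[1]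
    p∣^ (suc l) d with euclidsLemma m (m ^ l) pr d
    ... | inj₁ y = y
    ... | inj₂ y = p∣^ l y
    p∣m : p ∣ m
    p∣m = p∣^ k p∣m^k

  -- Follows the recursion of `∏[p≤_]p^_` with natural exponents, so that `N` can be compared with a
  -- quotient of two such products prime by prime.
  ∏ : ℕ → (ℕ → ℕ) → ℕ
  ∏ zero    e = 1
  ∏ (suc n) e with prime? (suc n)
  ... | yes _ = suc n ^ e (suc n) * ∏ n e
  ... | no  _ = ∏ n e

  ∏-nonZero : ∀ n e → NonZero (∏ n e)
  ∏-nonZero zero e = _
  ∏-nonZero (suc n) e with prime? (suc n)
  ... | yes _ = m*n≢0 (suc n ^ e (suc n)) (∏ n e) {{m^n≢0 (suc n) (e (suc n))}} {{∏-nonZero n e}}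
  ... | no  _ = ∏-nonZero n e

  ∏-coprime : ∀ n e {q} → Prime q → n < q → Coprime q (∏ n e)
  ∏-coprime zero e pq n<q = Coprime.sym (Coprime.1-coprimeTo _)
  ∏-coprime (suc n) e pq n<q with prime? (suc n)
  ... | yes pr = Coprime.sym (coprime-*ˡ
          (coprime-^ˡ (e (suc n)) (primes-coprime pr pq (<⇒≢ n<q)))
          (Coprime.sym (∏-coprime n e pq (<-trans (n<1+n n) n<q))))
  ... | no _ = ∏-coprime n e pq (<-trans (n<1+n n) n<q)

  ∏-∣ : ∀ n e {x} → (∀ p → Prime p → p ^ e p ∣ x) → ∏ n e ∣ x
  ∏-∣ zero e d = 1∣ _
  ∏-∣ (suc n) e d with prime? (suc n)
  ... | yes pr = coprime-*-∣ (coprime-^ˡ (e (suc n)) (∏-coprime n e pr (n<1+n n))) (d (suc n) pr) (∏-∣ n e d)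
  ... | no  _  = ∏-∣ n e d

  ∣-∏ : ∀ n e {p} → Prime p → p ≤ n → p ^ e p ∣ ∏ n e
  ∣-∏ zero e pr z≤n = contradiction pr ¬prime[0]
  ∣-∏ (suc n) e {p} pr p≤ with prime? (suc n) | m≤n⇒m<n∨m≡n p≤
  ... | yes _ | inj₁ (s≤s p≤n) = ∣n⇒∣m*n (suc n ^ e (suc n)) (∣-∏ n e pr p≤n)
  ... | yes _ | inj₂ refl      = m∣m*n (∏ n e)
  ... | no  _ | inj₁ (s≤s p≤n) = ∣-∏ n e pr p≤n
  ... | no ¬p | inj₂ refl      = contradiction pr ¬p

  ∏-^ : ∀ n e k → ∏ n e ^ k ≡ ∏ n (λ p → e p * k)
  ∏-^ zero e k = ^-zeroˡ k
  ∏-^ (suc n) e k with prime? (suc n)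
  ... | yes _ = trans (^-distribʳ-* k (suc n ^ e (suc n)) (∏ n e))
                      (cong₂ _*_ (^-*-assoc (suc n) (e (suc n)) k) (∏-^ n e k))
  ... | no  _ = ∏-^ n e k

  p∣n⇒p≤M : ∀ {p n M} .{{_ : NonZero n}} → n ≤ M → p ∣ n → p ≤ M
  p∣n⇒p≤M n≤M p∣n = ≤-trans (∣⇒≤ p∣n) n≤M

  n≤2⌈n/2⌉ : ∀ n → n ≤ ⌈ n /2⌉ * 2
  n≤2⌈n/2⌉ zero = z≤n
  n≤2⌈n/2⌉ (suc zero) = s≤s z≤n
  n≤2⌈n/2⌉ (suc (suc n)) = s≤s (s≤s (n≤2⌈n/2⌉ n))

  n≤2m⇒⌈n/2⌉≤m : ∀ n m → n ≤ m * 2 → ⌈ n /2⌉ ≤ m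
  n≤2m⇒⌈n/2⌉≤m zero m le = z≤n
  n≤2m⇒⌈n/2⌉≤m (suc zero) (suc m) le = s≤s z≤n
  n≤2m⇒⌈n/2⌉≤m (suc (suc n)) (suc m) (s≤s (s≤s le)) = s≤s (n≤2m⇒⌈n/2⌉≤m n m le)

  -- The least m with u ∣ m ²  (for u ≤ M).
  √⌈_⌉ : ℕ → ℕ → ℕ
  √⌈ M ⌉ u = ∏ M (λ p → ⌈ ordℕ p u /2⌉)

  u∣√⌈u⌉² : ∀ {M u} .{{_ : NonZero u}} → u ≤ M → u ∣ √⌈ M ⌉ u ^ 2
  u∣√⌈u⌉² {M} {u} u≤M = ∣-of-prime-powers u (√⌈ M ⌉ u ^ 2) local
    where
    e : ℕ → ℕ
    e p = ⌈ ordℕ p u /2⌉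
    local : ∀ p f → Prime p → p ^ f ∣ u → p ^ f ∣ √⌈ M ⌉ u ^ 2
    -- A prime with exponent 0 may exceed M. For a positive exponent p divides u, so p ≤ M and its
    -- factor occurs in the product.
    local p zero    pr d = 1∣ _
    local p (suc f) pr d = ∣-trans
      (^-monoʳ-∣ p (≤-trans (ord-max pr {suc f} d) (n≤2⌈n/2⌉ (ordℕ p u))))
      (subst (_∣ √⌈ M ⌉ u ^ 2) (^-*-assoc p (e p) 2) (^-monoˡ-∣ {m = p ^ e p} {n = √⌈ M ⌉ u} 2 (∣-∏ M e pr (p∣n⇒p≤M u≤M (m*n∣⇒m∣ p (p ^ f) d)))))

  u∣x²⇒√⌈u⌉∣x : ∀ {M u} x .{{_ : NonZero u}} .{{_ : NonZero x}} → u ∣ x ^ 2 → √⌈ M ⌉ u ∣ x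
  u∣x²⇒√⌈u⌉∣x {M} {u} x u∣x² = ∏-∣ M _ λ p pr → ∣-trans
    (^-monoʳ-∣ p (n≤2m⇒⌈n/2⌉≤m (ordℕ p u) (ordℕ p x) (ord-*-≤ x 2 pr (∣-trans (ord-∣ p u) u∣x²))))
    (ord-∣ p x)

  -- The greatest m with m ³ ∣ v  (for v ≤ M).
  ∛⌊_⌋ : ℕ → ℕ → ℕ
  ∛⌊ M ⌋ v = ∏ M (λ p → ordℕ p v / 3)

  ∛⌊v⌋³∣v : ∀ M v → ∛⌊ M ⌋ v ^ 3 ∣ v
  ∛⌊v⌋³∣v M v = subst (_∣ v) (sym (∏-^ M (λ p → ordℕ p v / 3) 3)) (∏-∣ M _ λ p pr → ∣-trans
    (^-monoʳ-∣ p (m/n*n≤m (ordℕ p v) 3)) (ord-∣ p v))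

  y³∣v⇒y∣∛⌊v⌋ : ∀ {M v} y .{{_ : NonZero v}} .{{_ : NonZero y}} → v ≤ M → y ^ 3 ∣ v → y ∣ ∛⌊ M ⌋ v
  y³∣v⇒y∣∛⌊v⌋ {M} {v} y v≤M y³∣v = ∣-of-prime-powers y (∛⌊ M ⌋ v) local
    where
    local : ∀ p f → Prime p → p ^ f ∣ y → p ^ f ∣ ∛⌊ M ⌋ v
    local p zero    pr d = 1∣ _
    local p (suc f) pr d = ∣-trans
      (^-monoʳ-∣ p (subst (_≤ ordℕ p v / 3) (m*n/n≡m (suc f) 3) (/-monoˡ-≤ 3 (ord-max pr {suc f * 3} p^3f∣v))))
      (∣-∏ M _ pr (p∣n⇒p≤M v≤M (m*n∣⇒m∣ p (p ^ (2 + f * 3)) p^3f∣v)))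
      where
      p^3f∣v : p ^ (suc f * 3) ∣ v
      p^3f∣v = subst (_∣ v) (^-*-assoc p (suc f) 3) (∣-trans (^-monoˡ-∣ {m = p ^ suc f} 3 d) y³∣v)

-- Rational arithmetic, and N as a quotient of natural numbers

module Rationals where

  open import Data.Nat as ℕ using (ℕ; zero; suc)
  import Data.Nat.Properties as ℕₚ
  import Data.Nat.DivMod as ℕ
  open import Data.Nat.Divisibility using (_∣_; _∤_; _∣?_; m*n∣⇒m∣)
  open import Data.Nat.Primality
  open import Data.Integer as ℤ using (ℤ; +_; -[1+_])
  import Data.Integer.Properties as ℤₚ
  open import Data.Rational as ℚ using (ℚ; 0ℚ; 1ℚ; _*_; _+_; -_; _-_; ↥_; ↧_; ↧ₙ_; mkℚ)
  import Data.Rational.Properties as ℚₚ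
  open import Data.Rational.Literals using (fromℤ)
  open import Data.Rational.Solver using (module +-*-Solver)
  open import Data.Rational.Unnormalised using (mkℚᵘ; *≡*)
  import Data.Rational.Unnormalised.Properties as ℚᵘₚ
  open import Data.Sum using (_⊎_; inj₁; inj₂)
  open import Data.Product using (_,_; _×_)
  open import Relation.Nullary using (yes; no; contradiction)
  open import Relation.Binary.PropositionalEquality
  import Data.Nat.Coprimality as Coprime

  open Arithmetic

  -- The operations on ℚ reduce by a gcd, which blocks computation. The identities here are checked
  -- between unnormalised fractions, where the operations are plain formulas, and carried back by
  -- injectivity.
  fromℤ-* : ∀ i j → fromℤ (i ℤ.* j) ≡ fromℤ i * fromℤ j
  fromℤ-* i j = ℚₚ.toℚᵘ-injective (ℚᵘₚ.≃-sym (ℚₚ.toℚᵘ-homo-* (fromℤ i) (fromℤ j)))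

  fromℤ-+ : ∀ i j → fromℤ (i ℤ.+ j) ≡ fromℤ i + fromℤ j
  fromℤ-+ i j = ℚₚ.toℚᵘ-injective (ℚᵘₚ.≃-sym (ℚᵘₚ.≃-trans (ℚₚ.toℚᵘ-homo-+ (fromℤ i) (fromℤ j))
    (*≡* (cong (ℤ._* + 1) (cong₂ ℤ._+_ (ℤₚ.*-identityʳ i) (ℤₚ.*-identityʳ j))))))

  fromℤ-injective : ∀ {i j} → fromℤ i ≡ fromℤ j → i ≡ j
  fromℤ-injective = cong ℚ.numerator

  q*y≡x⇒↥q*y≡x*↧q : ∀ q y x → q * fromℤ y ≡ fromℤ x → ↥ q ℤ.* y ≡ x ℤ.* ↧ q
  q*y≡x⇒↥q*y≡x*↧q q@(mkℚ n d _) y x eq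
    with ℚᵘₚ.≃-trans (ℚᵘₚ.≃-sym (ℚₚ.toℚᵘ-homo-* q (fromℤ y))) (ℚₚ.toℚᵘ-cong eq)
  ... | *≡* e = trans (sym (ℤₚ.*-identityʳ (n ℤ.* y))) (trans e (cong (λ t → x ℤ.* + t) (ℕₚ.*-identityʳ (suc d))))

  ↥q*y≡x*↧q⇒q*y≡x : ∀ q y x → ↥ q ℤ.* y ≡ x ℤ.* ↧ q → q * fromℤ y ≡ fromℤ x
  ↥q*y≡x*↧q⇒q*y≡x q@(mkℚ n d _) y x eq = ℚₚ.toℚᵘ-injective (ℚᵘₚ.≃-trans (ℚₚ.toℚᵘ-homo-* q (fromℤ y))
    (*≡* (trans (ℤₚ.*-identityʳ (n ℤ.* y)) (trans eq (cong (λ t → x ℤ.* + t) (sym (ℕₚ.*-identityʳ (suc d))))))))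

  *-cancelˡ : ∀ p {q r} → p ≢ 0ℚ → p * q ≡ p * r → q ≡ r
  *-cancelˡ p {q} {r} p≢0 eq = begin
    q                     ≡⟨ ℚₚ.*-identityˡ q ⟨
    1ℚ * q                ≡⟨ cong (_* q) (ℚₚ.*-inverseˡ p) ⟨
    (ℚ.1/ p * p) * q      ≡⟨ ℚₚ.*-assoc (ℚ.1/ p) p q ⟩
    ℚ.1/ p * (p * q)      ≡⟨ cong (ℚ.1/ p *_) eq ⟩
    ℚ.1/ p * (p * r)      ≡⟨ ℚₚ.*-assoc (ℚ.1/ p) p r ⟨
    (ℚ.1/ p * p) * r      ≡⟨ cong (_* r) (ℚₚ.*-inverseˡ p) ⟩
    1ℚ * r                ≡⟨ ℚₚ.*-identityˡ r ⟩
    r                     ∎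
    where
    open ≡-Reasoning
    instance _ = ℚ.≢-nonZero p≢0

  ÷-* : ∀ p q .{{_ : ℚ.NonZero q}} → (p ℚ.÷ q) * q ≡ p
  ÷-* p q = trans (ℚₚ.*-assoc p (ℚ.1/ q) q) (trans (cong (p *_) (ℚₚ.*-inverseˡ q)) (ℚₚ.*-identityʳ p))

  1/n*n≡1 : ∀ n .{{_ : ℕ.NonZero n}} → ((+ 1) ℚ./ n) * fromℤ (+ n) ≡ 1ℚ
  1/n*n≡1 (suc n) = ℚₚ.toℚᵘ-injective
    (ℚᵘₚ.≃-trans (ℚₚ.toℚᵘ-homo-* (ℚ.fromℚᵘ (mkℚᵘ (+ 1) n)) (fromℤ (+ suc n)))
    (ℚᵘₚ.≃-trans (ℚᵘₚ.*-congʳ (ℚₚ.toℚᵘ-fromℚᵘ (mkℚᵘ (+ 1) n)))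
    (*≡* (cong +_ (trans (ℕₚ.*-identityʳ (suc n ℕ.+ 0)) (sym (cong (λ t → suc (t ℕ.+ 0)) (ℕₚ.*-identityʳ n))))))))

  ^ℤ-neg : ∀ n .{{_ : ℕ.NonZero n}} k → (n ^ℤ (ℤ.- + k)) * fromℤ (+ (n ℕ.^ k)) ≡ 1ℚ
  ^ℤ-neg n zero    = refl
  ^ℤ-neg n (suc k) = 1/n*n≡1 (n ℕ.^ suc k) {{ℕₚ.m^n≢0 n (suc k)}}

  -- Floored division of a negative integer distinguishes whether the remainder is zero. Evaluating
  -- `⌈ + n /ℕ 2 ⌉` therefore takes the remainder and the quotient together.
  suc-%2 : ∀ n → (suc n ℕ.% 2 ≡ 0 × suc n ℕ./ 2 ≡ ℕ.⌈ suc n /2⌉) ⊎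
                 (suc n ℕ.% 2 ≡ 1 × suc (suc n ℕ./ 2) ≡ ℕ.⌈ suc n /2⌉)
  suc-%2 zero = inj₂ (refl , refl)
  suc-%2 (suc zero) = inj₁ (refl , refl)
  suc-%2 (suc (suc n)) with suc-%2 n
  ... | inj₁ (r , q) = inj₁ (r , trans (ℕ.m/n≡1+[m∸n]/n {suc (suc (suc n))} {2} 2≤) (cong suc q))
    where 2≤ = ℕ.s≤s (ℕ.s≤s ℕ.z≤n)
  ... | inj₂ (r , q) = inj₂ (r , cong suc (trans (ℕ.m/n≡1+[m∸n]/n {suc (suc (suc n))} {2} 2≤) q))
    where 2≤ = ℕ.s≤s (ℕ.s≤s ℕ.z≤n)

  ⌈+n/2⌉ : ∀ n → ⌈ + n /ℕ 2 ⌉ ≡ + ℕ.⌈ n /2⌉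
  ⌈+n/2⌉ zero = refl
  ⌈+n/2⌉ (suc n) with suc n ℕ.% 2 | suc-%2 n
  ... | zero  | inj₁ (_ , q) = trans (ℤₚ.neg-involutive (+ (suc n ℕ./ 2))) (cong +_ q)
  ... | suc _ | inj₂ (_ , q) = cong +_ q

  ⌈-n/3⌉ : ∀ n → ⌈ ℤ.- + n /ℕ 3 ⌉ ≡ ℤ.- + (n ℕ./ 3)
  ⌈-n/3⌉ zero    = refl
  ⌈-n/3⌉ (suc n) = refl

  ord≡0 : ∀ {p n} .{{_ : ℕ.NonZero n}} → Prime p → p ∤ n → ordℕ p n ≡ 0
  ord≡0 {p} {n} pr p∤n with ordℕ p n | ord-∣ p n
  ... | zero  | _ = refl
  ... | suc e | d = contradiction (m*n∣⇒m∣ p (p ℕ.^ e) d) p∤n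

  -- Numerator and denominator of N a.
  N↑ N↓ : ℚ → ℕ
  N↑ a = √⌈ ℤ.∣ ↥ a ∣ ℕ.⊔ ↧ₙ a ⌉ ℤ.∣ ↥ a ∣
  N↓ a = ∛⌊ ℤ.∣ ↥ a ∣ ℕ.⊔ ↧ₙ a ⌋ (↧ₙ a)

  coprime-↥↧ : ∀ a → Coprime.Coprime ℤ.∣ ↥ a ∣ (↧ₙ a)
  coprime-↥↧ (mkℚ n d c) = Coprime.recompute c

  ∣↥∣-nonZero : ∀ a → a ≢ 0ℚ → ℕ.NonZero ℤ.∣ ↥ a ∣
  ∣↥∣-nonZero a a≢0 = ℕ.≢-nonZero λ eq → a≢0 (ℚₚ.↥p≡0⇒p≡0 a (ℤₚ.∣i∣≡0⇒i≡0 eq))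

  module _ (a : ℚ) (a≢0 : a ≢ 0ℚ) where

    private
      u v : ℕ
      u = ℤ.∣ ↥ a ∣
      v = ↧ₙ a
      instance
        _ : ℕ.NonZero u
        _ = ∣↥∣-nonZero a a≢0

    α-nonNeg : ∀ p n → ord p a ≡ + n → α-exponent p a ≡ + ℕ.⌈ n /2⌉
    α-nonNeg p n eq with + 0 ℤ.≤? ord p a
    ... | yes _ rewrite eq = ⌈+n/2⌉ n
    ... | no ≱0 = contradiction (subst (+ 0 ℤ.≤_) (sym eq) (ℤ.+≤+ ℕ.z≤n)) ≱0

    α-nonPos : ∀ p n → ord p a ≡ ℤ.- + n → α-exponent p a ≡ ℤ.- + (n ℕ./ 3)
    -- Order 0 falls under the rule for nonnegative orders; both rules give the exponent 0 there.
    α-nonPos p zero    eq = α-nonNeg p zero eq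
    α-nonPos p (suc n) eq with + 0 ℤ.≤? ord p a
    ... | no _ rewrite eq = ⌈-n/3⌉ (suc n)
    ... | yes ≥0 with subst (+ 0 ℤ.≤_) eq ≥0
    ...   | ()

    -- As a is in lowest terms, p divides at most one of u and v. So the exponent is ⌈ord u / 2⌉ or
    -- -⌊ord v / 3⌋, while the other order is 0.
    N-factor : ∀ p .{{_ : ℕ.NonZero p}} → Prime p →
      (p ^ℤ α-exponent p a) * fromℤ (+ (p ℕ.^ (ordℕ p v ℕ./ 3))) ≡ fromℤ (+ (p ℕ.^ ℕ.⌈ ordℕ p u /2⌉))
    N-factor p pr with p ∣? v
    ... | no p∤v = trans (cong₂ (λ t f → (p ^ℤ t) * fromℤ (+ (p ℕ.^ (f ℕ./ 3)))) (α-nonNeg p (ordℕ p u) eq) (ord≡0 {n = v} pr p∤v))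
                         (ℚₚ.*-identityʳ _)
      where
      eq : ord p a ≡ + ordℕ p u
      eq = trans (cong (λ t → + ordℕ p u ℤ.- + t) (ord≡0 {n = v} pr p∤v)) (ℤₚ.+-identityʳ _)
    ... | yes p∣v = trans (cong (λ t → (p ^ℤ t) * fromℤ (+ (p ℕ.^ (ordℕ p v ℕ./ 3)))) (α-nonPos p (ordℕ p v) eq))
                   (trans (^ℤ-neg p (ordℕ p v ℕ./ 3)) (cong (λ t → fromℤ (+ (p ℕ.^ ℕ.⌈ t /2⌉))) (sym ordu≡0)))
      where
      ordu≡0 : ordℕ p u ≡ 0
      ordu≡0 = ord≡0 {n = u} pr λ p∣u → ¬prime[1] (subst Prime (coprime-↥↧ a (p∣u , p∣v)) pr)
      eq : ord p a ≡ ℤ.- + ordℕ p v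
      eq = trans (cong (λ t → + t ℤ.- + ordℕ p v) ordu≡0) (ℤₚ.+-identityˡ _)

    ∏-fraction : ∀ n → (∏[p≤ n ]p^ (λ p → α-exponent p a)) * fromℤ (+ ∏ n (λ p → ordℕ p v ℕ./ 3))
                     ≡ fromℤ (+ ∏ n (λ p → ℕ.⌈ ordℕ p u /2⌉))
    ∏-fraction zero = refl
    ∏-fraction (suc n) with prime? (suc n)
    ... | no _ = ∏-fraction n
    ... | yes pr = begin
      (A * A′) * fromℤ (+ (b ℕ.* b′))              ≡⟨ cong (λ t → (A * A′) * fromℤ t) (ℤₚ.pos-* b b′) ⟩
      (A * A′) * fromℤ (+ b ℤ.* + b′)              ≡⟨ cong ((A * A′) *_) (fromℤ-* (+ b) (+ b′)) ⟩
      (A * A′) * (fromℤ (+ b) * fromℤ (+ b′))      ≡⟨ solve 4 (λ x y z w → (x :* y) :* (z :* w) := (x :* z) :* (y :* w)) refl A A′ (fromℤ (+ b)) (fromℤ (+ b′)) ⟩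
      (A * fromℤ (+ b)) * (A′ * fromℤ (+ b′))      ≡⟨ cong₂ _*_ (N-factor (suc n) pr) (∏-fraction n) ⟩
      fromℤ (+ c) * fromℤ (+ c′)                   ≡⟨ fromℤ-* (+ c) (+ c′) ⟨
      fromℤ (+ c ℤ.* + c′)                         ≡⟨ cong fromℤ (ℤₚ.pos-* c c′) ⟨
      fromℤ (+ (c ℕ.* c′))                         ∎
      where
      open ≡-Reasoning
      open +-*-Solver
      A = suc n ^ℤ α-exponent (suc n) a
      A′ = ∏[p≤ n ]p^ (λ p → α-exponent p a)
      b = suc n ℕ.^ (ordℕ (suc n) v ℕ./ 3)
      b′ = ∏ n (λ p → ordℕ p v ℕ./ 3)
      c = suc n ℕ.^ ℕ.⌈ ordℕ (suc n) u /2⌉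
      c′ = ∏ n (λ p → ℕ.⌈ ordℕ p u /2⌉)

    N-fraction : ↥ N a ℤ.* + N↓ a ≡ + N↑ a ℤ.* ↧ N a
    N-fraction = q*y≡x⇒↥q*y≡x*↧q (N a) (+ N↓ a) (+ N↑ a) (∏-fraction (u ℕ.⊔ v))

-- The one-parameter families of curves with given j

module Curves where

  open import Data.Nat as ℕ using (ℕ; zero; suc)
  import Data.Nat.Properties as ℕₚ
  import Data.Nat.Divisibility as ℕ
  open import Data.Nat.Coprimality using (Coprime; coprime-divisor; coprime-/gcd)
  import Data.Nat.Coprimality as Coprime
  open import Data.Nat.GCD using (gcd; gcd[m,n]∣m; gcd[m,n]∣n; gcd[m,n]≢0)
  open import Data.Nat.DivMod using (m/n*n≡m)
  import Data.Nat.Solver as ℕS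
  open import Data.Nat.Primality
  open import Data.Integer as ℤ using (ℤ; +_; -[1+_]; +[1+_])
  import Data.Integer.Divisibility as ℤ
  import Data.Integer.Divisibility.Signed as ℤˢ
  import Data.Integer.Properties as ℤₚ
  import Data.Integer.Solver as ℤS
  open import Algebra.Bundles using (module AbelianGroup; CommutativeRing)
  import Algebra.Solver.Ring.NaturalCoefficients.Default as Natural
  open import Algebra.Properties.CommutativeSemigroup ℤₚ.*-commutativeSemigroup using (interchange)
  open import Algebra.Properties.Group (AbelianGroup.group ℤₚ.+-0-abelianGroup) using (∙-cancelˡ)
  open import Data.Rational as ℚ using (ℚ; 0ℚ; ↥_; ↧_; ↧ₙ_)
  import Data.Rational.Properties as ℚₚ
  open import Data.Rational.Literals using (fromℤ)
  import Data.Rational.Solver as ℚS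
  open import Data.Sum using (_⊎_; inj₁; inj₂; [_,_]′)
  open import Data.Product using (_,_; _×_; ∃-syntax; proj₁; proj₂)
  open import Function using (_∘_; id; _⇔_; mk⇔; it)
  open import Relation.Nullary using (contradiction)
  open import Relation.Binary.Definitions using (tri<; tri≈; tri>)
  open import Relation.Binary.PropositionalEquality

  open Arithmetic
  open Rationals

  NonMinimal : Curve → Set
  NonMinimal (A , B) = ∃[ p ] (Prime p × ((+ p) ℤ.^ 4) ℤ.∣ A × ((+ p) ℤ.^ 6) ℤ.∣ B)

  HasPowerDivisor : ℕ → ℕ → Set
  HasPowerDivisor s n = ∃[ p ] (Prime p × p ℕ.^ s ℕ.∣ n)

  -- All that the count needs to know about the curves of one j apart from their heights. The
  -- parameter 0 is excluded because it gives the singular curve y² = x³.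
  record Parametrisation (j : ℚ) (s : ℕ) : Set where
    field
      φ           : ℤ → Curve
      φ-injective : ∀ {k l} → φ k ≡ φ l → k ≡ l
      φ-sound     : ∀ {k} → k ≢ + 0 → Ẽ[ j ] (φ k)
      φ-complete  : ∀ {E} → Ẽ[ j ] E → ∃[ k ] (k ≢ + 0 × φ k ≡ E)
      φ-minimal   : ∀ {k} → k ≢ + 0 → NonMinimal (φ k) ⇔ HasPowerDivisor s ℤ.∣ k ∣

  abs-^ : ∀ i n → ℤ.∣ i ℤ.^ n ∣ ≡ ℤ.∣ i ∣ ℕ.^ n
  abs-^ i zero    = refl
  abs-^ i (suc n) = trans (ℤₚ.abs-* i (i ℤ.^ n)) (cong (ℤ.∣ i ∣ ℕ.*_) (abs-^ i n))

  ^-distrib-* : ∀ n i j → (i ℤ.* j) ℤ.^ n ≡ i ℤ.^ n ℤ.* j ℤ.^ n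
  ^-distrib-* zero    i j = refl
  ^-distrib-* (suc n) i j = trans (cong (i ℤ.* j ℤ.*_) (^-distrib-* n i j)) (interchange i j (i ℤ.^ n) (j ℤ.^ n))

  i≢0 : ∀ i .{{_ : ℤ.NonZero i}} → i ≢ + 0
  i≢0 +[1+ n ] ()
  i≢0 -[1+ n ] ()

  Δ≢0 : ∀ E → 4A³+27B² E ≢ + 0 → Ẽ E
  Δ≢0 E d≢0 eq with ℤₚ.i*j≡0⇒i≡0∨j≡0 (ℤ.- (+ 16)) eq
  ... | inj₁ ()
  ... | inj₂ d≡0 = d≢0 d≡0

  module _ (A B : ℤ) (e : Ẽ (A , B)) where

    private
      E : Curve
      E = A , B
      d = 4A³+27B² E
      Fd≢0 : fromℤ d ≢ 0ℚ
      Fd≢0 = 4A³+27B²≢0 E e ∘ fromℤ-injective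

    jInvariant-* : fromℤ d ℚ.* jInvariant E e ≡ 1728ℚ ℚ.* fromℤ (+ 4 ℤ.* A ℤ.^ 3)
    jInvariant-* = begin
      fromℤ d ℚ.* (1728ℚ ℚ.* q)     ≡⟨ solve 3 (λ x y z → x :* (y :* z) := y :* (z :* x)) refl (fromℤ d) 1728ℚ q ⟩
      1728ℚ ℚ.* (q ℚ.* fromℤ d)     ≡⟨ cong (1728ℚ ℚ.*_) (÷-* (fromℤ (+ 4 ℤ.* A ℤ.^ 3)) (fromℤ d)) ⟩
      1728ℚ ℚ.* fromℤ (+ 4 ℤ.* A ℤ.^ 3) ∎
      where
      open ≡-Reasoning
      open ℚS.+-*-Solver
      instance _ = fromℤ-nonZero (4A³+27B²≢0 E e)
      q = fromℤ (+ 4 ℤ.* A ℤ.^ 3) ℚ.÷ fromℤ d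

    jInvariant≡⇔ : ∀ {j} → jInvariant E e ≡ j ⇔ (fromℤ d ℚ.* j ≡ 1728ℚ ℚ.* fromℤ (+ 4 ℤ.* A ℤ.^ 3))
    jInvariant≡⇔ = mk⇔ (λ { refl → jInvariant-* }) (λ eq → *-cancelˡ (fromℤ d) Fd≢0 (trans jInvariant-* (sym eq)))

  open Function.Equivalence using (to; from)

  ∣i∣≡∣j∣⇒i≡±j : ∀ i j → ℤ.∣ i ∣ ≡ ℤ.∣ j ∣ → i ≡ j ⊎ i ≡ ℤ.- j
  ∣i∣≡∣j∣⇒i≡±j (+ m)    (+ n)    refl = inj₁ refl
  ∣i∣≡∣j∣⇒i≡±j (+ m)    -[1+ n ] refl = inj₂ refl
  ∣i∣≡∣j∣⇒i≡±j -[1+ m ] +[1+ n ] refl = inj₂ refl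
  ∣i∣≡∣j∣⇒i≡±j -[1+ m ] -[1+ n ] refl = inj₁ refl

  p^n∣∣i∣⇒p^n∣i : ∀ p n i → p ℕ.^ n ℕ.∣ ℤ.∣ i ∣ → ((+ p) ℤ.^ n) ℤ.∣ i
  p^n∣∣i∣⇒p^n∣i p n i = subst (ℕ._∣ ℤ.∣ i ∣) (sym (abs-^ (+ p) n))

  p^n∣i⇒p^n∣∣i∣ : ∀ p n i → ((+ p) ℤ.^ n) ℤ.∣ i → p ℕ.^ n ℕ.∣ ℤ.∣ i ∣
  p^n∣i⇒p^n∣∣i∣ p n i = subst (ℕ._∣ ℤ.∣ i ∣) (abs-^ (+ p) n)

  i∣0 : ∀ i → i ℤ.∣ + 0
  i∣0 i = ℤ.∣ i ∣ ℕ.∣0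

  minimal₀ : ∀ k → NonMinimal (+ 0 , k) ⇔ HasPowerDivisor 6 ℤ.∣ k ∣
  minimal₀ k = mk⇔ (λ (p , pr , _ , d) → p , pr , p^n∣i⇒p^n∣∣i∣ p 6 k d)
                   (λ (p , pr , d) → p , pr , i∣0 ((+ p) ℤ.^ 4) , p^n∣∣i∣⇒p^n∣i p 6 k d)

  minimal₁₇₂₈ : ∀ k → NonMinimal (k , + 0) ⇔ HasPowerDivisor 4 ℤ.∣ k ∣
  minimal₁₇₂₈ k = mk⇔ (λ (p , pr , d , _) → p , pr , p^n∣i⇒p^n∣∣i∣ p 4 k d)
                      (λ (p , pr , d) → p , pr , p^n∣∣i∣⇒p^n∣i p 4 k d , i∣0 ((+ p) ℤ.^ 6))

  parametrisation₀ : Parametrisation 0ℚ 6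
  parametrisation₀ = record
    { φ           = λ k → (+ 0 , k)
    ; φ-injective = cong proj₂
    ; φ-sound     = λ {k} → sound {k}
    ; φ-complete  = λ {E} → complete {E}
    ; φ-minimal   = λ {k} _ → minimal₀ k
    }
    where
    sound : ∀ {k} → k ≢ + 0 → Ẽ[ 0ℚ ] (+ 0 , k)
    sound {k} k≢0 = e , from (jInvariant≡⇔ (+ 0) k e) (ℚₚ.*-zeroʳ (fromℤ (4A³+27B² (+ 0 , k))))
      where
      e : Ẽ (+ 0 , k)
      e = Δ≢0 (+ 0 , k) λ eq → k≢0 (ℤₚ.i^n≡0⇒i≡0 k 2 ([ (λ ()) , id ]′ (ℤₚ.i*j≡0⇒i≡0∨j≡0 (+ 27) (trans (sym (ℤₚ.+-identityˡ _)) eq))))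
    complete : ∀ {E} → Ẽ[ 0ℚ ] E → ∃[ k ] (k ≢ + 0 × (+ 0 , k) ≡ E)
    complete {E@(A , B)} (e , j≡) = B , (λ { refl → e (cong₂ (λ a b → ℤ.- + 16 ℤ.* (+ 4 ℤ.* a ℤ.^ 3 ℤ.+ b)) A≡0 refl) }) , cong (_, B) (sym A≡0)
      where
      1728*4A³≡0 : + 1728 ℤ.* (+ 4 ℤ.* A ℤ.^ 3) ≡ + 0
      1728*4A³≡0 = fromℤ-injective (trans (fromℤ-* (+ 1728) (+ 4 ℤ.* A ℤ.^ 3)) (trans (sym (to (jInvariant≡⇔ A B e) j≡)) (ℚₚ.*-zeroʳ (fromℤ (4A³+27B² E)))))
      A≡0 : A ≡ + 0
      A≡0 = ℤₚ.i^n≡0⇒i≡0 A 3 ([ (λ ()) , id ]′ (ℤₚ.i*j≡0⇒i≡0∨j≡0 (+ 4) ([ (λ ()) , id ]′ (ℤₚ.i*j≡0⇒i≡0∨j≡0 (+ 1728) 1728*4A³≡0))))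

  parametrisation₁₇₂₈ : Parametrisation 1728ℚ 4
  parametrisation₁₇₂₈ = record
    { φ           = λ k → (k , + 0)
    ; φ-injective = cong proj₁
    ; φ-sound     = λ {k} → sound {k}
    ; φ-complete  = λ {E} → complete {E}
    ; φ-minimal   = λ {k} _ → minimal₁₇₂₈ k
    }
    where
    sound : ∀ {k} → k ≢ + 0 → Ẽ[ 1728ℚ ] (k , + 0)
    sound {k} k≢0 = e , from (jInvariant≡⇔ k (+ 0) e) (trans (ℚₚ.*-comm (fromℤ (4A³+27B² (k , + 0))) 1728ℚ) (cong (λ t → 1728ℚ ℚ.* fromℤ t) (ℤₚ.+-identityʳ (+ 4 ℤ.* k ℤ.^ 3))))
      where
      e : Ẽ (k , + 0)
      e = Δ≢0 (k , + 0) λ eq → k≢0 (ℤₚ.i^n≡0⇒i≡0 k 3 ([ (λ ()) , id ]′ (ℤₚ.i*j≡0⇒i≡0∨j≡0 (+ 4) (trans (sym (ℤₚ.+-identityʳ _)) eq))))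
    complete : ∀ {E} → Ẽ[ 1728ℚ ] E → ∃[ k ] (k ≢ + 0 × (k , + 0) ≡ E)
    complete {E@(A , B)} (e , j≡) = A , (λ { refl → e (cong (λ b → ℤ.- + 16 ℤ.* (+ 0 ℤ.+ + 27 ℤ.* b ℤ.^ 2)) B≡0) }) , cong (A ,_) (sym B≡0)
      where
      eq : 4A³+27B² E ≡ + 4 ℤ.* A ℤ.^ 3
      eq = fromℤ-injective (*-cancelˡ 1728ℚ (λ ()) (trans (ℚₚ.*-comm 1728ℚ (fromℤ (4A³+27B² E))) (to (jInvariant≡⇔ A B e) j≡)))
      27B²≡0 : + 27 ℤ.* B ℤ.^ 2 ≡ + 0
      27B²≡0 = ∙-cancelˡ (+ 4 ℤ.* A ℤ.^ 3) _ _ (trans eq (sym (ℤₚ.+-identityʳ _)))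
      B≡0 : B ≡ + 0
      B≡0 = ℤₚ.i^n≡0⇒i≡0 B 2 ([ (λ ()) , id ]′ (ℤₚ.i*j≡0⇒i≡0∨j≡0 (+ 27) 27B²≡0))

  -- With x = m n₁ and n₂ = l y the multiplier is m l, which is x/y divided by n₁/n₂. Cancelling u
  -- y³ from the equation determines g = w l³ r m², and both products follow by substitution.
  ∃-multiplier : ∀ {u v n₁ n₂ r w x y g} .{{_ : ℕ.NonZero u}} .{{_ : ℕ.NonZero y}} →
    n₁ ℕ.^ 2 ≡ r ℕ.* u → v ≡ w ℕ.* n₂ ℕ.^ 3 → n₁ ℕ.∣ x → y ℕ.∣ n₂ →
    v ℕ.* x ℕ.^ 2 ≡ u ℕ.* y ℕ.^ 3 ℕ.* g →
    ∃[ k ] (y ℕ.* g ≡ k ℕ.^ 2 ℕ.* (r ℕ.* w ℕ.* n₂) × x ℕ.* g ≡ k ℕ.^ 3 ℕ.* (r ℕ.* w ℕ.* n₁))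
  ∃-multiplier {u} {v} {n₁} {n₂} {r} {w} {x} {y} {g} n₁²≡ v≡ (ℕ.divides m refl) (ℕ.divides l refl) eq =
    m ℕ.* l , y*g≡ , x*g≡
    where
    open ≡-Reasoning
    open ℕS.+-*-Solver
    g≡ : g ≡ w ℕ.* l ℕ.^ 3 ℕ.* r ℕ.* m ℕ.^ 2
    g≡ = ℕₚ.*-cancelˡ-≡ g _ (u ℕ.* y ℕ.^ 3) {{ℕₚ.m*n≢0 u (y ℕ.^ 3) {{it}} {{ℕₚ.m^n≢0 y 3}}}} (begin
      u ℕ.* y ℕ.^ 3 ℕ.* g                          ≡⟨ eq ⟨
      v ℕ.* (m ℕ.* n₁) ℕ.^ 2                       ≡⟨ solve 3 (λ v m n → v :* (m :* n) :^ 2 := v :* m :^ 2 :* n :^ 2) refl v m n₁ ⟩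
      v ℕ.* m ℕ.^ 2 ℕ.* n₁ ℕ.^ 2                   ≡⟨ cong₂ (λ s t → s ℕ.* m ℕ.^ 2 ℕ.* t) v≡ n₁²≡ ⟩
      w ℕ.* (l ℕ.* y) ℕ.^ 3 ℕ.* m ℕ.^ 2 ℕ.* (r ℕ.* u)
        ≡⟨ solve 6 (λ w l y m r u → w :* (l :* y) :^ 3 :* m :^ 2 :* (r :* u) := u :* y :^ 3 :* (w :* l :^ 3 :* r :* m :^ 2)) refl w l y m r u ⟩
      u ℕ.* y ℕ.^ 3 ℕ.* (w ℕ.* l ℕ.^ 3 ℕ.* r ℕ.* m ℕ.^ 2) ∎)
    y*g≡ : y ℕ.* g ≡ (m ℕ.* l) ℕ.^ 2 ℕ.* (r ℕ.* w ℕ.* (l ℕ.* y))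
    y*g≡ = trans (cong (y ℕ.*_) g≡) (solve 5 (λ y w l r m → y :* (w :* l :^ 3 :* r :* m :^ 2) := (m :* l) :^ 2 :* (r :* w :* (l :* y))) refl y w l r m)
    x*g≡ : m ℕ.* n₁ ℕ.* g ≡ (m ℕ.* l) ℕ.^ 3 ℕ.* (r ℕ.* w ℕ.* n₁)
    x*g≡ = trans (cong (m ℕ.* n₁ ℕ.*_) g≡) (solve 5 (λ n w l r m → m :* n :* (w :* l :^ 3 :* r :* m :^ 2) := (m :* l) :^ 3 :* (r :* w :* n)) refl n₁ w l r m)

  i≡-i⇒i≡0 : ∀ {i} → i ≡ ℤ.- i → i ≡ + 0
  i≡-i⇒i≡0 {+ zero} _ = refl

  m^n-injective : ∀ n .{{_ : ℕ.NonZero n}} {k l} → k ℕ.^ n ≡ l ℕ.^ n → k ≡ l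
  m^n-injective n {k} {l} eq with ℕₚ.<-cmp k l
  ... | tri< k<l _ _ = contradiction eq (ℕₚ.<⇒≢ (ℕₚ.^-monoˡ-< n k<l))
  ... | tri≈ _ k≡l _ = k≡l
  ... | tri> _ _ k>l = contradiction (sym eq) (ℕₚ.<⇒≢ (ℕₚ.^-monoˡ-< n k>l))

  signed-abs : ∀ i → ∃[ s ] (i ≡ s ℤ.* + ℤ.∣ i ∣ × s ℤ.* s ≡ + 1)
  signed-abs i with ∣i∣≡∣j∣⇒i≡±j i (+ ℤ.∣ i ∣) refl
  ... | inj₁ eq = + 1 , trans eq (sym (ℤₚ.*-identityˡ _)) , refl
  ... | inj₂ eq = ℤ.- + 1 , trans eq (sym (ℤₚ.-1*i≡-i _)) , refl

  -- Stated over an abstract ring: over ℤ the conversion checker unfolds _*_.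
  module BaseSolution {c ℓ} (R : CommutativeRing c ℓ) where
    open CommutativeRing R hiding (refl)
    ≈-refl : ∀ {x} → x ≈ x
    ≈-refl = CommutativeRing.refl R
    open Natural commutativeSemiring
    identity₁ : ∀ s r w l m → (w * m) * ((s * (r * l)) * ((s * (r * l)) * 1#)) ≈ (s * s) * (w * m * (r * (r * 1#)) * (l * (l * 1#)))
    identity₁ = solve 5 (λ s r w l m → (w :* m) :* ((s :* (r :* l)) :* ((s :* (r :* l)) :* con 1)) := (s :* s) :* (w :* m :* (r :* (r :* con 1)) :* (l :* (l :* con 1)))) ≈-refl
    identity₂ : ∀ s r w u m → ((s * s) * (s * s)) * (w * (m * (m * (m * 1#))) * ((r * w) * ((r * w) * 1#)) * (r * u)) ≈ (s * u) * ((s * ((r * w) * m)) * ((s * ((r * w) * m)) * ((s * ((r * w) * m)) * 1#)))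
    identity₂ = solve 5 (λ s r w u m → ((s :* s) :* (s :* s)) :* (w :* (m :* (m :* (m :* con 1))) :* ((r :* w) :* ((r :* w) :* con 1)) :* (r :* u)) := (s :* u) :* ((s :* ((r :* w) :* m)) :* ((s :* ((r :* w) :* m)) :* ((s :* ((r :* w) :* m)) :* con 1)))) ≈-refl

  open BaseSolution ℤₚ.+-*-commutativeRing

  pos-^ : ∀ m n → + (m ℕ.^ n) ≡ (+ m) ℤ.^ n
  pos-^ m zero    = refl
  pos-^ m (suc n) = trans (ℤₚ.pos-* m (m ℕ.^ n)) (cong (+ m ℤ.*_) (pos-^ m n))

  base-solution : ∀ {s} {u v n₁ n₂ r w} → s ℤ.* s ≡ + 1 → n₁ ℕ.^ 2 ≡ r ℕ.* u → v ≡ w ℕ.* n₂ ℕ.^ 3 →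
    + v ℤ.* (s ℤ.* + (r ℕ.* w ℕ.* n₁)) ℤ.^ 2 ≡ (s ℤ.* + u) ℤ.* (s ℤ.* + (r ℕ.* w ℕ.* n₂)) ℤ.^ 3
  base-solution {s} {u} {v} {n₁} {n₂} {r} {w} s*s≡1 n₁²≡r*u v≡w*n₂³ = begin
    + v ℤ.* (s ℤ.* + (r ℕ.* w ℕ.* n₁)) ℤ.^ 2
      ≡⟨ cong₂ (λ x y → x ℤ.* (s ℤ.* y) ℤ.^ 2) (trans (cong +_ v≡w*n₂³) (trans (ℤₚ.pos-* w (n₂ ℕ.^ 3)) (cong (+ w ℤ.*_) (pos-^ n₂ 3)))) (pos-rwn n₁) ⟩
    (+ w ℤ.* (+ n₂) ℤ.^ 3) ℤ.* (s ℤ.* (R ℤ.* + n₁)) ℤ.^ 2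
      ≡⟨ identity₁ s R (+ w) (+ n₁) ((+ n₂) ℤ.^ 3) ⟩
    (s ℤ.* s) ℤ.* (+ w ℤ.* (+ n₂) ℤ.^ 3 ℤ.* R ℤ.^ 2 ℤ.* (+ n₁) ℤ.^ 2)
      -- The left side of the equation contains s², the right side s⁴; both are 1.
      ≡⟨ cong₂ (λ x y → x ℤ.* (+ w ℤ.* (+ n₂) ℤ.^ 3 ℤ.* R ℤ.^ 2 ℤ.* y)) (trans s*s≡1 (sym (cong₂ ℤ._*_ s*s≡1 s*s≡1))) (trans (sym (pos-^ n₁ 2)) (trans (cong +_ n₁²≡r*u) (ℤₚ.pos-* r u))) ⟩
    ((s ℤ.* s) ℤ.* (s ℤ.* s)) ℤ.* (+ w ℤ.* (+ n₂) ℤ.^ 3 ℤ.* R ℤ.^ 2 ℤ.* (+ r ℤ.* + u))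
      ≡⟨ identity₂ s (+ r) (+ w) (+ u) (+ n₂) ⟩
    (s ℤ.* + u) ℤ.* (s ℤ.* (R ℤ.* + n₂)) ℤ.^ 3
      ≡⟨ cong (λ y → (s ℤ.* + u) ℤ.* (s ℤ.* y) ℤ.^ 3) (pos-rwn n₂) ⟨
    (s ℤ.* + u) ℤ.* (s ℤ.* + (r ℕ.* w ℕ.* n₂)) ℤ.^ 3 ∎
    where
    open ≡-Reasoning
    open ℤS.+-*-Solver
    R : ℤ
    R = + r ℤ.* + w
    pos-rwn : ∀ n → + (r ℕ.* w ℕ.* n) ≡ R ℤ.* + n
    pos-rwn n = trans (ℤₚ.pos-* (r ℕ.* w) n) (cong (ℤ._* + n) (ℤₚ.pos-* r w))

  ∣i^n*j∣ : ∀ i n j → ℤ.∣ i ℤ.^ n ℤ.* j ∣ ≡ ℤ.∣ i ∣ ℕ.^ n ℕ.* ℤ.∣ j ∣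
  ∣i^n*j∣ i n j = trans (ℤₚ.abs-* (i ℤ.^ n) j) (cong (ℕ._* ℤ.∣ j ∣) (abs-^ i n))

  i≡p^n*j⇒p^n∣∣i∣ : ∀ p n {i j} → i ≡ (+ p) ℤ.^ n ℤ.* j → p ℕ.^ n ℕ.∣ ℤ.∣ i ∣
  i≡p^n*j⇒p^n∣∣i∣ p n {j = j} refl = subst (p ℕ.^ n ℕ.∣_) (sym (∣i^n*j∣ (+ p) n j)) (ℕ.m∣m*n ℤ.∣ j ∣)

  p^2n∣∣k^n*i∣ : ∀ p k n i → p ℕ.^ 2 ℕ.∣ ℤ.∣ k ∣ → p ℕ.^ (2 ℕ.* n) ℕ.∣ ℤ.∣ k ℤ.^ n ℤ.* i ∣
  p^2n∣∣k^n*i∣ p k n i p²∣k = subst₂ ℕ._∣_ (ℕₚ.^-*-assoc p 2 n)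
    (sym (∣i^n*j∣ k n i))
    (ℕ.∣m⇒∣m*n ℤ.∣ i ∣ (^-monoˡ-∣ n p²∣k))

  [-i]² : ∀ i → (ℤ.- i) ℤ.^ 2 ≡ i ℤ.^ 2
  [-i]² = solve 1 (λ x → (:- x) :^ 2 := x :^ 2) refl
    where open ℤS.+-*-Solver

  [-i]³ : ∀ i → (ℤ.- i) ℤ.^ 3 ≡ ℤ.- (i ℤ.^ 3)
  [-i]³ = solve 1 (λ x → (:- x) :^ 3 := :- (x :^ 3)) refl
    where open ℤS.+-*-Solver

  i*[-j]³ : ∀ i j → i ℤ.* (ℤ.- j) ℤ.^ 3 ≡ ℤ.- (i ℤ.* j ℤ.^ 3)
  i*[-j]³ i j = trans (cong (i ℤ.*_) ([-i]³ j)) (sym (ℤₚ.neg-distribʳ-* i (j ℤ.^ 3)))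

  i*p^2n : ∀ n i p → i ℤ.* p ℤ.^ (2 ℕ.* n) ≡ (p ℤ.^ 2) ℤ.^ n ℤ.* i
  i*p^2n n i p = trans (ℤₚ.*-comm i (p ℤ.^ (2 ℕ.* n))) (cong (ℤ._* i) (sym (ℤₚ.^-*-assoc p 2 n)))

  p^n*[k^n*i] : ∀ n p k i → p ℤ.^ n ℤ.* (k ℤ.^ n ℤ.* i) ≡ (p ℤ.* k) ℤ.^ n ℤ.* i
  p^n*[k^n*i] n p k i = trans (sym (ℤₚ.*-assoc (p ℤ.^ n) (k ℤ.^ n) i)) (cong (ℤ._* i) (sym (^-distrib-* n p k)))

  i²i³-scale : ∀ v k b → v ℤ.* (k ℤ.^ 3 ℤ.* b) ℤ.^ 2 ≡ k ℤ.^ 6 ℤ.* (v ℤ.* b ℤ.^ 2)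
  i²i³-scale = solve 3 (λ v k b → v :* (k :^ 3 :* b) :^ 2 := k :^ 6 :* (v :* b :^ 2)) refl
    where open ℤS.+-*-Solver

  i³i²-scale : ∀ u k a → u ℤ.* (k ℤ.^ 2 ℤ.* a) ℤ.^ 3 ≡ k ℤ.^ 6 ℤ.* (u ℤ.* a ℤ.^ 3)
  i³i²-scale = solve 3 (λ u k a → u :* (k :^ 2 :* a) :^ 3 := k :^ 6 :* (u :* a :^ 3)) refl
    where open ℤS.+-*-Solver

  a[_]-* : ∀ j (j≢0 : j ≢ 0ℚ) → a[ j ] j≢0 ℚ.* (fromℤ (+ 27) ℚ.* j) ≡ fromℤ (+ 4) ℚ.* (1728ℚ ℚ.- j)
  a[ j ]-* j≢0 = ÷-* (fromℤ (+ 4) ℚ.* (1728ℚ ℚ.- j)) (fromℤ (+ 27) ℚ.* j) {{ℚ.≢-nonZero (27*≢0 j≢0)}}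

  a[_]≢0 : ∀ j (j≢0 : j ≢ 0ℚ) → j ≢ 1728ℚ → a[ j ] j≢0 ≢ 0ℚ
  a[ j ]≢0 j≢0 j≢1728 a≡0 = j≢1728 (sym (begin
    1728ℚ                  ≡⟨ solve 2 (λ x y → x := (x :- y) :+ y) refl 1728ℚ j ⟩
    (1728ℚ ℚ.- j) ℚ.+ j    ≡⟨ cong (ℚ._+ j) (*-cancelˡ (fromℤ (+ 4)) {1728ℚ ℚ.- j} {0ℚ} (λ ()) 4*≡0) ⟩
    0ℚ ℚ.+ j               ≡⟨ ℚₚ.+-identityˡ j ⟩
    j                      ∎))
    where
    open ≡-Reasoning
    open ℚS.+-*-Solver
    4*≡0 : fromℤ (+ 4) ℚ.* (1728ℚ ℚ.- j) ≡ fromℤ (+ 4) ℚ.* 0ℚ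
    4*≡0 = trans (sym (a[ j ]-* j≢0)) (trans (cong (ℚ._* (fromℤ (+ 27) ℚ.* j)) a≡0) (trans (ℚₚ.*-zeroˡ (fromℤ (+ 27) ℚ.* j)) (sym (ℚₚ.*-zeroʳ (fromℤ (+ 4))))))

  module Generic (j : ℚ) (j≢0 : j ≢ 0ℚ) (j≢1728 : j ≢ 1728ℚ) where

    a : ℚ
    a = a[ j ] j≢0

    a≢0 : a ≢ 0ℚ
    a≢0 = a[ j ]≢0 j≢0 j≢1728

    u v n₁ n₂ r w : ℕ
    u = ℤ.∣ ↥ a ∣
    v = ↧ₙ a
    n₁ = N↑ a
    n₂ = N↓ a

    instance
      u-nonZero : ℕ.NonZero u
      u-nonZero = ∣↥∣-nonZero a a≢0

    u∣n₁² : u ℕ.∣ n₁ ℕ.^ 2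
    u∣n₁² = u∣√⌈u⌉² (ℕₚ.m≤m⊔n u v)

    n₂³∣v : n₂ ℕ.^ 3 ℕ.∣ v
    n₂³∣v = ∛⌊v⌋³∣v (u ℕ.⊔ v) v

    r = ℕ.quotient u∣n₁²
    w = ℕ.quotient n₂³∣v

    n₁²≡r*u : n₁ ℕ.^ 2 ≡ r ℕ.* u
    n₁²≡r*u = ℕ._∣_.equality u∣n₁²

    v≡w*n₂³ : v ≡ w ℕ.* n₂ ℕ.^ 3
    v≡w*n₂³ = ℕ._∣_.equality n₂³∣v

    -- B² = a A³ multiplied by the denominator of a. Clearing denominators in j(E) = j gives 27 j B²
    -- = 4 (1728 - j) A³, and a is the quotient of the two coefficients.
    record Solution (A B : ℤ) : Set where
      constructor solution
      field equation : + v ℤ.* B ℤ.^ 2 ≡ ↥ a ℤ.* A ℤ.^ 3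

    open Solution

    solution⇔ : ∀ A B → Solution A B ⇔ (a ℚ.* fromℤ (A ℤ.^ 3) ≡ fromℤ (B ℤ.^ 2))
    solution⇔ A B = mk⇔
      (λ sol → ↥q*y≡x*↧q⇒q*y≡x a (A ℤ.^ 3) (B ℤ.^ 2) (trans (sym (equation sol)) (ℤₚ.*-comm (+ v) (B ℤ.^ 2))))
      (λ eq → solution (trans (ℤₚ.*-comm (+ v) (B ℤ.^ 2)) (sym (q*y≡x⇒↥q*y≡x*↧q a (A ℤ.^ 3) (B ℤ.^ 2) eq))))

    module _ (A B : ℤ) where

      private
        x y d c₄ c₂₇ : ℚ
        x = fromℤ (A ℤ.^ 3)
        y = fromℤ (B ℤ.^ 2)
        d = fromℤ (4A³+27B² (A , B))
        c₄ = fromℤ (+ 4)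
        c₂₇ = fromℤ (+ 27)

        d≡ : d ≡ c₄ ℚ.* x ℚ.+ c₂₇ ℚ.* y
        d≡ = trans (fromℤ-+ (+ 4 ℤ.* A ℤ.^ 3) (+ 27 ℤ.* B ℤ.^ 2)) (cong₂ ℚ._+_ (fromℤ-* (+ 4) (A ℤ.^ 3)) (fromℤ-* (+ 27) (B ℤ.^ 2)))

        open ≡-Reasoning
        open ℚS.+-*-Solver

        expand : (c₂₇ ℚ.* j) ℚ.* (a ℚ.* x) ≡ 1728ℚ ℚ.* (c₄ ℚ.* x) ℚ.- (c₄ ℚ.* x) ℚ.* j
        expand = begin
          (c₂₇ ℚ.* j) ℚ.* (a ℚ.* x)             ≡⟨ solve 3 (λ s a x → s :* (a :* x) := (a :* s) :* x) refl (c₂₇ ℚ.* j) a x ⟩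
          (a ℚ.* (c₂₇ ℚ.* j)) ℚ.* x             ≡⟨ cong (ℚ._* x) (a[ j ]-* j≢0) ⟩
          (c₄ ℚ.* (1728ℚ ℚ.- j)) ℚ.* x          ≡⟨ solve 4 (λ c m j x → (c :* (m :- j)) :* x := m :* (c :* x) :- (c :* x) :* j) refl c₄ 1728ℚ j x ⟩
          1728ℚ ℚ.* (c₄ ℚ.* x) ℚ.- (c₄ ℚ.* x) ℚ.* j ∎

      j⇒solution : d ℚ.* j ≡ 1728ℚ ℚ.* fromℤ (+ 4 ℤ.* A ℤ.^ 3) → Solution A B
      j⇒solution eq = from (solution⇔ A B) (*-cancelˡ (c₂₇ ℚ.* j) (27*≢0 j≢0) (begin
        (c₂₇ ℚ.* j) ℚ.* (a ℚ.* x)                              ≡⟨ expand ⟩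
        1728ℚ ℚ.* (c₄ ℚ.* x) ℚ.- (c₄ ℚ.* x) ℚ.* j              ≡⟨ cong (λ t → 1728ℚ ℚ.* t ℚ.- (c₄ ℚ.* x) ℚ.* j) (fromℤ-* (+ 4) (A ℤ.^ 3)) ⟨
        1728ℚ ℚ.* fromℤ (+ 4 ℤ.* A ℤ.^ 3) ℚ.- (c₄ ℚ.* x) ℚ.* j ≡⟨ cong (ℚ._- (c₄ ℚ.* x) ℚ.* j) (trans (sym eq) (cong (ℚ._* j) d≡)) ⟩
        (c₄ ℚ.* x ℚ.+ c₂₇ ℚ.* y) ℚ.* j ℚ.- (c₄ ℚ.* x) ℚ.* j    ≡⟨ solve 4 (λ s c y j → (s :+ c :* y) :* j :- s :* j := (c :* j) :* y) refl (c₄ ℚ.* x) c₂₇ y j ⟩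
        (c₂₇ ℚ.* j) ℚ.* y                                      ∎))

      solution⇒j : Solution A B → d ℚ.* j ≡ 1728ℚ ℚ.* fromℤ (+ 4 ℤ.* A ℤ.^ 3)
      solution⇒j sol = begin
        d ℚ.* j                                                ≡⟨ cong (ℚ._* j) d≡ ⟩
        (c₄ ℚ.* x ℚ.+ c₂₇ ℚ.* y) ℚ.* j                         ≡⟨ solve 4 (λ s c y j → (s :+ c :* y) :* j := s :* j :+ (c :* j) :* y) refl (c₄ ℚ.* x) c₂₇ y j ⟩
        (c₄ ℚ.* x) ℚ.* j ℚ.+ (c₂₇ ℚ.* j) ℚ.* y                 ≡⟨ cong (λ t → (c₄ ℚ.* x) ℚ.* j ℚ.+ (c₂₇ ℚ.* j) ℚ.* t) (to (solution⇔ A B) sol) ⟨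
        (c₄ ℚ.* x) ℚ.* j ℚ.+ (c₂₇ ℚ.* j) ℚ.* (a ℚ.* x)         ≡⟨ cong ((c₄ ℚ.* x) ℚ.* j ℚ.+_) expand ⟩
        (c₄ ℚ.* x) ℚ.* j ℚ.+ (1728ℚ ℚ.* (c₄ ℚ.* x) ℚ.- (c₄ ℚ.* x) ℚ.* j) ≡⟨ solve 2 (λ s t → s :+ (t :- s) := t) refl ((c₄ ℚ.* x) ℚ.* j) (1728ℚ ℚ.* (c₄ ℚ.* x)) ⟩
        1728ℚ ℚ.* (c₄ ℚ.* x)                                   ≡⟨ cong (1728ℚ ℚ.*_) (fromℤ-* (+ 4) (A ℤ.^ 3)) ⟨
        1728ℚ ℚ.* fromℤ (+ 4 ℤ.* A ℤ.^ 3)                      ∎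

    -- The curve is nonsingular because d j = 1728 · 4A³ with d = 4A³ + 27B² = 0 would force A = 0.
    solution⇒Ẽ[j] : ∀ {A B} → A ≢ + 0 → Solution A B → Ẽ[ j ] (A , B)
    solution⇒Ẽ[j] {A} {B} A≢0 sol = e , from (jInvariant≡⇔ A B e) dj≡
      where
      dj≡ = solution⇒j A B sol
      e : Ẽ (A , B)
      e = Δ≢0 (A , B) λ d≡0 → A≢0 (ℤₚ.i^n≡0⇒i≡0 A 3 (ℤₚ.*-cancelˡ-≡ (+ 4) (A ℤ.^ 3) (+ 0)
        (fromℤ-injective (*-cancelˡ 1728ℚ (λ ()) (trans (sym dj≡) (trans (cong (λ t → fromℤ t ℚ.* j) d≡0)
          (trans (ℚₚ.*-zeroˡ j) (sym (ℚₚ.*-zeroʳ 1728ℚ)))))))))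

    Ẽ[j]⇒solution : ∀ {A B} → Ẽ[ j ] (A , B) → Solution A B
    Ẽ[j]⇒solution {A} {B} (e , j≡) = j⇒solution A B (to (jInvariant≡⇔ A B e) j≡)

    private
      s : ℤ
      s = proj₁ (signed-abs (↥ a))

      ↥a≡s*u : ↥ a ≡ s ℤ.* + u
      ↥a≡s*u = proj₁ (proj₂ (signed-abs (↥ a)))

      s*s≡1 : s ℤ.* s ≡ + 1
      s*s≡1 = proj₂ (proj₂ (signed-abs (↥ a)))

      ∣s∣≡1 : ℤ.∣ s ∣ ≡ 1
      ∣s∣≡1 = ℕₚ.m*n≡1⇒m≡1 ℤ.∣ s ∣ ℤ.∣ s ∣ (trans (sym (ℤₚ.abs-* s s)) (cong ℤ.∣_∣ s*s≡1))

      ∣s*n∣≡n : ∀ n → ℤ.∣ s ℤ.* + n ∣ ≡ n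
      ∣s*n∣≡n n = trans (ℤₚ.abs-* s (+ n)) (trans (cong (ℕ._* n) ∣s∣≡1) (ℕₚ.*-identityˡ n))

    -- These are N²/a and N³/a, with s the sign of a. Since N = n₁/n₂, n₁² = r u and v = w n₂³, one
    -- has N²/|a| = n₁² v / (n₂² u) = r w n₂; multiplication by N gives r w n₁.
    A₁ B₁ : ℤ
    A₁ = s ℤ.* + (r ℕ.* w ℕ.* n₂)
    B₁ = s ℤ.* + (r ℕ.* w ℕ.* n₁)

    ∣A₁∣≡ : ℤ.∣ A₁ ∣ ≡ r ℕ.* w ℕ.* n₂
    ∣A₁∣≡ = ∣s*n∣≡n (r ℕ.* w ℕ.* n₂)

    ∣B₁∣≡ : ℤ.∣ B₁ ∣ ≡ r ℕ.* w ℕ.* n₁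
    ∣B₁∣≡ = ∣s*n∣≡n (r ℕ.* w ℕ.* n₁)

    instance
      n₁-nonZero : ℕ.NonZero n₁
      n₁-nonZero = ∏-nonZero (u ℕ.⊔ v) _
      n₂-nonZero : ℕ.NonZero n₂
      n₂-nonZero = ∏-nonZero (u ℕ.⊔ v) _
      r-nonZero : ℕ.NonZero r
      r-nonZero = ℕₚ.m*n≢0⇒m≢0 r {{subst ℕ.NonZero n₁²≡r*u (ℕₚ.m^n≢0 n₁ 2)}}
      w-nonZero : ℕ.NonZero w
      w-nonZero = ℕₚ.m*n≢0⇒m≢0 w {{subst ℕ.NonZero v≡w*n₂³ _}}
      rw-nonZero : ℕ.NonZero (r ℕ.* w)
      rw-nonZero = ℕₚ.m*n≢0 r w
      A₁-nonZero : ℤ.NonZero A₁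
      A₁-nonZero = subst ℕ.NonZero (sym ∣A₁∣≡) (ℕₚ.m*n≢0 (r ℕ.* w) n₂)
      B₁-nonZero : ℤ.NonZero B₁
      B₁-nonZero = subst ℕ.NonZero (sym ∣B₁∣≡) (ℕₚ.m*n≢0 (r ℕ.* w) n₁)

    φ : ℤ → Curve
    φ k = k ℤ.^ 2 ℤ.* A₁ , k ℤ.^ 3 ℤ.* B₁

    solution-A₁B₁ : Solution A₁ B₁
    solution-A₁B₁ = solution (subst (λ t → + v ℤ.* B₁ ℤ.^ 2 ≡ t ℤ.* A₁ ℤ.^ 3) (sym ↥a≡s*u) (base-solution {s} {u} {v} {n₁} {n₂} {r} {w} s*s≡1 n₁²≡r*u v≡w*n₂³))

    module _ (k A B : ℤ) where
      private
        lhs : + v ℤ.* (k ℤ.^ 3 ℤ.* B) ℤ.^ 2 ≡ k ℤ.^ 6 ℤ.* (+ v ℤ.* B ℤ.^ 2)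
        lhs = i²i³-scale (+ v) k B
        rhs : ↥ a ℤ.* (k ℤ.^ 2 ℤ.* A) ℤ.^ 3 ≡ k ℤ.^ 6 ℤ.* (↥ a ℤ.* A ℤ.^ 3)
        rhs = i³i²-scale (↥ a) k A

      solution-scale : Solution A B → Solution (k ℤ.^ 2 ℤ.* A) (k ℤ.^ 3 ℤ.* B)
      solution-scale sol = solution (trans lhs (trans (cong (k ℤ.^ 6 ℤ.*_) (equation sol)) (sym rhs)))

      solution-unscale : k ≢ + 0 → Solution (k ℤ.^ 2 ℤ.* A) (k ℤ.^ 3 ℤ.* B) → Solution A B
      solution-unscale k≢0 sol = solution (ℤₚ.*-cancelˡ-≡ (k ℤ.^ 6) _ _ {{ℤ.≢-nonZero (k≢0 ∘ ℤₚ.i^n≡0⇒i≡0 k 6)}} (trans (sym lhs) (trans (equation sol) rhs)))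

    -- The first coordinate determines k up to sign because it contains k²; the cube in the second
    -- coordinate determines the sign.
    φ-injective : ∀ {k l} → φ k ≡ φ l → k ≡ l
    φ-injective {k} {l} eq = [ id , neg ]′ (∣i∣≡∣j∣⇒i≡±j k l ∣k∣≡∣l∣)
      where
      ∣k∣≡∣l∣ : ℤ.∣ k ∣ ≡ ℤ.∣ l ∣
      ∣k∣≡∣l∣ = m^n-injective 2 (trans (sym (abs-^ k 2)) (trans (cong ℤ.∣_∣ (ℤₚ.*-cancelʳ-≡ (k ℤ.^ 2) (l ℤ.^ 2) A₁ (cong proj₁ eq))) (abs-^ l 2)))
      neg : k ≡ ℤ.- l → k ≡ l
      neg refl = trans (cong ℤ.-_ l≡0) (sym l≡0)
        where
        l≡0 : l ≡ + 0
        l≡0 = ℤₚ.i^n≡0⇒i≡0 l 3 (i≡-i⇒i≡0 (trans (sym (ℤₚ.*-cancelʳ-≡ ((ℤ.- l) ℤ.^ 3) (l ℤ.^ 3) B₁ (cong proj₂ eq))) ([-i]³ l)))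

    φ-sound : ∀ {k} → k ≢ + 0 → Ẽ[ j ] (φ k)
    φ-sound {k} k≢0 = solution⇒Ẽ[j] k²A₁≢0 (solution-scale k A₁ B₁ solution-A₁B₁)
      where
      k²A₁≢0 : k ℤ.^ 2 ℤ.* A₁ ≢ + 0
      k²A₁≢0 eq = [ k≢0 ∘ ℤₚ.i^n≡0⇒i≡0 k 2 , i≢0 A₁ ]′ (ℤₚ.i*j≡0⇒i≡0∨j≡0 (k ℤ.^ 2) eq)

    -- Let x/y be |B|/|A| in lowest terms and g the gcd. The equation becomes v x² = u y³ g. As u is
    -- coprime to v and x to y, u divides x² and y³ divides v; by the extremal properties of n₁ and
    -- n₂ this means n₁ ∣ x and y ∣ n₂, which is how N ∣ t reads in natural numbers.
    ∃-abs-multiplier : ∀ A B .{{_ : ℤ.NonZero A}} .{{_ : ℤ.NonZero B}} → Solution A B →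
      ∃[ k ] (ℤ.∣ A ∣ ≡ k ℕ.^ 2 ℕ.* ℤ.∣ A₁ ∣ × ℤ.∣ B ∣ ≡ k ℕ.^ 3 ℕ.* ℤ.∣ B₁ ∣)
    ∃-abs-multiplier A B sol = k , trans (sym ∣A∣≡y*g) (trans y*g≡ (cong (k ℕ.^ 2 ℕ.*_) (sym ∣A₁∣≡))) , trans (sym ∣B∣≡x*g) (trans x*g≡ (cong (k ℕ.^ 3 ℕ.*_) (sym ∣B₁∣≡)))
      where
      open ≡-Reasoning
      open ℕS.+-*-Solver
      g = gcd ℤ.∣ B ∣ ℤ.∣ A ∣
      instance
        g-nonZero : ℕ.NonZero g
        g-nonZero = ℕ.≢-nonZero (gcd[m,n]≢0 ℤ.∣ B ∣ ℤ.∣ A ∣ (inj₂ (ℕ.≢-nonZero⁻¹ ℤ.∣ A ∣)))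
      x = ℤ.∣ B ∣ ℕ./ g
      y = ℤ.∣ A ∣ ℕ./ g
      ∣B∣≡x*g : x ℕ.* g ≡ ℤ.∣ B ∣
      ∣B∣≡x*g = m/n*n≡m (gcd[m,n]∣m ℤ.∣ B ∣ ℤ.∣ A ∣)
      ∣A∣≡y*g : y ℕ.* g ≡ ℤ.∣ A ∣
      ∣A∣≡y*g = m/n*n≡m (gcd[m,n]∣n ℤ.∣ B ∣ ℤ.∣ A ∣)
      instance
        x-nonZero : ℕ.NonZero x
        x-nonZero = ℕₚ.m*n≢0⇒m≢0 x {{subst ℕ.NonZero (sym ∣B∣≡x*g) it}}
        y-nonZero : ℕ.NonZero y
        y-nonZero = ℕₚ.m*n≢0⇒m≢0 y {{subst ℕ.NonZero (sym ∣A∣≡y*g) it}}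
      coprime : Coprime x y
      coprime = coprime-/gcd ℤ.∣ B ∣ ℤ.∣ A ∣
      abs-sol : v ℕ.* ℤ.∣ B ∣ ℕ.^ 2 ≡ u ℕ.* ℤ.∣ A ∣ ℕ.^ 3
      abs-sol = begin
        v ℕ.* ℤ.∣ B ∣ ℕ.^ 2       ≡⟨ cong (v ℕ.*_) (abs-^ B 2) ⟨
        v ℕ.* ℤ.∣ B ℤ.^ 2 ∣       ≡⟨ ℤₚ.abs-* (+ v) (B ℤ.^ 2) ⟨
        ℤ.∣ + v ℤ.* B ℤ.^ 2 ∣     ≡⟨ cong ℤ.∣_∣ (equation sol) ⟩
        ℤ.∣ ↥ a ℤ.* A ℤ.^ 3 ∣     ≡⟨ ℤₚ.abs-* (↥ a) (A ℤ.^ 3) ⟩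
        u ℕ.* ℤ.∣ A ℤ.^ 3 ∣       ≡⟨ cong (u ℕ.*_) (abs-^ A 3) ⟩
        u ℕ.* ℤ.∣ A ∣ ℕ.^ 3       ∎
      reduced : v ℕ.* x ℕ.^ 2 ≡ u ℕ.* y ℕ.^ 3 ℕ.* g
      reduced = ℕₚ.*-cancelˡ-≡ _ _ (g ℕ.^ 2) {{ℕₚ.m^n≢0 g 2}} (begin
        g ℕ.^ 2 ℕ.* (v ℕ.* x ℕ.^ 2)          ≡⟨ solve 3 (λ g v x → g :^ 2 :* (v :* x :^ 2) := v :* (x :* g) :^ 2) refl g v x ⟩
        v ℕ.* (x ℕ.* g) ℕ.^ 2                ≡⟨ cong (λ t → v ℕ.* t ℕ.^ 2) ∣B∣≡x*g ⟩
        v ℕ.* ℤ.∣ B ∣ ℕ.^ 2                  ≡⟨ abs-sol ⟩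
        u ℕ.* ℤ.∣ A ∣ ℕ.^ 3                  ≡⟨ cong (λ t → u ℕ.* t ℕ.^ 3) ∣A∣≡y*g ⟨
        u ℕ.* (y ℕ.* g) ℕ.^ 3                ≡⟨ solve 3 (λ g u y → u :* (y :* g) :^ 3 := g :^ 2 :* (u :* y :^ 3 :* g)) refl g u y ⟩
        g ℕ.^ 2 ℕ.* (u ℕ.* y ℕ.^ 3 ℕ.* g)    ∎)
      u∣x² : u ℕ.∣ x ℕ.^ 2
      u∣x² = coprime-divisor (coprime-↥↧ a) (subst (u ℕ.∣_) (sym reduced) (ℕ.∣m⇒∣m*n g (ℕ.m∣m*n (y ℕ.^ 3))))
      y³∣v : y ℕ.^ 3 ℕ.∣ v
      y³∣v = coprime-divisor (coprime-^ 3 2 (Coprime.sym coprime))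
        (subst (y ℕ.^ 3 ℕ.∣_) (trans (sym reduced) (ℕₚ.*-comm v (x ℕ.^ 2))) (ℕ.∣m⇒∣m*n g (ℕ.n∣m*n u)))
      multiplier = ∃-multiplier {u} {v} {n₁} {n₂} {r} {w} {x} {y} {g} n₁²≡r*u v≡w*n₂³
        (u∣x²⇒√⌈u⌉∣x {u ℕ.⊔ v} x u∣x²) (y³∣v⇒y∣∛⌊v⌋ {u ℕ.⊔ v} y (ℕₚ.m≤n⊔m u v) y³∣v) reduced
      k = proj₁ multiplier
      y*g≡ = proj₁ (proj₂ multiplier)
      x*g≡ = proj₂ (proj₂ multiplier)

    -- The absolute values give a natural k with |A| and |B| as required, and the sign of B selects
    -- k or -k. The sign of A is then forced by the equation.
    φ-complete : ∀ {E} → Ẽ[ j ] E → ∃[ k ] (k ≢ + 0 × φ k ≡ E)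
    φ-complete {A , B} e = find (∃-abs-multiplier A B sol)
      where
      sol : Solution A B
      sol = Ẽ[j]⇒solution e
      A≡0⇒B≡0 : A ≡ + 0 → B ≡ + 0
      A≡0⇒B≡0 refl = ℤₚ.i^n≡0⇒i≡0 B 2 (ℤₚ.*-cancelˡ-≡ (+ v) (B ℤ.^ 2) (+ 0) (trans (equation sol) (trans (ℤₚ.*-zeroʳ (↥ a)) (sym (ℤₚ.*-zeroʳ (+ v))))))
      B≡0⇒A≡0 : B ≡ + 0 → A ≡ + 0
      B≡0⇒A≡0 refl = ℤₚ.i^n≡0⇒i≡0 A 3 (ℤₚ.*-cancelˡ-≡ (↥ a) (A ℤ.^ 3) (+ 0) {{it}} (trans (sym (equation sol)) (trans (ℤₚ.*-zeroʳ (+ v)) (sym (ℤₚ.*-zeroʳ (↥ a))))))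
      not-both : A ≡ + 0 → B ≡ + 0 → Δ (A , B) ≡ + 0
      not-both refl refl = refl
      A≢0 : A ≢ + 0
      A≢0 A≡0 = proj₁ e (not-both A≡0 (A≡0⇒B≡0 A≡0))
      B≢0 : B ≢ + 0
      B≢0 B≡0 = proj₁ e (not-both (B≡0⇒A≡0 B≡0) B≡0)
      instance
        A-nonZero : ℤ.NonZero A
        A-nonZero = ℤ.≢-nonZero A≢0
        B-nonZero : ℤ.NonZero B
        B-nonZero = ℤ.≢-nonZero B≢0
      find : ∃[ k ] (ℤ.∣ A ∣ ≡ k ℕ.^ 2 ℕ.* ℤ.∣ A₁ ∣ × ℤ.∣ B ∣ ≡ k ℕ.^ 3 ℕ.* ℤ.∣ B₁ ∣) → ∃[ k ] (k ≢ + 0 × φ k ≡ (A , B))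
      find (k , ∣A∣≡ , ∣B∣≡) = [ plus , minus ]′ (∣i∣≡∣j∣⇒i≡±j B Bk (trans ∣B∣≡ (sym (∣i^n*j∣ (+ k) 3 B₁))))
        where
        Ak Bk : ℤ
        Ak = (+ k) ℤ.^ 2 ℤ.* A₁
        Bk = (+ k) ℤ.^ 3 ℤ.* B₁
        -- A wrong sign of A would negate a A³ but not B², so v B² would equal its own negative and
        -- vanish.
        A≢-Ak : B ℤ.^ 2 ≡ Bk ℤ.^ 2 → A ≢ ℤ.- Ak
        A≢-Ak B²≡ eq = B≢0 (ℤₚ.i^n≡0⇒i≡0 B 2 (ℤₚ.*-cancelˡ-≡ (+ v) (B ℤ.^ 2) (+ 0) (trans (i≡-i⇒i≡0 vB²≡-vB²) (sym (ℤₚ.*-zeroʳ (+ v))))))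
          where
          open ≡-Reasoning
          vB²≡-vB² : + v ℤ.* B ℤ.^ 2 ≡ ℤ.- (+ v ℤ.* B ℤ.^ 2)
          vB²≡-vB² = begin
            + v ℤ.* B ℤ.^ 2             ≡⟨ equation sol ⟩
            ↥ a ℤ.* A ℤ.^ 3             ≡⟨ cong (λ t → ↥ a ℤ.* t ℤ.^ 3) eq ⟩
            ↥ a ℤ.* (ℤ.- Ak) ℤ.^ 3      ≡⟨ i*[-j]³ (↥ a) Ak ⟩
            ℤ.- (↥ a ℤ.* Ak ℤ.^ 3)      ≡⟨ cong ℤ.-_ (equation (solution-scale (+ k) A₁ B₁ solution-A₁B₁)) ⟨
            ℤ.- (+ v ℤ.* Bk ℤ.^ 2)      ≡⟨ cong (λ t → ℤ.- (+ v ℤ.* t)) B²≡ ⟨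
            ℤ.- (+ v ℤ.* B ℤ.^ 2)       ∎
        A≡Ak : B ℤ.^ 2 ≡ Bk ℤ.^ 2 → A ≡ Ak
        A≡Ak B²≡ = [ id , (λ eq → contradiction eq (A≢-Ak B²≡)) ]′ (∣i∣≡∣j∣⇒i≡±j A Ak (trans ∣A∣≡ (sym (∣i^n*j∣ (+ k) 2 A₁))))
        nonzero : ∀ {l} → l ℤ.^ 3 ℤ.* B₁ ≡ B → l ≢ + 0
        nonzero eq refl = B≢0 (sym eq)
        plus : B ≡ Bk → ∃[ k ] (k ≢ + 0 × φ k ≡ (A , B))
        plus eq = + k , nonzero (sym eq) , cong₂ _,_ (sym (A≡Ak (cong (ℤ._^ 2) eq))) (sym eq)
        minus : B ≡ ℤ.- Bk → ∃[ k ] (k ≢ + 0 × φ k ≡ (A , B))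
        minus eq = ℤ.- + k , nonzero B≡ , cong₂ _,_ A≡ B≡
          where
          A≡ : (ℤ.- + k) ℤ.^ 2 ℤ.* A₁ ≡ A
          A≡ = trans (cong (ℤ._* A₁) ([-i]² (+ k))) (sym (A≡Ak (trans (cong (ℤ._^ 2) eq) ([-i]² Bk))))
          B≡ : (ℤ.- + k) ℤ.^ 3 ℤ.* B₁ ≡ B
          B≡ = trans (cong (ℤ._* B₁) ([-i]³ (+ k))) (trans (sym (ℤₚ.neg-distribˡ-* ((+ k) ℤ.^ 3) B₁)) (sym eq))

    -- The equation is homogeneous for the weights 2 and 3, so the quotients A′, B′ solve it too.
    -- Completeness writes them as φ(k′), and then φ(k) = φ(P² k′), whence k = P² k′ by injectivity.
    -- No factorisation of A₁ or B₁ is needed.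
    P⁴∣A,P⁶∣B⇒P²∣k : ∀ {k A′ B′} P → k ≢ + 0 → P ≢ + 0 →
      k ℤ.^ 2 ℤ.* A₁ ≡ A′ ℤ.* P ℤ.^ 4 → k ℤ.^ 3 ℤ.* B₁ ≡ B′ ℤ.* P ℤ.^ 6 →
      ∃[ k′ ] (k ≡ P ℤ.^ 2 ℤ.* k′)
    P⁴∣A,P⁶∣B⇒P²∣k {k} {A′} {B′} P k≢0 P≢0 A≡ B≡ = descend (φ-complete {A′ , B′} (solution⇒Ẽ[j] {A′} {B′} A′≢0 sol))
      where
      P² : ℤ
      P² = P ℤ.^ 2
      A≡′ : k ℤ.^ 2 ℤ.* A₁ ≡ P² ℤ.^ 2 ℤ.* A′
      A≡′ = trans A≡ (i*p^2n 2 A′ P)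
      B≡′ : k ℤ.^ 3 ℤ.* B₁ ≡ P² ℤ.^ 3 ℤ.* B′
      B≡′ = trans B≡ (i*p^2n 3 B′ P)
      sol : Solution A′ B′
      sol = solution-unscale P² A′ B′ (P≢0 ∘ ℤₚ.i^n≡0⇒i≡0 P 2)
        (subst₂ Solution A≡′ B≡′ (solution-scale k A₁ B₁ solution-A₁B₁))
      A′≢0 : A′ ≢ + 0
      A′≢0 eq = [ k≢0 ∘ ℤₚ.i^n≡0⇒i≡0 k 2 , i≢0 A₁ ]′ (ℤₚ.i*j≡0⇒i≡0∨j≡0 (k ℤ.^ 2) (trans A≡ (cong (ℤ._* P ℤ.^ 4) eq)))
      descend : ∃[ k′ ] (k′ ≢ + 0 × φ k′ ≡ (A′ , B′)) → ∃[ k′ ] (k ≡ P² ℤ.* k′)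
      descend (k′ , _ , φk′≡) = k′ , φ-injective {k} {P² ℤ.* k′} (cong₂ _,_
        (trans A≡′ (trans (cong (P² ℤ.^ 2 ℤ.*_) (sym (cong proj₁ φk′≡))) (p^n*[k^n*i] 2 P² k′ A₁)))
        (trans B≡′ (trans (cong (P² ℤ.^ 3 ℤ.*_) (sym (cong proj₂ φk′≡))) (p^n*[k^n*i] 3 P² k′ B₁))))

    nonMinimal⇒p²∣k : ∀ {k} → k ≢ + 0 → NonMinimal (φ k) → HasPowerDivisor 2 ℤ.∣ k ∣
    nonMinimal⇒p²∣k {k} k≢0 (p , pr , p⁴∣A , p⁶∣B) = descend (ℤˢ.∣ᵤ⇒∣ p⁴∣A) (ℤˢ.∣ᵤ⇒∣ p⁶∣B)
      where
      P≢0 : + p ≢ + 0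
      P≢0 eq = ¬prime[0] (subst Prime (ℤₚ.+-injective eq) pr)
      descend : (+ p) ℤ.^ 4 ℤˢ.∣ k ℤ.^ 2 ℤ.* A₁ → (+ p) ℤ.^ 6 ℤˢ.∣ k ℤ.^ 3 ℤ.* B₁ → HasPowerDivisor 2 ℤ.∣ k ∣
      descend p⁴∣A p⁶∣B = p , pr , i≡p^n*j⇒p^n∣∣i∣ p 2
        (proj₂ (P⁴∣A,P⁶∣B⇒P²∣k {k} {ℤˢ.quotient p⁴∣A} {ℤˢ.quotient p⁶∣B} (+ p) k≢0 P≢0 (ℤˢ._∣_.equality p⁴∣A) (ℤˢ._∣_.equality p⁶∣B)))

    p²∣k⇒nonMinimal : ∀ {k} → HasPowerDivisor 2 ℤ.∣ k ∣ → NonMinimal (φ k)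
    p²∣k⇒nonMinimal {k} (p , pr , p²∣k) = p , pr ,
      p^n∣∣i∣⇒p^n∣i p 4 (k ℤ.^ 2 ℤ.* A₁) (p^2n∣∣k^n*i∣ p k 2 A₁ p²∣k) ,
      p^n∣∣i∣⇒p^n∣i p 6 (k ℤ.^ 3 ℤ.* B₁) (p^2n∣∣k^n*i∣ p k 3 B₁ p²∣k)

    φ-minimal : ∀ k → k ≢ + 0 → NonMinimal (φ k) ⇔ HasPowerDivisor 2 ℤ.∣ k ∣
    φ-minimal k k≢0 = mk⇔ (nonMinimal⇒p²∣k {k} k≢0) (p²∣k⇒nonMinimal {k})

    parametrisation : Parametrisation j 2
    parametrisation = record
      { φ           = φ
      ; φ-injective = λ {k} {l} → φ-injective {k} {l}
      ; φ-sound     = λ {k} → φ-sound {k}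
      ; φ-complete  = λ {E} → φ-complete {E}
      ; φ-minimal   = λ {k} → φ-minimal k
      }

module Analysis (lem : ExcludedMiddle 0ℓ) (ℝ : CompleteOrderedField) where

  import Algebra.Properties.CommutativeSemiring.Exp as CExp
  import Algebra.Properties.Ring as Ring
  import Algebra.Properties.Semiring.Exp as Exp
  import Algebra.Properties.Semiring.Mult as Mult
  import Algebra.Properties.Semiring.Mult.TCOptimised as Mult′
  import Algebra.Solver.Ring
  open import Algebra.Solver.Ring.AlmostCommutativeRing using (fromCommutativeRing; _-Raw-AlmostCommutative⟶_)
  open import Data.Integer as ℤ using (ℤ; +_; -[1+_])
  import Data.Integer.Properties as ℤₚ
  open import Data.List using (List; []; _∷_; _++_; map; length)
  open import Data.List.Membership.Propositional using (_∈_)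
  open import Data.List.Membership.Propositional.Properties using (∈-map⁺; ∈-map⁻; ∈-++⁺ˡ; ∈-++⁺ʳ; ∈-++⁻)
  open import Data.List.Properties using (length-++; length-map)
  open import Data.List.Relation.Unary.All as All using (All; []; _∷_)
  import Data.List.Relation.Unary.All.Properties as All
  open import Data.List.Relation.Unary.Any using (here; there)
  open import Data.List.Relation.Unary.Unique.Propositional using (Unique; []; _∷_)
  import Data.List.Relation.Unary.Unique.Propositional.Properties as Unique
  open import Data.Maybe using (Maybe; just; nothing)
  open import Data.Nat as ℕ using (ℕ; suc)
  open import Data.Nat.Coprimality using (coprime-divisor)
  open import Data.Nat.DivMod using (m<n*o⇒m/o<n; m*n/n≡m; /-monoˡ-≤; m/n*n≤m; m/n/o≡m/[n*o]; m<n⇒m/n≡0; m≡m%n+[m/n]*n; m%n<n; n/1≡n; /-congʳ; 0/n≡0)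
  open import Data.Nat.Divisibility using (_∣_; _∤_; divides; ∣n⇒∣m*n; ∣1⇒≡1; ∣⇒≤; ∣-trans; m∣m*n)
  open import Data.Nat.Primality using (Prime; prime?; ¬prime[0]; euclidsLemma)
  import Data.Nat.Properties as ℕₚ
  open import Data.Product using (∃; ∃-syntax; _×_; _,_; proj₁; proj₂)
  open import Data.Rational as ℚ using (ℚ; 0ℚ; ↥_; ↧_; ↧ₙ_; mkℚ)
  open import Data.Sum using (_⊎_; inj₁; inj₂; [_,_]′)
  open import Data.Unit using (⊤; tt)
  open import Function using (id; _∘_; _⇔_; mk⇔; module Equivalence)
  open import Relation.Binary using (IsTotalOrder; Poset)
  import Relation.Binary.Construct.NonStrictToStrict as Strict
  open import Relation.Binary.PropositionalEquality as ≡ using (_≡_; _≢_)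
  import Relation.Binary.Reasoning.PartialOrder as PartialOrderReasoning
  open import Relation.Nullary using (¬_; Dec; yes; no; contradiction)
  open import Relation.Unary using (Pred)

  open Arithmetic using (coprime-^; primes-coprime; ∃-prime-divisor; prime>1; ^-distribʳ-*)
  open Rationals using (N-fraction)
  open Curves using (HasPowerDivisor; Parametrisation; module Parametrisation; parametrisation₀; parametrisation₁₇₂₈; ∣i^n*j∣; module Generic)

  open Real lem ℝ hiding (zero)
  open IsTotalOrder isTotalOrder using (total; antisym; isPartialOrder; ≤-respˡ-≈; ≤-respʳ-≈) renaming (refl to ≤-refl; trans to ≤-trans; reflexive to ≤-reflexive)
  open import Algebra.Construct.NaturalChoice.Min totalOrder using (x⊓y≤x; x⊓y≤y; ⊓-glb; ⊓-sel)
  open import Algebra.Construct.NaturalChoice.Max totalOrder using (x≤x⊔y; x≤y⊔x; ⊔-lub)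
  open Ring ring using (-0#≈0#; -‿involutive; -‿distribˡ-*; -‿distribʳ-*; -‿+-comm)
  open Exp semiring using (^-congˡ; ^-assocʳ)
  open CExp commutativeSemiring using (^-distrib-*)
  open Mult semiring using (×1-homo-*)

  poset : Poset 0ℓ 0ℓ 0ℓ
  poset = record { isPartialOrder = isPartialOrder }

  module ≤-Reasoning = PartialOrderReasoning poset

  -- A ring solver for the real field with integer coefficients

  private
    module M′ = Mult′ semiring
    module ≈R = ≤-Reasoning
    open M′ using () renaming (_×_ to _×′_)

    -- With the optimised multiple `⟦ + 1 ⟧` reduces to `1#`, whereas `fromInt (+ 1)` reduces to
    -- `1# + 0#`. The solver constant `con (+ 1)` thus stands for `1#` itself.
    ⟦_⟧ : ℤ → Carrier
    ⟦ + n ⟧      = n ×′ 1#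
    ⟦ -[1+ n ] ⟧ = - (suc n ×′ 1#)

    suc-×′ : ∀ n → suc n ×′ 1# ≈ 1# + n ×′ 1#
    suc-×′ n = M′.1+× n 1#

    cancel₁ : ∀ x y → x - y ≈ (1# + x) - (1# + y)
    cancel₁ x y = begin-equality
      x - y                       ≈⟨ +-congʳ (+-identityˡ x) ⟨
      (0# + x) - y                ≈⟨ +-congʳ (+-congʳ (-‿inverseʳ 1#)) ⟨
      ((1# - 1#) + x) - y         ≈⟨ +-congʳ (+-assoc 1# (- 1#) x) ⟩
      (1# + (- 1# + x)) - y       ≈⟨ +-congʳ (+-congˡ (+-comm (- 1#) x)) ⟩
      (1# + (x - 1#)) - y         ≈⟨ +-congʳ (+-assoc 1# x (- 1#)) ⟨
      ((1# + x) - 1#) - y         ≈⟨ +-assoc (1# + x) (- 1#) (- y) ⟩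
      (1# + x) + (- 1# - y)       ≈⟨ +-congˡ (-‿+-comm 1# y) ⟩
      (1# + x) - (1# + y)         ∎
      where open ≈R

    ⟦⊖⟧ : ∀ m n → ⟦ m ℤ.⊖ n ⟧ ≈ m ×′ 1# - n ×′ 1#
    ⟦⊖⟧ m       ℕ.zero    = sym (trans (+-congˡ -0#≈0#) (+-identityʳ (m ×′ 1#)))
    ⟦⊖⟧ ℕ.zero  (suc n)   = sym (+-identityˡ _)
    ⟦⊖⟧ (suc m) (suc n)   = begin-equality
      ⟦ suc m ℤ.⊖ suc n ⟧                 ≡⟨ ≡.cong ⟦_⟧ (ℤₚ.[1+m]⊖[1+n]≡m⊖n m n) ⟩
      ⟦ m ℤ.⊖ n ⟧                         ≈⟨ ⟦⊖⟧ m n ⟩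
      m ×′ 1# - n ×′ 1#                   ≈⟨ cancel₁ (m ×′ 1#) (n ×′ 1#) ⟩
      (1# + m ×′ 1#) - (1# + n ×′ 1#)     ≈⟨ +-cong (suc-×′ m) (-‿cong (suc-×′ n)) ⟨
      suc m ×′ 1# - suc n ×′ 1#           ∎
      where open ≈R

    ⟦⟧-+ : ∀ i j → ⟦ i ℤ.+ j ⟧ ≈ ⟦ i ⟧ + ⟦ j ⟧
    ⟦⟧-+ (+ m)    (+ n)    = M′.×-homo-+ 1# m n
    ⟦⟧-+ (+ m)    -[1+ n ] = ⟦⊖⟧ m (suc n)
    ⟦⟧-+ -[1+ m ] (+ n)    = trans (⟦⊖⟧ n (suc m)) (+-comm _ _)
    ⟦⟧-+ -[1+ m ] -[1+ n ] = begin-equality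
      - (suc (suc (m ℕ.+ n)) ×′ 1#)             ≡⟨ ≡.cong (λ t → - (t ×′ 1#)) (≡.cong suc (ℕₚ.+-suc m n)) ⟨
      - ((suc m ℕ.+ suc n) ×′ 1#)               ≈⟨ -‿cong (M′.×-homo-+ 1# (suc m) (suc n)) ⟩
      - (suc m ×′ 1# + suc n ×′ 1#)             ≈⟨ -‿+-comm _ _ ⟨
      - (suc m ×′ 1#) - suc n ×′ 1#             ∎
      where open ≈R

    ⟦⟧-neg : ∀ i → ⟦ ℤ.- i ⟧ ≈ - ⟦ i ⟧
    ⟦⟧-neg (+ ℕ.zero) = sym -0#≈0#
    ⟦⟧-neg (+ suc n)  = refl
    ⟦⟧-neg -[1+ n ]   = sym (-‿involutive _)

    ⟦⟧-*-pos : ∀ m n → ⟦ + m ℤ.* + n ⟧ ≈ ⟦ + m ⟧ * ⟦ + n ⟧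
    ⟦⟧-*-pos m n = begin-equality
      ⟦ + m ℤ.* + n ⟧         ≡⟨ ≡.cong ⟦_⟧ (≡.sym (ℤₚ.pos-* m n)) ⟩
      (m ℕ.* n) ×′ 1#         ≈⟨ M′.×1-homo-* m n ⟩
      m ×′ 1# * (n ×′ 1#)     ∎
      where open ≈R
    ⟦⟧-*ˡ : ∀ m j → ⟦ + m ℤ.* j ⟧ ≈ ⟦ + m ⟧ * ⟦ j ⟧
    ⟦⟧-*ˡ m (+ n)    = ⟦⟧-*-pos m n
    ⟦⟧-*ˡ m -[1+ n ] = begin-equality
      ⟦ + m ℤ.* (ℤ.- + suc n) ⟧      ≡⟨ ≡.cong ⟦_⟧ (ℤₚ.neg-distribʳ-* (+ m) (+ suc n)) ⟨
      ⟦ ℤ.- (+ m ℤ.* + suc n) ⟧      ≈⟨ ⟦⟧-neg (+ m ℤ.* + suc n) ⟩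
      - ⟦ + m ℤ.* + suc n ⟧          ≈⟨ -‿cong (⟦⟧-*-pos m (suc n)) ⟩
      - (⟦ + m ⟧ * ⟦ + suc n ⟧)      ≈⟨ -‿distribʳ-* _ _ ⟩
      ⟦ + m ⟧ * - ⟦ + suc n ⟧        ∎
      where open ≈R
    ⟦⟧-* : ∀ i j → ⟦ i ℤ.* j ⟧ ≈ ⟦ i ⟧ * ⟦ j ⟧
    ⟦⟧-* (+ m)    j = ⟦⟧-*ˡ m j
    ⟦⟧-* -[1+ m ] j = begin-equality
      ⟦ (ℤ.- + suc m) ℤ.* j ⟧        ≡⟨ ≡.cong ⟦_⟧ (ℤₚ.neg-distribˡ-* (+ suc m) j) ⟨
      ⟦ ℤ.- (+ suc m ℤ.* j) ⟧        ≈⟨ ⟦⟧-neg (+ suc m ℤ.* j) ⟩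
      - ⟦ + suc m ℤ.* j ⟧            ≈⟨ -‿cong (⟦⟧-*ˡ (suc m) j) ⟩
      - (⟦ + suc m ⟧ * ⟦ j ⟧)        ≈⟨ -‿distribˡ-* _ _ ⟩
      - ⟦ + suc m ⟧ * ⟦ j ⟧          ∎
      where open ≈R

    ⟦⟧-homomorphism : ℤ.+-*-rawRing -Raw-AlmostCommutative⟶ fromCommutativeRing commutativeRing
    ⟦⟧-homomorphism = record
      { ⟦_⟧    = ⟦_⟧
      ; +-homo = ⟦⟧-+
      ; *-homo = ⟦⟧-*
      ; -‿homo = ⟦⟧-neg
      ; 0-homo = refl
      ; 1-homo = refl
      }

    coeff≟ : ∀ i j → Maybe (⟦ i ⟧ ≈ ⟦ j ⟧)
    coeff≟ i j with i ℤ.≟ j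
    ... | yes ≡.refl = just refl
    ... | no  _      = nothing

  module Solver = Algebra.Solver.Ring ℤ.+-*-rawRing (fromCommutativeRing commutativeRing) ⟦⟧-homomorphism coeff≟

  open Solver using (solve; _:=_; _:+_; _:*_; _:-_; :-_; con; _:^_) public

  -- Inequalities, powers and absolute values in an ordered field

  x≤y⇒0≤y-x : ∀ {x y} → x ≤ y → 0# ≤ y - x
  x≤y⇒0≤y-x {x} {y} x≤y = begin
    0#          ≈⟨ -‿inverseˡ x ⟨
    - x + x     ≤⟨ +-monoʳ-≤ (- x) x≤y ⟩
    - x + y     ≈⟨ +-comm (- x) y ⟩
    y - x       ∎
    where open ≤-Reasoning

  0≤y-x⇒x≤y : ∀ {x y} → 0# ≤ y - x → x ≤ y
  0≤y-x⇒x≤y {x} {y} 0≤ = begin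
    x             ≈⟨ +-identityʳ x ⟨
    x + 0#        ≤⟨ +-monoʳ-≤ x 0≤ ⟩
    x + (y - x)   ≈⟨ solve 2 (λ x y → x :+ (y :- x) := y) refl x y ⟩
    y             ∎
    where open ≤-Reasoning

  +-mono-≤ : ∀ {x y u v} → x ≤ y → u ≤ v → x + u ≤ y + v
  +-mono-≤ {x} {y} {u} {v} x≤y u≤v = begin
    x + u   ≤⟨ +-monoʳ-≤ x u≤v ⟩
    x + v   ≈⟨ +-comm x v ⟩
    v + x   ≤⟨ +-monoʳ-≤ v x≤y ⟩
    v + y   ≈⟨ +-comm v y ⟩
    y + v   ∎
    where open ≤-Reasoning

  +-monoˡ-≤ : ∀ z {x y} → x ≤ y → x + z ≤ y + z
  +-monoˡ-≤ z x≤y = +-mono-≤ x≤y ≤-refl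

  neg-mono-≤ : ∀ {x y} → x ≤ y → - y ≤ - x
  neg-mono-≤ {x} {y} x≤y = 0≤y-x⇒x≤y (≤-respʳ-≈ (solve 2 (λ x y → y :- x := :- x :- (:- y)) refl x y) (x≤y⇒0≤y-x x≤y))

  x≤x+y : ∀ {x y} → 0# ≤ y → x ≤ x + y
  x≤x+y {x} 0≤y = ≤-respˡ-≈ (+-identityʳ x) (+-monoʳ-≤ x 0≤y)

  *-monoʳ-≤ : ∀ {z x y} → 0# ≤ z → x ≤ y → z * x ≤ z * y
  *-monoʳ-≤ {z} {x} {y} 0≤z x≤y = 0≤y-x⇒x≤y (≤-respʳ-≈ (solve 3 (λ z x y → z :* (y :- x) := z :* y :- z :* x) refl z x y) (*-nonNeg 0≤z (x≤y⇒0≤y-x x≤y)))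

  *-monoˡ-≤ : ∀ {z x y} → 0# ≤ z → x ≤ y → x * z ≤ y * z
  *-monoˡ-≤ {z} {x} {y} 0≤z x≤y = ≤-respˡ-≈ (*-comm z x) (≤-respʳ-≈ (*-comm z y) (*-monoʳ-≤ 0≤z x≤y))

  *-mono-≤ : ∀ {x y u v} → 0# ≤ u → 0# ≤ y → x ≤ y → u ≤ v → x * u ≤ y * v
  *-mono-≤ 0≤u 0≤y x≤y u≤v = ≤-trans (*-monoˡ-≤ 0≤u x≤y) (*-monoʳ-≤ 0≤y u≤v)

  0≤x*x : ∀ x → 0# ≤ x * x
  0≤x*x x with total 0# x
  ... | inj₁ 0≤x = *-nonNeg 0≤x 0≤x
  ... | inj₂ x≤0 = ≤-respʳ-≈ (solve 1 (λ x → (:- x) :* (:- x) := x :* x) refl x) (*-nonNeg 0≤-x 0≤-x)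
    where
    0≤-x : 0# ≤ - x
    0≤-x = ≤-respˡ-≈ -0#≈0# (neg-mono-≤ x≤0)

  0≤1 : 0# ≤ 1#
  0≤1 = ≤-respʳ-≈ (*-identityˡ 1#) (0≤x*x 1#)

  0<1 : 0# < 1#
  0<1 = 0≤1 , 0≉1

  ≰⇒> : ∀ {x y} → ¬ (x ≤ y) → y < x
  ≰⇒> = Strict.≰⇒> _≈_ _≤_ sym ≤-reflexive total

  <⇒≱ : ∀ {x y} → x < y → ¬ (y ≤ x)
  <⇒≱ = Strict.<⇒≱ _≈_ _≤_ antisym

  <⇒≤ : ∀ {x y} → x < y → x ≤ y
  <⇒≤ = proj₁

  ≤-<-trans : ∀ {x y z} → x ≤ y → y < z → x < z
  ≤-<-trans = Strict.≤-<-trans _≈_ _≤_ ≤-trans antisym ≤-respˡ-≈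

  <-≤-trans : ∀ {x y z} → x < y → y ≤ z → x < z
  <-≤-trans = Strict.<-≤-trans _≈_ _≤_ sym ≤-trans antisym ≤-respʳ-≈

  ≤-or-> : ∀ x y → x ≤ y ⊎ y < x
  ≤-or-> x y with lem {x ≤ y}
  ... | yes x≤y = inj₁ x≤y
  ... | no  x≰y = inj₂ (≰⇒> x≰y)

  0<x⇒x≉0 : ∀ {x} → 0# < x → x ≉ 0#
  0<x⇒x≉0 (_ , 0≉x) x≈0 = 0≉x (sym x≈0)

  x<y⇒0<y-x : ∀ {x y} → x < y → 0# < y - x
  x<y⇒0<y-x {x} {y} (x≤y , x≉y) = x≤y⇒0≤y-x x≤y , λ 0≈y-x → x≉y (begin-equality
    x            ≈⟨ +-identityʳ x ⟨
    x + 0#       ≈⟨ +-congˡ 0≈y-x ⟩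
    x + (y - x)  ≈⟨ solve 2 (λ x y → x :+ (y :- x) := y) refl x y ⟩
    y            ∎)
    where open ≤-Reasoning

  0<y-x⇒x<y : ∀ {x y} → 0# < y - x → x < y
  0<y-x⇒x<y {x} {y} (0≤ , 0≉) = 0≤y-x⇒x≤y 0≤ , λ x≈y → 0≉ (sym (trans (+-congˡ (-‿cong x≈y)) (-‿inverseʳ y)))

  +-monoʳ-< : ∀ z {x y} → x < y → z + x < z + y
  +-monoʳ-< z {x} {y} x<y = 0<y-x⇒x<y (<-respʳ (solve 3 (λ x y z → y :- x := (z :+ y) :- (z :+ x)) refl x y z) (x<y⇒0<y-x x<y))
    where
    <-respʳ : ∀ {x y z} → y ≈ z → x < y → x < z
    <-respʳ y≈z x<y = <-≤-trans x<y (≤-reflexive y≈z)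

  x<x+y : ∀ {x y} → 0# < y → x < x + y
  x<x+y {x} {y} 0<y = ≤-<-trans (≤-reflexive (sym (+-identityʳ x))) (+-monoʳ-< x 0<y)

  x-y<x : ∀ {x y} → 0# < y → x - y < x
  x-y<x {x} {y} 0<y = 0<y-x⇒x<y (<-≤-trans 0<y (≤-reflexive (solve 2 (λ x y → y := x :- (x :- y)) refl x y)))

  x<x+1 : ∀ x → x < x + 1#
  x<x+1 x = x<x+y 0<1

  0<x+1 : ∀ {x} → 0# ≤ x → 0# < x + 1#
  0<x+1 {x} 0≤x = ≤-<-trans 0≤x (x<x+1 x)

  *-pos : ∀ {x y} → 0# < x → 0# < y → 0# < x * y
  *-pos {x} {y} 0<x 0<y = *-nonNeg (<⇒≤ 0<x) (<⇒≤ 0<y) , λ 0≈xy → proj₂ 0<y (begin-equality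
    0#               ≈⟨ zeroʳ (x ⁻¹) ⟨
    x ⁻¹ * 0#        ≈⟨ *-congˡ 0≈xy ⟩
    x ⁻¹ * (x * y)   ≈⟨ solve 3 (λ i x y → i :* (x :* y) := (x :* i) :* y) refl (x ⁻¹) x y ⟩
    (x * x ⁻¹) * y   ≈⟨ *-congʳ (*-inverseʳ (0<x⇒x≉0 0<x)) ⟩
    1# * y           ≈⟨ *-identityˡ y ⟩
    y                ∎)
    where open ≤-Reasoning

  *-monoʳ-< : ∀ {z x y} → 0# < z → x < y → z * x < z * y
  *-monoʳ-< {z} {x} {y} 0<z x<y = 0<y-x⇒x<y (<-≤-trans (*-pos 0<z (x<y⇒0<y-x x<y)) (≤-reflexive (solve 3 (λ z x y → z :* (y :- x) := z :* y :- z :* x) refl z x y)))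

  *-cancelˡ-≤ : ∀ {z x y} → 0# < z → z * x ≤ z * y → x ≤ y
  *-cancelˡ-≤ {z} {x} {y} 0<z zx≤zy with ≤-or-> x y
  ... | inj₁ x≤y = x≤y
  ... | inj₂ y<x = contradiction zx≤zy (<⇒≱ (*-monoʳ-< 0<z y<x))

  *-cancelʳ-≤ : ∀ {z x y} → 0# < z → x * z ≤ y * z → x ≤ y
  *-cancelʳ-≤ {z} {x} {y} 0<z xz≤yz = *-cancelˡ-≤ 0<z (≤-respˡ-≈ (*-comm x z) (≤-respʳ-≈ (*-comm y z) xz≤yz))

  *-cancelˡ-≈ : ∀ {z x y} → 0# < z → z * x ≈ z * y → x ≈ y
  *-cancelˡ-≈ 0<z eq = antisym (*-cancelˡ-≤ 0<z (≤-reflexive eq)) (*-cancelˡ-≤ 0<z (≤-reflexive (sym eq)))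

  x/y*y≈x : ∀ {x y} → 0# < y → x / y * y ≈ x
  x/y*y≈x {x} {y} 0<y = begin-equality
    x * y ⁻¹ * y     ≈⟨ solve 3 (λ x i y → x :* i :* y := x :* (y :* i)) refl x (y ⁻¹) y ⟩
    x * (y * y ⁻¹)   ≈⟨ *-congˡ (*-inverseʳ (0<x⇒x≉0 0<y)) ⟩
    x * 1#           ≈⟨ *-identityʳ x ⟩
    x                ∎
    where open ≤-Reasoning

  ⁻¹-pos : ∀ {x} → 0# < x → 0# < x ⁻¹
  ⁻¹-pos {x} 0<x with ≤-or-> (x ⁻¹) 0#
  ... | inj₂ 0<x⁻¹ = 0<x⁻¹
  ... | inj₁ x⁻¹≤0 = contradiction 1≤0 (<⇒≱ 0<1)
    where
    open ≤-Reasoning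
    1≤0 : 1# ≤ 0#
    1≤0 = begin
      1#         ≈⟨ *-inverseʳ (0<x⇒x≉0 0<x) ⟨
      x * x ⁻¹   ≤⟨ *-monoʳ-≤ (<⇒≤ 0<x) x⁻¹≤0 ⟩
      x * 0#     ≈⟨ zeroʳ x ⟩
      0#         ∎

  ≤/⇒*≤ : ∀ {x y z} → 0# < y → x ≤ z / y → x * y ≤ z
  ≤/⇒*≤ 0<y x≤ = ≤-respʳ-≈ (x/y*y≈x 0<y) (*-monoˡ-≤ (<⇒≤ 0<y) x≤)

  *≤⇒≤/ : ∀ {x y z} → 0# < y → x * y ≤ z → x ≤ z / y
  *≤⇒≤/ 0<y xy≤z = *-cancelʳ-≤ 0<y (≤-respʳ-≈ (sym (x/y*y≈x 0<y)) xy≤z)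

  ≤*⇒/≤ : ∀ {x y z} → 0# < y → x ≤ z * y → x / y ≤ z
  ≤*⇒/≤ 0<y x≤zy = *-cancelʳ-≤ 0<y (≤-respˡ-≈ (sym (x/y*y≈x 0<y)) x≤zy)

  /-nonNeg : ∀ {x y} → 0# ≤ x → 0# < y → 0# ≤ x / y
  /-nonNeg 0≤x 0<y = *-nonNeg 0≤x (<⇒≤ (⁻¹-pos 0<y))

  ^-nonNeg : ∀ {x} n → 0# ≤ x → 0# ≤ x ^ n
  ^-nonNeg ℕ.zero  0≤x = 0≤1
  ^-nonNeg (suc n) 0≤x = *-nonNeg 0≤x (^-nonNeg n 0≤x)

  ^-pos : ∀ {x} n → 0# < x → 0# < x ^ n
  ^-pos ℕ.zero  0<x = 0<1
  ^-pos (suc n) 0<x = *-pos 0<x (^-pos n 0<x)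

  ^-monoˡ-≤ : ∀ n {x y} → 0# ≤ x → x ≤ y → x ^ n ≤ y ^ n
  ^-monoˡ-≤ ℕ.zero  0≤x x≤y = ≤-refl
  ^-monoˡ-≤ (suc n) 0≤x x≤y = *-mono-≤ (^-nonNeg n 0≤x) (≤-trans 0≤x x≤y) x≤y (^-monoˡ-≤ n 0≤x x≤y)

  ^-monoˡ-< : ∀ n {x y} → 0# ≤ x → x < y → x ^ suc n < y ^ suc n
  ^-monoˡ-< ℕ.zero {x} {y} 0≤x x<y = ≤-<-trans (≤-reflexive (*-identityʳ x)) (<-≤-trans x<y (≤-reflexive (sym (*-identityʳ y))))
  ^-monoˡ-< (suc n) {x} {y} 0≤x x<y = ≤-<-trans (*-monoʳ-≤ 0≤x (<⇒≤ ih)) (<-≤-trans′ (*-monoʳ-< (≤-<-trans (^-nonNeg (suc n) 0≤x) ih) x<y))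
    where
    ih = ^-monoˡ-< n 0≤x x<y
    <-≤-trans′ : y ^ suc n * x < y ^ suc n * y → x * y ^ suc n < y * y ^ suc n
    <-≤-trans′ lt = ≤-<-trans (≤-reflexive (*-comm x _)) (<-≤-trans lt (≤-reflexive (*-comm _ y)))

  ^-cancel-≤ : ∀ n {x y} → 0# ≤ y → x ^ suc n ≤ y ^ suc n → x ≤ y
  ^-cancel-≤ n {x} {y} 0≤y x^n≤y^n with ≤-or-> x y
  ... | inj₁ x≤y = x≤y
  ... | inj₂ y<x = contradiction x^n≤y^n (<⇒≱ (^-monoˡ-< n 0≤y y<x))

  1^n≈1 : ∀ n → 1# ^ n ≈ 1#
  1^n≈1 ℕ.zero  = refl
  1^n≈1 (suc n) = trans (*-identityˡ _) (1^n≈1 n)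

  1≤x^n : ∀ n {x} → 1# ≤ x → 1# ≤ x ^ n
  1≤x^n n 1≤x = ≤-respˡ-≈ (1^n≈1 n) (^-monoˡ-≤ n 0≤1 1≤x)

  x≤∣x∣ : ∀ x → x ≤ ∣ x ∣
  x≤∣x∣ x = x≤x⊔y x (- x)

  -x≤∣x∣ : ∀ x → - x ≤ ∣ x ∣
  -x≤∣x∣ x = x≤y⊔x x (- x)

  ∣x∣≤ : ∀ {x y} → x ≤ y → - x ≤ y → ∣ x ∣ ≤ y
  ∣x∣≤ = ⊔-lub

  ∣∣-cong : ∀ {x y} → x ≈ y → ∣ x ∣ ≈ ∣ y ∣
  ∣∣-cong {x} {y} x≈y = antisym (le x≈y) (le (sym x≈y))
    where
    le : ∀ {x y} → x ≈ y → ∣ x ∣ ≤ ∣ y ∣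
    le {x} {y} eq = ∣x∣≤ (≤-respˡ-≈ (sym eq) (x≤∣x∣ y)) (≤-respˡ-≈ (-‿cong (sym eq)) (-x≤∣x∣ y))

  0≤∣x∣ : ∀ x → 0# ≤ ∣ x ∣
  0≤∣x∣ x with total 0# x
  ... | inj₁ 0≤x = ≤-trans 0≤x (x≤∣x∣ x)
  ... | inj₂ x≤0 = ≤-trans (≤-respˡ-≈ -0#≈0# (neg-mono-≤ x≤0)) (-x≤∣x∣ x)

  ∣-x∣≤∣x∣ : ∀ x → ∣ - x ∣ ≤ ∣ x ∣
  ∣-x∣≤∣x∣ x = ∣x∣≤ (-x≤∣x∣ x) (≤-respˡ-≈ (sym (-‿involutive x)) (x≤∣x∣ x))

  ∣x+y∣≤∣x∣+∣y∣ : ∀ x y → ∣ x + y ∣ ≤ ∣ x ∣ + ∣ y ∣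
  ∣x+y∣≤∣x∣+∣y∣ x y = ∣x∣≤ (+-mono-≤ (x≤∣x∣ x) (x≤∣x∣ y))
    (≤-respˡ-≈ (-‿+-comm x y) (+-mono-≤ (-x≤∣x∣ x) (-x≤∣x∣ y)))

  ∣x-y∣≤∣x∣+∣y∣ : ∀ x y → ∣ x - y ∣ ≤ ∣ x ∣ + ∣ y ∣
  ∣x-y∣≤∣x∣+∣y∣ x y = ≤-trans (∣x+y∣≤∣x∣+∣y∣ x (- y)) (+-monoʳ-≤ ∣ x ∣ (∣-x∣≤∣x∣ y))

  ∣x*y∣≤x*∣y∣ : ∀ {x} y → 0# ≤ x → ∣ x * y ∣ ≤ x * ∣ y ∣
  ∣x*y∣≤x*∣y∣ {x} y 0≤x = ∣x∣≤ (*-monoʳ-≤ 0≤x (x≤∣x∣ y)) (≤-respˡ-≈ (sym (-‿distribʳ-* x y)) (*-monoʳ-≤ 0≤x (-x≤∣x∣ y)))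

  0≤x⇒∣x∣≈x : ∀ {x} → 0# ≤ x → ∣ x ∣ ≈ x
  0≤x⇒∣x∣≈x {x} 0≤x = antisym (∣x∣≤ ≤-refl (≤-trans (≤-respʳ-≈ -0#≈0# (neg-mono-≤ 0≤x)) 0≤x)) (x≤∣x∣ x)

  -- The embeddings of ℕ and ℤ, and the Archimedean property

  fromNat-* : ∀ m n → fromNat (m ℕ.* n) ≈ fromNat m * fromNat n
  fromNat-* = ×1-homo-*

  fromNat-1 : fromNat 1 ≈ 1#
  fromNat-1 = +-identityʳ 1#

  fromNat-^ : ∀ m n → fromNat (m ℕ.^ n) ≈ fromNat m ^ n
  fromNat-^ m ℕ.zero  = fromNat-1
  fromNat-^ m (suc n) = trans (fromNat-* m (m ℕ.^ n)) (*-congˡ (fromNat-^ m n))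

  fromNat-nonNeg : ∀ n → 0# ≤ fromNat n
  fromNat-nonNeg ℕ.zero  = ≤-refl
  fromNat-nonNeg (suc n) = ≤-trans (fromNat-nonNeg n) (≤-respʳ-≈ (+-comm (fromNat n) 1#) (x≤x+y 0≤1))

  fromNat-mono : ∀ {m n} → m ℕ.≤ n → fromNat m ≤ fromNat n
  fromNat-mono {n = n} ℕ.z≤n = fromNat-nonNeg n
  fromNat-mono (ℕ.s≤s m≤n)   = +-monoʳ-≤ 1# (fromNat-mono m≤n)

  fromNat-suc : ∀ n → fromNat (suc n) ≈ fromNat n + 1#
  fromNat-suc n = +-comm 1# (fromNat n)

  fromNat-pos : ∀ n → 0# < fromNat (suc n)
  fromNat-pos n = <-≤-trans 0<1 (x≤x+y (fromNat-nonNeg n))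

  fromNat-nonZero-pos : ∀ n .{{_ : ℕ.NonZero n}} → 0# < fromNat n
  fromNat-nonZero-pos (suc n) = fromNat-pos n

  fromNat-mono-< : ∀ {m n} → m ℕ.< n → fromNat m < fromNat n
  fromNat-mono-< {m} m<n = <-≤-trans (<-≤-trans (x<x+1 (fromNat m)) (≤-reflexive (sym (fromNat-suc m)))) (fromNat-mono m<n)

  fromNat-cancel-≤ : ∀ {m n} → fromNat m ≤ fromNat n → m ℕ.≤ n
  fromNat-cancel-≤ {m} {n} le with m ℕ.≤? n
  ... | yes m≤n = m≤n
  ... | no  m≰n = contradiction le (<⇒≱ (fromNat-mono-< (ℕₚ.≰⇒> m≰n)))

  fromNat-cancel-< : ∀ {m n} → fromNat m < fromNat n → m ℕ.< n
  fromNat-cancel-< {m} {n} lt with m ℕ.<? n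
  ... | yes m<n = m<n
  ... | no  m≮n = contradiction (fromNat-mono (ℕₚ.≮⇒≥ m≮n)) (<⇒≱ lt)

  fromInt-* : ∀ i j → fromInt (i ℤ.* j) ≈ fromInt i * fromInt j
  fromInt-* i j = trans (fromInt≈⟦⟧ (i ℤ.* j)) (trans (⟦⟧-* i j) (sym (*-cong (fromInt≈⟦⟧ i) (fromInt≈⟦⟧ j))))
    where
    fromInt≈⟦⟧ : ∀ i → fromInt i ≈ ⟦ i ⟧
    fromInt≈⟦⟧ (+ n)    = M′.×ᵤ≈× n 1#
    fromInt≈⟦⟧ -[1+ n ] = -‿cong (M′.×ᵤ≈× (suc n) 1#)

  ∣fromInt∣ : ∀ i → ∣ fromInt i ∣ ≈ fromNat ℤ.∣ i ∣
  ∣fromInt∣ (+ n)    = 0≤x⇒∣x∣≈x (fromNat-nonNeg n)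
  ∣fromInt∣ -[1+ n ] = trans (antisym (∣-x∣≤∣x∣ _) (≤-respˡ-≈ (∣∣-cong (-‿involutive _)) (∣-x∣≤∣x∣ _))) (0≤x⇒∣x∣≈x (fromNat-nonNeg (suc n)))

  fromInt² : ∀ i → fromInt i ^ 2 ≈ fromNat ℤ.∣ i ∣ ^ 2
  fromInt² (+ n)    = refl
  fromInt² -[1+ n ] = solve 1 (λ x → (:- x) :^ 2 := x :^ 2) refl (fromNat (suc n))

  the-satisfies : ∀ {A : Set} (d : A) (P : Pred A 0ℓ) → ∃ P → P (the d P)
  the-satisfies d P ∃P with lem {∃ P}
  ... | yes (_ , Px) = Px
  ... | no ¬∃P       = contradiction ∃P ¬∃P

  -- Otherwise the natural numbers would have a supremum s. From n + 1 ≤ s for all n it follows that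
  -- s - 1 is also an upper bound, which is absurd.
  archimedean : ∀ x → ∃[ n ] (x < fromNat n)
  archimedean x with lem {∃[ n ] (x < fromNat n)}
  ... | yes p = p
  ... | no ¬p = contradiction (least (s - 1#) s-1-bound) (<⇒≱ (<-≤-trans (x<x+1 (s - 1#)) (≤-reflexive (solve 1 (λ s → (s :- con (+ 1)) :+ con (+ 1) := s) refl s))))
    where
    S : Pred Carrier 0ℓ
    S y = ∃[ n ] (y ≈ fromNat n)
    n≤x : ∀ n → fromNat n ≤ x
    n≤x n with ≤-or-> (fromNat n) x
    ... | inj₁ le = le
    ... | inj₂ lt = contradiction (n , lt) ¬p
    bound : UpperBound S x
    bound y (n , y≈) = ≤-respˡ-≈ (sym y≈) (n≤x n)
    sup = supremum S (0# , 0 , refl) (x , bound)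
    s = proj₁ sup
    upper = proj₁ (proj₂ sup)
    least = proj₂ (proj₂ sup)
    s-1-bound : UpperBound S (s - 1#)
    s-1-bound y (n , y≈) = begin
      y                  ≈⟨ solve 1 (λ y → y := (y :+ con (+ 1)) :- con (+ 1)) refl y ⟩
      (y + 1#) - 1#      ≤⟨ +-monoˡ-≤ (- 1#) (upper (y + 1#) (suc n , trans (+-congʳ y≈) (sym (fromNat-suc n)))) ⟩
      s - 1#             ∎
      where open ≤-Reasoning

  -- Integer parts, roots and ζ

  ∃-floor : ∀ {x} → 0# ≤ x → ∃[ n ] (fromNat n ≤ x × x < fromNat n + 1#)
  ∃-floor {x} 0≤x = descend (proj₁ (archimedean x)) (proj₂ (archimedean x))
    where
    descend : ∀ m → x < fromNat m → ∃[ n ] (fromNat n ≤ x × x < fromNat n + 1#)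
    descend ℕ.zero  x<0 = contradiction 0≤x (<⇒≱ x<0)
    descend (suc m) x<m+1 with ≤-or-> (fromNat m) x
    ... | inj₁ m≤x = m , m≤x , <-≤-trans x<m+1 (≤-reflexive (fromNat-suc m))
    ... | inj₂ x<m = descend m x<m

  floor : ∀ {x} → 0# ≤ x → ℕ
  floor 0≤x = proj₁ (∃-floor 0≤x)

  floor-≤ : ∀ {x} (0≤x : 0# ≤ x) → fromNat (floor 0≤x) ≤ x
  floor-≤ 0≤x = proj₁ (proj₂ (∃-floor 0≤x))

  <floor+1 : ∀ {x} (0≤x : 0# ≤ x) → x < fromNat (floor 0≤x) + 1#
  <floor+1 0≤x = proj₂ (proj₂ (∃-floor 0≤x))

  ≤floor : ∀ {x} (0≤x : 0# ≤ x) {m} → fromNat m ≤ x → m ℕ.≤ floor 0≤x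
  ≤floor 0≤x {m} m≤x = ℕₚ.≤-pred (fromNat-cancel-< (<-≤-trans (≤-<-trans m≤x (<floor+1 0≤x)) (≤-reflexive (sym (fromNat-suc (floor 0≤x))))))

  -- `⌊ x ⌋` is some integer chosen by its defining inequalities, so it has to be identified by
  -- uniqueness. A negative candidate would put x below 0.
  ⌊⌋≡floor : ∀ {x} (0≤x : 0# ≤ x) → ⌊ x ⌋ ≡ + floor 0≤x
  ⌊⌋≡floor {x} 0≤x = unique ⌊ x ⌋ (the-satisfies (+ 0) (λ m → fromInt m ≤ x × x < fromInt m + 1#) (+ floor 0≤x , floor-≤ 0≤x , <floor+1 0≤x))
    where
    unique : ∀ m → fromInt m ≤ x × x < fromInt m + 1# → m ≡ + floor 0≤x
    unique (+ m) (m≤x , x<m+1) = ≡.cong +_ (ℕₚ.≤-antisym (≤floor 0≤x m≤x)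
      (ℕₚ.≤-pred (fromNat-cancel-< (≤-<-trans (floor-≤ 0≤x) (<-≤-trans x<m+1 (≤-reflexive (sym (fromNat-suc m))))))))
    unique -[1+ m ] (_ , x<) = contradiction 0≤x (<⇒≱ (<-≤-trans x< (begin
      - fromNat (suc m) + 1#     ≈⟨ solve 1 (λ m → (:- (con (+ 1) :+ m)) :+ con (+ 1) := :- m) refl (fromNat m) ⟩
      - fromNat m                ≤⟨ neg-mono-≤ (fromNat-nonNeg m) ⟩
      - 0#                       ≈⟨ -0#≈0# ⟩
      0#                         ∎)))
      where open ≤-Reasoning

  -- Takes the smaller of b and ε / (C + 1); the summand 1 keeps the denominator positive when C =
  -- 0.
  small : ∀ {ε C b} → 0# < ε → 0# ≤ C → 0# < b → ∃[ h ] (0# < h × h ≤ b × h * C ≤ ε)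
  small {ε} {C} {b} 0<ε 0≤C 0<b with total b (ε / (C + 1#))
  ... | inj₁ b≤ = b , 0<b , ≤-refl , ≤-trans (*-monoʳ-≤ (<⇒≤ 0<b) (x≤x+y 0≤1)) (≤/⇒*≤ (0<x+1 0≤C) b≤)
  ... | inj₂ ≤b = h , *-pos 0<ε (⁻¹-pos (0<x+1 0≤C)) , ≤b , ≤-trans (*-monoʳ-≤ (/-nonNeg (<⇒≤ 0<ε) (0<x+1 0≤C)) (x≤x+y 0≤1)) (≤-reflexive (x/y*y≈x (0<x+1 0≤C)))
    where h = ε / (C + 1#)

  -- Continuity of the power function from the right, with a linear bound in place of a derivative.
  -- In the induction the term in h² is made linear by h ≤ 1.
  ^-upper : ∀ n {s} → 0# ≤ s → ∃[ C ] (0# ≤ C × ∀ h → 0# ≤ h → h ≤ 1# → (s + h) ^ n ≤ s ^ n + h * C)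
  ^-upper ℕ.zero  {s} 0≤s = 0# , ≤-refl , λ h _ _ → ≤-reflexive (solve 1 (λ h → con (+ 1) := con (+ 1) :+ h :* con (+ 0)) refl h)
  ^-upper (suc n) {s} 0≤s with ^-upper n 0≤s
  ... | C , 0≤C , bound = s ^ n + (s + 1#) * C , ≤-trans (^-nonNeg n 0≤s) (x≤x+y (*-nonNeg (≤-trans 0≤s (x≤x+y 0≤1)) 0≤C)) , λ h 0≤h h≤1 → begin
      (s + h) * (s + h) ^ n               ≤⟨ *-monoʳ-≤ (≤-trans 0≤s (x≤x+y 0≤h)) (bound h 0≤h h≤1) ⟩
      (s + h) * (s ^ n + h * C)           ≈⟨ solve 4 (λ s h p c → (s :+ h) :* (p :+ h :* c) := (s :* p :+ h :* p) :+ (h :* c) :* (s :+ h)) refl s h (s ^ n) C ⟩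
      (s * s ^ n + h * s ^ n) + (h * C) * (s + h)  ≤⟨ +-monoʳ-≤ _ (*-monoʳ-≤ (*-nonNeg 0≤h 0≤C) (+-monoʳ-≤ s h≤1)) ⟩
      (s * s ^ n + h * s ^ n) + (h * C) * (s + 1#) ≈⟨ solve 4 (λ s h p c → (s :* p :+ h :* p) :+ (h :* c) :* (s :+ con (+ 1)) := s :* p :+ h :* (p :+ (s :+ con (+ 1)) :* c)) refl s h (s ^ n) C ⟩
      s * s ^ n + h * (s ^ n + (s + 1#) * C) ∎
    where open ≤-Reasoning

  -- The counterpart from the left. The term h² C has a favourable sign, and h ≤ s keeps the base s
  -- - h nonnegative, so that the induction hypothesis can be multiplied by it.
  ^-lower : ∀ n {s} → 0# ≤ s → ∃[ C ] (0# ≤ C × ∀ h → 0# ≤ h → h ≤ s → s ^ n - h * C ≤ (s - h) ^ n)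
  ^-lower ℕ.zero  {s} 0≤s = 0# , ≤-refl , λ h _ _ → ≤-reflexive (solve 1 (λ h → con (+ 1) :- h :* con (+ 0) := con (+ 1)) refl h)
  ^-lower (suc n) {s} 0≤s with ^-lower n 0≤s
  ... | C , 0≤C , bound = s ^ n + s * C , ≤-trans (^-nonNeg n 0≤s) (x≤x+y (*-nonNeg 0≤s 0≤C)) , λ h 0≤h h≤s → begin
      s * s ^ n - h * (s ^ n + s * C)                   ≤⟨ x≤x+y (*-nonNeg (*-nonNeg 0≤h 0≤h) 0≤C) ⟩
      s * s ^ n - h * (s ^ n + s * C) + (h * h) * C     ≈⟨ solve 4 (λ s h p c → s :* p :- h :* (p :+ s :* c) :+ (h :* h) :* c := (s :- h) :* (p :- h :* c)) refl s h (s ^ n) C ⟩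
      (s - h) * (s ^ n - h * C)                         ≤⟨ *-monoʳ-≤ (x≤y⇒0≤y-x h≤s) (bound h 0≤h h≤s) ⟩
      (s - h) * (s - h) ^ n                             ∎
    where open ≤-Reasoning

  ^-increase : ∀ k {s x} → 0# ≤ s → s ^ k < x → ∃[ h ] (0# < h × (s + h) ^ k ≤ x)
  ^-increase k {s} {x} 0≤s s^k<x with ^-upper k 0≤s
  ... | C , 0≤C , bound with small (x<y⇒0<y-x s^k<x) 0≤C 0<1
  ...   | h , 0<h , h≤1 , hC≤ = h , 0<h , (begin
    (s + h) ^ k           ≤⟨ bound h (<⇒≤ 0<h) h≤1 ⟩
    s ^ k + h * C         ≤⟨ +-monoʳ-≤ (s ^ k) hC≤ ⟩
    s ^ k + (x - s ^ k)   ≈⟨ solve 2 (λ s x → s :+ (x :- s) := x) refl (s ^ k) x ⟩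
    x                     ∎)
    where open ≤-Reasoning

  ^-decrease : ∀ k {s x} → 0# < s → x < s ^ k → ∃[ h ] (0# < h × h ≤ s × x ≤ (s - h) ^ k)
  ^-decrease k {s} {x} 0<s x<s^k with ^-lower k (<⇒≤ 0<s)
  ... | C , 0≤C , bound with small (x<y⇒0<y-x x<s^k) 0≤C 0<s
  ...   | h , 0<h , h≤s , hC≤ = h , 0<h , h≤s , (begin
    x                       ≈⟨ solve 2 (λ s x → x := s :- (s :- x)) refl (s ^ k) x ⟩
    s ^ k - (s ^ k - x)     ≤⟨ +-monoʳ-≤ (s ^ k) (neg-mono-≤ hC≤) ⟩
    s ^ k - h * C           ≤⟨ bound h (<⇒≤ 0<h) h≤s ⟩
    (s - h) ^ k             ∎)
    where open ≤-Reasoning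

  x≤[x+1]^n : ∀ n {x} → 0# ≤ x → x ≤ (x + 1#) ^ suc n
  x≤[x+1]^n n {x} 0≤x = begin
    x                     ≤⟨ x≤x+y 0≤1 ⟩
    x + 1#                ≈⟨ *-identityʳ (x + 1#) ⟨
    (x + 1#) * 1#         ≤⟨ *-monoʳ-≤ (<⇒≤ (0<x+1 0≤x)) (1≤x^n n (≤-trans (≤-reflexive (sym (+-identityˡ 1#))) (+-monoˡ-≤ 1# 0≤x))) ⟩
    (x + 1#) ^ suc n      ∎
    where open ≤-Reasoning

  0^n≈0 : ∀ n → 0# ^ suc n ≈ 0#
  0^n≈0 n = zeroˡ (0# ^ n)

  -- The root is the supremum s of the y ≥ 0 whose power is at most x. If the power of s fell short
  -- of x, some s + h would still be in the set; if it exceeded x, some s - h would still be an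
  -- upper bound.
  ∃-root : ∀ n {x} → 0# ≤ x → ∃[ y ] (0# ≤ y × y ^ suc n ≈ x)
  -- The bound is x + 1 because x itself fails for small x: roots of numbers below 1 are larger than
  -- the numbers.
  ∃-root n {x} 0≤x = from-sup (supremum S (0# , 0∈S) (x + 1# , λ y (0≤y , y^k≤x) → ^-cancel-≤ n (<⇒≤ (0<x+1 0≤x)) (≤-trans y^k≤x (x≤[x+1]^n n 0≤x))))
    where
    S : Pred Carrier 0ℓ
    S y = 0# ≤ y × y ^ suc n ≤ x
    0∈S : S 0#
    0∈S = ≤-refl , ≤-respˡ-≈ (sym (0^n≈0 n)) 0≤x
    from-sup : ∃[ s ] (UpperBound S s × (∀ u → UpperBound S u → s ≤ u)) → ∃[ y ] (0# ≤ y × y ^ suc n ≈ x)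
    from-sup (s , upper , least) = s , 0≤s , antisym s^n≤x x≤s^n
      where
      0≤s : 0# ≤ s
      0≤s = upper 0# 0∈S
      too-small : ¬ (∃[ h ] (0# < h × (s + h) ^ suc n ≤ x))
      too-small (h , 0<h , [s+h]^n≤x) = <⇒≱ (x<x+y 0<h) (upper (s + h) (≤-trans 0≤s (x≤x+y (<⇒≤ 0<h)) , [s+h]^n≤x))
      too-big : ¬ (∃[ h ] (0# < h × h ≤ s × x ≤ (s - h) ^ suc n))
      too-big (h , 0<h , h≤s , x≤[s-h]^n) = <⇒≱ (x-y<x 0<h)
        (least (s - h) λ y (0≤y , y^n≤x) → ^-cancel-≤ n (x≤y⇒0≤y-x h≤s) (≤-trans y^n≤x x≤[s-h]^n))
      x≤s^n : x ≤ s ^ suc n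
      x≤s^n = [ id , (λ s^n<x → contradiction (^-increase (suc n) 0≤s s^n<x) too-small) ]′ (≤-or-> x (s ^ suc n))
      s^n≤x : s ^ suc n ≤ x
      s^n≤x = [ id , (λ x<s^n → contradiction (^-decrease (suc n) (0<s x<s^n) x<s^n) too-big) ]′ (≤-or-> (s ^ suc n) x)
        where
        0<s : x < s ^ suc n → 0# < s
        0<s x<s^n = 0≤s , λ 0≈s → <⇒≱ (≤-<-trans 0≤x x<s^n) (≤-reflexive (trans (^-congˡ (suc n) (sym 0≈s)) (0^n≈0 n)))

  module _ (n : ℕ) {x : Carrier} (0≤x : 0# ≤ x) where
    private
      root-spec : 0# ≤ x ^1/ suc n × (x ^1/ suc n) ^ suc n ≈ x
      root-spec = the-satisfies 0# (λ y → 0# ≤ y × y ^ suc n ≈ x) (∃-root n 0≤x)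

    root-nonNeg : 0# ≤ x ^1/ suc n
    root-nonNeg = proj₁ root-spec

    root-^ : (x ^1/ suc n) ^ suc n ≈ x
    root-^ = proj₂ root-spec

  root-pos : ∀ n {x} → 0# < x → 0# < x ^1/ suc n
  root-pos n {x} 0<x = root-nonNeg n 0≤x , λ 0≈r → proj₂ 0<x (trans (sym (zeroˡ (0# ^ n))) (trans (^-congˡ (suc n) 0≈r) (root-^ n 0≤x)))
    where 0≤x = <⇒≤ 0<x

  -- Sums over 1 ≤ n ≤ M.
  ∑ : ℕ → (ℕ → Carrier) → Carrier
  ∑ ℕ.zero  f = 0#
  ∑ (suc M) f = ∑ M f + f (suc M)

  ∑-cong : ∀ M {f g} → (∀ n .{{_ : ℕ.NonZero n}} → f n ≈ g n) → ∑ M f ≈ ∑ M g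
  ∑-cong ℕ.zero  f≈g = refl
  ∑-cong (suc M) f≈g = +-cong (∑-cong M f≈g) (f≈g (suc M))

  ∑-cong-≤ : ∀ M {f g} → (∀ n .{{_ : ℕ.NonZero n}} → n ℕ.≤ M → f n ≈ g n) → ∑ M f ≈ ∑ M g
  ∑-cong-≤ ℕ.zero  f≈g = refl
  ∑-cong-≤ (suc M) f≈g = +-cong (∑-cong-≤ M (λ n n≤M → f≈g n (ℕₚ.m≤n⇒m≤1+n n≤M))) (f≈g (suc M) ℕₚ.≤-refl)

  ∑-- : ∀ M f g → ∑ M (λ n → f n - g n) ≈ ∑ M f - ∑ M g
  ∑-- ℕ.zero  f g = sym (-‿inverseʳ 0#)
  ∑-- (suc M) f g = trans (+-congʳ (∑-- M f g)) (solve 4 (λ a b c d → (a :- b) :+ (c :- d) := (a :+ c) :- (b :+ d)) refl (∑ M f) (∑ M g) (f (suc M)) (g (suc M)))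

  ∑-* : ∀ M c f → ∑ M (λ n → c * f n) ≈ c * ∑ M f
  ∑-* ℕ.zero  c f = sym (zeroʳ c)
  ∑-* (suc M) c f = trans (+-congʳ (∑-* M c f)) (sym (distribˡ c _ _))

  ∑-monoˡ : ∀ {M N} f → (∀ n .{{_ : ℕ.NonZero n}} → 0# ≤ f n) → M ℕ.≤ N → ∑ M f ≤ ∑ N f
  ∑-monoˡ {N = ℕ.zero} f 0≤f ℕ.z≤n = ≤-refl
  ∑-monoˡ {M} {suc N} f 0≤f M≤ with ℕₚ.m≤n⇒m<n∨m≡n M≤
  ... | inj₁ (ℕ.s≤s M≤N) = ≤-trans (∑-monoˡ f 0≤f M≤N) (x≤x+y (0≤f (suc N)))
  ... | inj₂ ≡.refl = ≤-refl

  1/ⁿ : ℕ → Carrier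
  1/ⁿ n = fromNat n ⁻¹

  1/ⁿ-pos : ∀ n .{{_ : ℕ.NonZero n}} → 0# < 1/ⁿ n
  1/ⁿ-pos n = ⁻¹-pos (fromNat-nonZero-pos n)

  n*1/ⁿ : ∀ n .{{_ : ℕ.NonZero n}} → fromNat n * 1/ⁿ n ≈ 1#
  n*1/ⁿ n = *-inverseʳ (0<x⇒x≉0 (fromNat-nonZero-pos n))

  1/ⁿ-1 : 1/ⁿ 1 ≈ 1#
  1/ⁿ-1 = trans (sym (*-identityˡ _)) (trans (*-congʳ (sym fromNat-1)) (n*1/ⁿ 1))

  1/ⁿ-* : ∀ m n .{{_ : ℕ.NonZero m}} .{{_ : ℕ.NonZero n}} → 1/ⁿ (m ℕ.* n) ≈ 1/ⁿ m * 1/ⁿ n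
  1/ⁿ-* m n = *-cancelˡ-≈ (fromNat-nonZero-pos (m ℕ.* n) {{ℕₚ.m*n≢0 m n}}) (begin-equality
    fromNat (m ℕ.* n) * 1/ⁿ (m ℕ.* n)             ≈⟨ n*1/ⁿ (m ℕ.* n) {{ℕₚ.m*n≢0 m n}} ⟩
    1#                                            ≈⟨ *-identityˡ 1# ⟨
    1# * 1#                                       ≈⟨ *-cong (n*1/ⁿ m) (n*1/ⁿ n) ⟨
    (fromNat m * 1/ⁿ m) * (fromNat n * 1/ⁿ n)     ≈⟨ solve 4 (λ a b c d → (a :* b) :* (c :* d) := (a :* c) :* (b :* d)) refl (fromNat m) (1/ⁿ m) (fromNat n) (1/ⁿ n) ⟩
    (fromNat m * fromNat n) * (1/ⁿ m * 1/ⁿ n)     ≈⟨ *-congʳ (fromNat-* m n) ⟨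
    fromNat (m ℕ.* n) * (1/ⁿ m * 1/ⁿ n)           ∎)
    where open ≤-Reasoning

  1/ⁿ≤1 : ∀ n .{{_ : ℕ.NonZero n}} → 1/ⁿ n ≤ 1#
  1/ⁿ≤1 n@(suc m) = ≤-respˡ-≈ (*-identityˡ _) (≤-respʳ-≈ (n*1/ⁿ n) (*-monoˡ-≤ (<⇒≤ (1/ⁿ-pos n)) (x≤x+y (fromNat-nonNeg m))))

  1/ⁿ-suc : ∀ n .{{_ : ℕ.NonZero n}} → 1/ⁿ n - 1/ⁿ (suc n) ≈ 1/ⁿ n * 1/ⁿ (suc n)
  1/ⁿ-suc n = begin-equality
    a - b                                           ≈⟨ +-cong (*-identityʳ a) (-‿cong (*-identityʳ b)) ⟨
    a * 1# - b * 1#                                 ≈⟨ +-cong (*-congˡ (n*1/ⁿ (suc n))) (-‿cong (*-congˡ (n*1/ⁿ n))) ⟨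
    a * (fromNat (suc n) * b) - b * (fromNat n * a) ≈⟨ solve 3 (λ a b n → a :* ((con (+ 1) :+ n) :* b) :- b :* (n :* a) := a :* b) refl a b (fromNat n) ⟩
    a * b                                           ∎
    where
    open ≤-Reasoning
    a = 1/ⁿ n
    b = 1/ⁿ (suc n)

  1/ⁿ-suc-≤ : ∀ n .{{_ : ℕ.NonZero n}} → 1/ⁿ (suc n) ≤ 1/ⁿ n
  1/ⁿ-suc-≤ n = 0≤y-x⇒x≤y (≤-respʳ-≈ (sym (1/ⁿ-suc n)) (*-nonNeg (<⇒≤ (1/ⁿ-pos n)) (<⇒≤ (1/ⁿ-pos (suc n)))))

  1/ⁿ-small : ∀ {ε} → 0# < ε → ∃[ n₀ ] (ℕ.NonZero n₀ × (∀ n .{{_ : ℕ.NonZero n}} → n₀ ℕ.≤ n → 1/ⁿ n ≤ ε))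
  1/ⁿ-small {ε} 0<ε with archimedean (ε ⁻¹)
  ... | n₀ , ε⁻¹<n₀ = suc n₀ , _ , λ n n₀<n → *-cancelˡ-≤ (fromNat-nonZero-pos n) (begin
    fromNat n * 1/ⁿ n     ≈⟨ n*1/ⁿ n ⟩
    1#                    ≈⟨ *-inverseʳ (0<x⇒x≉0 0<ε) ⟨
    ε * ε ⁻¹              ≤⟨ *-monoʳ-≤ (<⇒≤ 0<ε) (≤-trans (<⇒≤ ε⁻¹<n₀) (fromNat-mono {n₀} {n} (ℕₚ.<⇒≤ n₀<n))) ⟩
    ε * fromNat n         ≈⟨ *-comm ε (fromNat n) ⟩
    fromNat n * ε         ∎)
    where open ≤-Reasoning

  1/x^n≈x⁻¹^n : ∀ n {x} → 0# < x → 1# / x ^ n ≈ (x ⁻¹) ^ n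
  1/x^n≈x⁻¹^n n {x} 0<x = *-cancelˡ-≈ (^-pos n 0<x) (begin-equality
    x ^ n * (1# / x ^ n)     ≈⟨ *-comm _ _ ⟩
    (1# / x ^ n) * x ^ n     ≈⟨ x/y*y≈x (^-pos n 0<x) ⟩
    1#                       ≈⟨ 1^n≈1 n ⟨
    1# ^ n                   ≈⟨ ^-congˡ n (*-inverseʳ (0<x⇒x≉0 0<x)) ⟨
    (x * x ⁻¹) ^ n           ≈⟨ ^-distrib-* x (x ⁻¹) n ⟩
    x ^ n * (x ⁻¹) ^ n       ∎)
    where open ≤-Reasoning

  module Zeta (k : ℕ) where

    -- Writing s = k + 2 builds in s ≥ 2, hence convergence, and makes the exponent s - 1 of the
    -- tails a successor.
    s : ℕ
    s = suc (suc k)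

    -- Σ_{n > M} n⁻ˢ ≤ tail M, by telescoping.
    w tail : ℕ → Carrier
    w n    = 1/ⁿ n ^ s
    tail n = 1/ⁿ n ^ suc k

    Z : ℕ → Carrier
    Z M = ∑ M w

    w-pos : ∀ n .{{_ : ℕ.NonZero n}} → 0# < w n
    w-pos n = ^-pos s (1/ⁿ-pos n)

    tail-nonNeg : ∀ n .{{_ : ℕ.NonZero n}} → 0# ≤ tail n
    tail-nonNeg n = ^-nonNeg (suc k) (<⇒≤ (1/ⁿ-pos n))

    ∑n⁻≈Z : ∀ M → ∑[n≤ M ]n⁻ s ≈ Z M
    ∑n⁻≈Z ℕ.zero  = refl
    ∑n⁻≈Z (suc M) = +-cong (∑n⁻≈Z M) (1/x^n≈x⁻¹^n s (fromNat-pos M))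

    -- With a = 1/n and b = 1/(n+1) one has a b = a - b. Hence b^s ≤ a b · b^k = (a - b) b^k ≤
    -- a^(s-1) - b^(s-1).
    w≤Δtail : ∀ n .{{_ : ℕ.NonZero n}} → w (suc n) ≤ tail n - tail (suc n)
    w≤Δtail n = begin
      b * (b * b ^ k)                 ≤⟨ *-monoˡ-≤ (*-nonNeg 0≤b (^-nonNeg k 0≤b)) (1/ⁿ-suc-≤ n) ⟩
      a * (b * b ^ k)                 ≈⟨ solve 3 (λ a b p → a :* (b :* p) := (a :* b) :* p) refl a b (b ^ k) ⟩
      (a * b) * b ^ k                 ≈⟨ *-congʳ (1/ⁿ-suc n) ⟨
      (a - b) * b ^ k                 ≈⟨ solve 3 (λ a b p → (a :- b) :* p := a :* p :- b :* p) refl a b (b ^ k) ⟩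
      a * b ^ k - b * b ^ k           ≤⟨ +-monoˡ-≤ _ (*-monoʳ-≤ (<⇒≤ (1/ⁿ-pos n)) (^-monoˡ-≤ k 0≤b (1/ⁿ-suc-≤ n))) ⟩
      a * a ^ k - b * b ^ k           ∎
      where
      open ≤-Reasoning
      a = 1/ⁿ n
      b = 1/ⁿ (suc n)
      0≤b : 0# ≤ b
      0≤b = <⇒≤ (1/ⁿ-pos (suc n))

    -- While the partial sums increase, the sums corrected by `tail` decrease. This brackets every
    -- later partial sum, and in the limit ζ(s), between two values at D.
    Z+tail-antitone : ∀ {D M} .{{_ : ℕ.NonZero D}} → D ℕ.≤ M → Z M + tail M ≤ Z D + tail D
    Z+tail-antitone {D} {ℕ.zero} D≤M = contradiction (ℕₚ.n≤0⇒n≡0 D≤M) (ℕ.≢-nonZero⁻¹ D)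
    Z+tail-antitone {D} {suc M} D≤ with ℕₚ.m≤n⇒m<n∨m≡n D≤
    ... | inj₂ ≡.refl = ≤-refl
    ... | inj₁ (ℕ.s≤s D≤M) = ≤-trans step (Z+tail-antitone D≤M)
      where
      open ≤-Reasoning
      instance
        M-nonZero : ℕ.NonZero M
        M-nonZero = ℕ.>-nonZero (ℕₚ.<-≤-trans (ℕ.>-nonZero⁻¹ D) D≤M)
      step : Z (suc M) + tail (suc M) ≤ Z M + tail M
      step = begin
        Z M + w (suc M) + tail (suc M)                 ≤⟨ +-monoˡ-≤ _ (+-monoʳ-≤ _ (w≤Δtail M)) ⟩
        Z M + (tail M - tail (suc M)) + tail (suc M)   ≈⟨ solve 3 (λ z t u → z :+ (t :- u) :+ u := z :+ t) refl (Z M) (tail M) (tail (suc M)) ⟩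
        Z M + tail M                                   ∎

    Z-mono : ∀ {M N} → M ℕ.≤ N → Z M ≤ Z N
    Z-mono = ∑-monoˡ w (λ n → <⇒≤ (w-pos n))

    Z-bound : ∀ {D} M .{{_ : ℕ.NonZero D}} → Z M ≤ Z D + tail D
    Z-bound {D} M with ℕₚ.≤-total D M
    ... | inj₁ D≤M = ≤-trans (x≤x+y (tail-nonNeg M {{ℕ.>-nonZero (ℕₚ.<-≤-trans (ℕ.>-nonZero⁻¹ D) D≤M)}})) (Z+tail-antitone D≤M)
    ... | inj₂ M≤D = ≤-trans (Z-mono M≤D) (x≤x+y (tail-nonNeg D))

    -- The partial sums increase and stay below Z 1 + tail 1, so their supremum is a limit. This
    -- supplies the witness without which `the` would return its default.
    ζ-converges : Converges (λ m → ∑[n≤ m ]n⁻ s) (ζ s)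
    ζ-converges = the-satisfies 0# (Converges (λ m → ∑[n≤ m ]n⁻ s)) (l , converges)
      where
      S : Pred Carrier 0ℓ
      S y = ∃[ M ] (y ≈ Z M)
      sup = supremum S (0# , 0 , refl) (Z 1 + tail 1 , λ y (M , y≈) → ≤-respˡ-≈ (sym y≈) (Z-bound {1} M))
      l = proj₁ sup
      upper = proj₁ (proj₂ sup)
      least = proj₂ (proj₂ sup)
      near : ∀ {ε} → 0# < ε → ∃[ M ] (l - ε < Z M)
      near {ε} 0<ε with lem {∃[ M ] (l - ε < Z M)}
      ... | yes p = p
      ... | no ¬p = contradiction (least (l - ε) bound) (<⇒≱ (x-y<x 0<ε))
        where
        bound : UpperBound S (l - ε)
        bound y (M , y≈) with ≤-or-> (Z M) (l - ε)
        ... | inj₁ le = ≤-respˡ-≈ (sym y≈) le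
        ... | inj₂ lt = contradiction (M , lt) ¬p
      converges : Converges (λ m → ∑[n≤ m ]n⁻ s) l
      converges ε 0<ε with near 0<ε
      ... | n₀ , l-ε<Z = n₀ , λ n n₀≤n → ≤-<-trans (≤-reflexive (∣∣-cong (+-congʳ (∑n⁻≈Z n))))
              (≤-<-trans (∣x∣≤ (≤-trans (Z≤l n) (0≤l-Zn n)) (≤-reflexive (solve 2 (λ z l → :- (z :- l) := l :- z) refl (Z n) l)))
                (0<y-x⇒x<y (<-≤-trans (x<y⇒0<y-x (<-≤-trans l-ε<Z (Z-mono n₀≤n))) (≤-reflexive (solve 3 (λ z l e → z :- (l :- e) := e :- (l :- z)) refl (Z n) l ε)))))
        where
        0≤l-Zn : ∀ n → 0# ≤ l - Z n
        0≤l-Zn n = x≤y⇒0≤y-x (upper (Z n) (n , refl))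
        Z≤l : ∀ n → Z n - l ≤ 0#
        Z≤l n = ≤-trans (+-monoˡ-≤ (- l) (upper (Z n) (n , refl))) (≤-reflexive (-‿inverseʳ l))

    -- `ζ s` is only known to be some limit of the partial sums, not the supremum used to show that
    -- a limit exists. A bound on it is obtained by contradiction from a partial sum that is close
    -- to it and has index at least M.
    ∃-close : ∀ {ε} M → 0# < ε → ∃[ n ] (M ℕ.≤ n × ∣ Z n - ζ s ∣ < ε)
    ∃-close {ε} M 0<ε = close (ζ-converges ε 0<ε)
      where
      close : ∃[ n₀ ] (∀ n → n₀ ℕ.≤ n → ∣ ∑[n≤ n ]n⁻ s - ζ s ∣ < ε) → ∃[ n ] (M ℕ.≤ n × ∣ Z n - ζ s ∣ < ε)
      close (n₀ , c) = n₀ ℕ.⊔ M , ℕₚ.m≤n⊔m n₀ M ,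
        ≤-<-trans (≤-reflexive (∣∣-cong (+-congʳ (sym (∑n⁻≈Z (n₀ ℕ.⊔ M)))))) (c (n₀ ℕ.⊔ M) (ℕₚ.m≤m⊔n n₀ M))

    Z≤ζ : ∀ M → Z M ≤ ζ s
    Z≤ζ M = [ id , (λ ζ<Z → contradiction (∃-close M (x<y⇒0<y-x ζ<Z)) far) ]′ (≤-or-> (Z M) (ζ s))
      where
      far : ¬ (∃[ n ] (M ℕ.≤ n × ∣ Z n - ζ s ∣ < Z M - ζ s))
      far (n , M≤n , close) = <⇒≱ close (≤-trans (+-monoˡ-≤ (- ζ s) (Z-mono M≤n)) (x≤∣x∣ (Z n - ζ s)))

    ζ≤Z+tail : ∀ D .{{_ : ℕ.NonZero D}} → ζ s ≤ Z D + tail D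
    ζ≤Z+tail D = [ id , (λ <ζ → contradiction (∃-close 0 (x<y⇒0<y-x <ζ)) far) ]′ (≤-or-> (ζ s) (Z D + tail D))
      where
      open ≤-Reasoning
      far : ¬ (∃[ n ] (0 ℕ.≤ n × ∣ Z n - ζ s ∣ < ζ s - (Z D + tail D)))
      far (n , _ , close) = <⇒≱ close (begin
        ζ s - (Z D + tail D)   ≤⟨ +-monoʳ-≤ (ζ s) (neg-mono-≤ (Z-bound n)) ⟩
        ζ s - Z n              ≈⟨ solve 2 (λ z l → l :- z := :- (z :- l)) refl (Z n) (ζ s) ⟩
        - (Z n - ζ s)          ≤⟨ -x≤∣x∣ (Z n - ζ s) ⟩
        ∣ Z n - ζ s ∣          ∎)

    Z1≈1 : Z 1 ≈ 1#
    Z1≈1 = trans (+-identityˡ _) (trans (^-congˡ s 1/ⁿ-1) (1^n≈1 s))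

    1≤ζ : 1# ≤ ζ s
    1≤ζ = ≤-respˡ-≈ Z1≈1 (Z≤ζ 1)

    0<ζ : 0# < ζ s
    0<ζ = <-≤-trans 0<1 1≤ζ

  -- The sieve

  abstract
    -- The indicator of a proposition, decided by excluded middle. It is abstract, so that only the
    -- laws below enter and the decision is never unfolded.
    χ : Set → Carrier
    χ P with lem {P}
    ... | yes _ = 1#
    ... | no  _ = 0#

    χ-yes : ∀ {P} → P → χ P ≈ 1#
    χ-yes {P} p with lem {P}
    ... | yes _ = refl
    ... | no ¬p = contradiction p ¬p

    χ-no : ∀ {P} → ¬ P → χ P ≈ 0#
    χ-no {P} ¬p with lem {P}
    ... | yes p = contradiction p ¬p
    ... | no _  = refl

    0≤χ : ∀ P → 0# ≤ χ P
    0≤χ P with lem {P}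
    ... | yes _ = 0≤1
    ... | no  _ = ≤-refl

    χ≤1 : ∀ P → χ P ≤ 1#
    χ≤1 P with lem {P}
    ... | yes _ = ≤-refl
    ... | no  _ = 0≤1

    χ-cong : ∀ {P Q} → (P → Q) → (Q → P) → χ P ≈ χ Q
    χ-cong {P} {Q} f g with lem {P}
    ... | yes p = sym (χ-yes (f p))
    ... | no ¬p = sym (χ-no (¬p ∘ g))

  χ-yes-* : ∀ {P x} → P → χ P * x ≈ x
  χ-yes-* {x = x} p = trans (*-congʳ (χ-yes p)) (*-identityˡ x)

  χ-no-* : ∀ {P x} → ¬ P → χ P * x ≈ 0#
  χ-no-* {x = x} ¬p = trans (*-congʳ (χ-no ¬p)) (zeroˡ x)

  ∑-+ : ∀ M f g → ∑ M (λ n → f n + g n) ≈ ∑ M f + ∑ M g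
  ∑-+ ℕ.zero  f g = sym (+-identityˡ 0#)
  ∑-+ (suc M) f g = trans (+-congʳ (∑-+ M f g)) (solve 4 (λ a b c d → (a :+ b) :+ (c :+ d) := (a :+ c) :+ (b :+ d)) refl (∑ M f) (∑ M g) (f (suc M)) (g (suc M)))

  ∑-mono : ∀ M {f g} → (∀ n .{{_ : ℕ.NonZero n}} → f n ≤ g n) → ∑ M f ≤ ∑ M g
  ∑-mono ℕ.zero  f≤g = ≤-refl
  ∑-mono (suc M) f≤g = +-mono-≤ (∑-mono M f≤g) (f≤g (suc M))

  ∑-0 : ∀ M → ∑ M (λ _ → 0#) ≈ 0#
  ∑-0 ℕ.zero  = refl
  ∑-0 (suc M) = trans (+-identityʳ _) (∑-0 M)

  ∑-1 : ∀ M → ∑ M (λ _ → 1#) ≈ fromNat M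
  ∑-1 ℕ.zero  = refl
  ∑-1 (suc M) = trans (+-congʳ (∑-1 M)) (sym (fromNat-suc M))

  ∑-single : ∀ {M x} (f : ℕ → Carrier) .{{_ : ℕ.NonZero x}} → x ℕ.≤ M → ∑ M (λ m → χ (m ≡ x) * f m) ≈ f x
  ∑-single {ℕ.zero} {suc x} f ()
  ∑-single {suc M} {x} f x≤ = [ below , (λ { ≡.refl → top }) ]′ (ℕₚ.m≤n⇒m<n∨m≡n x≤)
    where
    below : x ℕ.< suc M → ∑ (suc M) (λ m → χ (m ≡ x) * f m) ≈ f x
    below x<sucM = trans (+-cong (∑-single f (ℕₚ.≤-pred x<sucM)) (χ-no-* (ℕₚ.>⇒≢ x<sucM))) (+-identityʳ (f x))
    top : ∑ (suc M) (λ m → χ (m ≡ suc M) * f m) ≈ f (suc M)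
    top = trans (+-cong (trans (∑-cong-≤ M (λ n n≤M → χ-no-* (ℕₚ.<⇒≢ (ℕ.s≤s n≤M)))) (∑-0 M)) (χ-yes-* ≡.refl)) (+-identityˡ (f (suc M)))

  sumᴸ : (ℕ → Carrier) → List ℕ → Carrier
  sumᴸ f []       = 0#
  sumᴸ f (x ∷ xs) = f x + sumᴸ f xs

  sumᴸ-++ : ∀ f xs ys → sumᴸ f (xs ++ ys) ≈ sumᴸ f xs + sumᴸ f ys
  sumᴸ-++ f []       ys = sym (+-identityˡ _)
  sumᴸ-++ f (x ∷ xs) ys = trans (+-congˡ (sumᴸ-++ f xs ys)) (sym (+-assoc _ _ _))

  sumᴸ-map : ∀ f g xs → sumᴸ f (map g xs) ≈ sumᴸ (f ∘ g) xs
  sumᴸ-map f g []       = refl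
  sumᴸ-map f g (x ∷ xs) = +-congˡ (sumᴸ-map f g xs)

  sumᴸ-cong : ∀ {f g} xs → (∀ x → f x ≡ g x) → sumᴸ f xs ≈ sumᴸ g xs
  sumᴸ-cong []       f≡g = refl
  sumᴸ-cong (x ∷ xs) f≡g = +-cong (reflexive (f≡g x)) (sumᴸ-cong xs f≡g)

  InRange : ℕ → ℕ → Set
  InRange M d = ℕ.NonZero d × d ℕ.≤ M

  -- Serves to compare a sum over the numbers d produced by the sieve, which are not in increasing
  -- order, with a sum over an initial segment. Distinctness ensures that no index is counted twice.
  unique-sumᴸ : ∀ (f : ℕ → Carrier) {M xs} → Unique xs → All (InRange M) xs → sumᴸ f xs ≈ ∑ M (λ m → χ (m ∈ xs) * f m)
  unique-sumᴸ f {M} [] [] = sym (trans (∑-cong M (λ n → χ-no-* (λ ()))) (∑-0 M))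
  unique-sumᴸ f {M} {x ∷ xs} (x∉ ∷ uxs) ((x≢0 , x≤M) ∷ rs) = sym (begin-equality
    ∑ M (λ m → χ (m ∈ x ∷ xs) * f m)                                      ≈⟨ ∑-cong M (λ m → split m) ⟩
    ∑ M (λ m → χ (m ≡ x) * f m + χ (m ∈ xs) * f m)                        ≈⟨ ∑-+ M _ _ ⟩
    ∑ M (λ m → χ (m ≡ x) * f m) + ∑ M (λ m → χ (m ∈ xs) * f m)            ≈⟨ +-cong (∑-single {M} {x} f {{x≢0}} x≤M) (sym (unique-sumᴸ f uxs rs)) ⟩
    f x + sumᴸ f xs                                                       ∎)
    where
    open ≤-Reasoning
    split : ∀ m → χ (m ∈ x ∷ xs) * f m ≈ χ (m ≡ x) * f m + χ (m ∈ xs) * f m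
    split m = go (lem {m ≡ x})
      where
      go : Dec (m ≡ x) → χ (m ∈ x ∷ xs) * f m ≈ χ (m ≡ x) * f m + χ (m ∈ xs) * f m
      go (yes ≡.refl) = trans (χ-yes-* (here ≡.refl)) (sym (trans (+-cong (χ-yes-* ≡.refl) (χ-no-* (λ x∈xs → All.lookup x∉ x∈xs ≡.refl))) (+-identityʳ (f m))))
      go (no m≢x) = sym (trans (+-congʳ (χ-no-* m≢x)) (trans (+-identityˡ _) (*-congʳ (χ-cong there λ { (here eq) → contradiction eq m≢x ; (there m∈) → m∈ }))))

  unique-sumᴸ-≤ : ∀ f {M xs} → (∀ n .{{_ : ℕ.NonZero n}} → 0# ≤ f n) → Unique xs → All (InRange M) xs → sumᴸ f xs ≤ ∑ M f
  unique-sumᴸ-≤ f {M} {xs} 0≤f uxs rs = ≤-respˡ-≈ (sym (unique-sumᴸ f uxs rs))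
    (∑-mono M λ n → ≤-respʳ-≈ (*-identityˡ (f n)) (*-monoˡ-≤ (0≤f n) (χ≤1 (n ∈ xs))))

  ∣suc⇒/-suc : ∀ q N .{{_ : ℕ.NonZero q}} → q ∣ suc N → (suc N ℕ./ q ≡ suc (N ℕ./ q)) × (q ℕ.* suc (N ℕ./ q) ≡ suc N)
  ∣suc⇒/-suc q N (divides (suc c) eq) = ≡.trans sucN/q≡ (≡.cong suc (≡.sym N/q≡c)) , ≡.trans (≡.cong (λ t → q ℕ.* suc t) N/q≡c) (≡.trans (ℕₚ.*-comm q (suc c)) (≡.sym eq))
    where
    sucN/q≡ : suc N ℕ./ q ≡ suc c
    sucN/q≡ = ≡.trans (≡.cong (ℕ._/ q) eq) (m*n/n≡m (suc c) q)
    cq≤N : c ℕ.* q ℕ.≤ N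
    cq≤N = ℕₚ.≤-pred (ℕₚ.≤-trans (ℕₚ.+-monoˡ-≤ (c ℕ.* q) (ℕ.>-nonZero⁻¹ q)) (ℕₚ.≤-reflexive (≡.sym eq)))
    N/q≡c : N ℕ./ q ≡ c
    N/q≡c = ℕₚ.≤-antisym (ℕₚ.≤-pred (m<n*o⇒m/o<n {n = suc c} (ℕₚ.≤-reflexive eq))) (≡.subst (ℕ._≤ N ℕ./ q) (m*n/n≡m c q) (/-monoˡ-≤ q cq≤N))

  ∤suc⇒/-suc : ∀ q N .{{_ : ℕ.NonZero q}} → q ∤ suc N → suc N ℕ./ q ≡ N ℕ./ q
  ∤suc⇒/-suc q N q∤ = ℕₚ.≤-antisym (≡.subst (ℕ._≤ N ℕ./ q) (m*n/n≡m (suc N ℕ./ q) q) (/-monoˡ-≤ q cq≤N)) (/-monoˡ-≤ q (ℕₚ.n≤1+n N))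
    where
    cq≤N : suc N ℕ./ q ℕ.* q ℕ.≤ N
    cq≤N = ℕₚ.≤-pred (ℕₚ.≤∧≢⇒< (m/n*n≤m (suc N) q) (λ eq → q∤ (divides (suc N ℕ./ q) (≡.sym eq))))

  -- By induction on N: the quotient N / q grows by one exactly when q divides N + 1, and then q
  -- times the new quotient is N + 1.
  ∑-multiples : ∀ q N (f : ℕ → Carrier) .{{_ : ℕ.NonZero q}} → ∑ N (λ m → χ (q ∣ m) * f m) ≈ ∑ (N ℕ./ q) (λ e → f (q ℕ.* e))
  ∑-multiples q ℕ.zero f = reflexive (≡.cong (λ t → ∑ t (λ e → f (q ℕ.* e))) (≡.sym (0/n≡0 q)))
  ∑-multiples q (suc N) f = go lem
    where
    open ≤-Reasoning
    go : Dec (q ∣ suc N) → ∑ (suc N) (λ m → χ (q ∣ m) * f m) ≈ ∑ (suc N ℕ./ q) (λ e → f (q ℕ.* e))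
    go (yes q∣) = begin-equality
      ∑ N (λ m → χ (q ∣ m) * f m) + χ (q ∣ suc N) * f (suc N)            ≈⟨ +-cong (∑-multiples q N f) (χ-yes-* q∣) ⟩
      ∑ (N ℕ./ q) (λ e → f (q ℕ.* e)) + f (suc N)                        ≡⟨ ≡.cong (λ t → ∑ (N ℕ./ q) (λ e → f (q ℕ.* e)) + f t) (proj₂ (∣suc⇒/-suc q N q∣)) ⟨
      ∑ (suc (N ℕ./ q)) (λ e → f (q ℕ.* e))                              ≡⟨ ≡.cong (λ t → ∑ t (λ e → f (q ℕ.* e))) (proj₁ (∣suc⇒/-suc q N q∣)) ⟨
      ∑ (suc N ℕ./ q) (λ e → f (q ℕ.* e))                                ∎
    go (no q∤) = begin-equality
      ∑ N (λ m → χ (q ∣ m) * f m) + χ (q ∣ suc N) * f (suc N)            ≈⟨ +-cong (∑-multiples q N f) (χ-no-* q∤) ⟩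
      ∑ (N ℕ./ q) (λ e → f (q ℕ.* e)) + 0#                               ≈⟨ +-identityʳ _ ⟩
      ∑ (N ℕ./ q) (λ e → f (q ℕ.* e))                                    ≡⟨ ≡.cong (λ t → ∑ t (λ e → f (q ℕ.* e))) (∤suc⇒/-suc q N q∤) ⟨
      ∑ (suc N ℕ./ q) (λ e → f (q ℕ.* e))                                ∎

  -- The survivors of the sieve by the primes ≤ n. With t = s they lead to the s-th-power-free
  -- numbers, with t = 1 they are the numbers without prime factors ≤ n.
  Free : ℕ → ℕ → ℕ → Set
  Free t n m = ∀ p → Prime p → p ℕ.≤ n → p ℕ.^ t ∤ m

  Free-0 : ∀ t m → Free t 0 m
  Free-0 t m p pr ℕ.z≤n = contradiction pr ¬prime[0]

  Free-suc : ∀ {t n m} → Free t n m → (Prime (suc n) → suc n ℕ.^ t ∤ m) → Free t (suc n) m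
  Free-suc {t} {n} {m} free last p pr p≤ = [ (λ p<1+n → free p pr (ℕₚ.≤-pred p<1+n)) , (λ { ≡.refl → last pr }) ]′ (ℕₚ.m≤n⇒m<n∨m≡n p≤)

  Free-pred : ∀ {t n m} → Free t (suc n) m → Free t n m
  Free-pred free p pr p≤n = free p pr (ℕₚ.m≤n⇒m≤1+n p≤n)

  Free-cancel : ∀ {t n m} → Prime (suc n) → Free t n (suc n ℕ.^ t ℕ.* m) → Free t n m
  Free-cancel {t} {n} pq free p pr p≤n p^t∣m = free p pr p≤n (∣n⇒∣m*n (suc n ℕ.^ t) p^t∣m)

  Free-multiple : ∀ {t n m} → Prime (suc n) → Free t n m → Free t n (suc n ℕ.^ t ℕ.* m)
  Free-multiple {t} {n} pq free p pr p≤n p^t∣qm = free p pr p≤n (coprime-divisor (coprime-^ t t (primes-coprime pr pq (ℕₚ.<⇒≢ (ℕ.s≤s p≤n)))) p^t∣qm)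

  -- One recursion for two sieves: t = s with weight 1 counts, and t = 1 with weight n⁻ˢ treats
  -- ζ(s). Complete multiplicativity of f lets the contribution of the multiples of q factor out f
  -- q.
  module Weighted (t : ℕ) (f : ℕ → Carrier) (f-* : ∀ (m n : ℕ) .{{_ : ℕ.NonZero m}} .{{_ : ℕ.NonZero n}} → f (m ℕ.* n) ≈ f m * f n) where

    W : ℕ → ℕ → Carrier
    W n N = ∑ N (λ m → χ (Free t n m) * f m)

    W-0 : ∀ N → W 0 N ≈ ∑ N f
    W-0 N = ∑-cong N λ m → χ-yes-* (Free-0 t m)

    W-nonprime : ∀ n N → ¬ Prime (suc n) → W (suc n) N ≈ W n N
    W-nonprime n N ¬pr = ∑-cong N λ m → *-congʳ (χ-cong (Free-pred {t}) (λ free → Free-suc {t} free (λ pr → contradiction pr ¬pr)))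

    module _ (n N : ℕ) (pr : Prime (suc n)) where
      private
        q = suc n ℕ.^ t
        instance
          q-nonZero : ℕ.NonZero q
          q-nonZero = ℕₚ.m^n≢0 (suc n) t

        F : ℕ → Carrier
        F m = χ (Free t n m) * f m

        split : ∀ m → χ (Free t (suc n) m) * f m ≈ F m - χ (q ∣ m) * F m
        split m = go lem
          where
          go : Dec (q ∣ m) → χ (Free t (suc n) m) * f m ≈ F m - χ (q ∣ m) * F m
          go (yes q∣m) = trans (χ-no-* (λ free → free (suc n) pr ℕₚ.≤-refl q∣m)) (sym (trans (+-congˡ (-‿cong (χ-yes-* q∣m))) (-‿inverseʳ (F m))))
          go (no q∤m) = sym (trans (+-congˡ (trans (-‿cong (χ-no-* q∤m)) -0#≈0#)) (trans (+-identityʳ (F m)) (*-congʳ (χ-cong (λ free → Free-suc {t} free (λ _ → q∤m)) (Free-pred {t})))))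

        scale : ∀ e .{{_ : ℕ.NonZero e}} → F (q ℕ.* e) ≈ f q * F e
        scale e = trans (*-cong (χ-cong (Free-cancel {t} pr) (Free-multiple {t} pr)) (f-* q e)) (solve 3 (λ c x y → c :* (x :* y) := x :* (c :* y)) refl (χ (Free t n e)) (f q) (f e))

      -- Legendre's recursion. The new prime removes those earlier survivors that are multiples q e
      -- of q = (n+1)^t, and q e survives the smaller primes exactly when e does, because q is
      -- coprime to them.
      W-prime : W (suc n) N ≈ W n N - f q * W n (N ℕ./ q)
      W-prime = begin-equality
        ∑ N (λ m → χ (Free t (suc n) m) * f m)              ≈⟨ ∑-cong N (λ m → split m) ⟩
        ∑ N (λ m → F m - χ (q ∣ m) * F m)                   ≈⟨ ∑-- N F (λ m → χ (q ∣ m) * F m) ⟩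
        W n N - ∑ N (λ m → χ (q ∣ m) * F m)                 ≈⟨ +-congˡ (-‿cong (∑-multiples q N F)) ⟩
        W n N - ∑ (N ℕ./ q) (λ e → F (q ℕ.* e))             ≈⟨ +-congˡ (-‿cong (∑-cong (N ℕ./ q) (λ e → scale e))) ⟩
        W n N - ∑ (N ℕ./ q) (λ e → f q * F e)               ≈⟨ +-congˡ (-‿cong (∑-* (N ℕ./ q) (f q) F)) ⟩
        W n N - f q * W n (N ℕ./ q)                         ∎
        where open ≤-Reasoning

  double≤ : ∀ {ε} → 0# < ε → ∃[ δ ] (0# < δ × δ + δ ≤ ε)
  double≤ {ε} 0<ε with small {ε} {1# + 1#} {1#} 0<ε (≤-trans 0≤1 (x≤x+y 0≤1)) 0<1
  ... | δ , 0<δ , _ , le = δ , 0<δ , ≤-respˡ-≈ (solve 1 (λ d → d :* (con (+ 1) :+ con (+ 1)) := d :+ d) refl δ) le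

  ≤-approx : ∀ {x y} → (∀ ε → 0# < ε → x ≤ y + ε) → x ≤ y
  ≤-approx {x} {y} approx = [ id , (λ y<x → contradiction (double≤ (x<y⇒0<y-x y<x)) impossible) ]′ (≤-or-> x y)
    where
    impossible : ¬ (∃[ δ ] (0# < δ × δ + δ ≤ x - y))
    impossible (δ , 0<δ , 2δ≤) = <⇒≱ (x<x+y {δ} 0<δ) (≤-trans 2δ≤ (begin
      x - y         ≤⟨ +-monoˡ-≤ (- y) (approx δ 0<δ) ⟩
      (y + δ) - y   ≈⟨ solve 2 (λ y d → (y :+ d) :- y := d) refl y δ ⟩
      δ             ∎))
      where open ≤-Reasoning

  iroot : ∀ k N → ∃[ D ] (D ℕ.^ suc k ℕ.≤ N × N ℕ.< suc D ℕ.^ suc k)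
  iroot k ℕ.zero = 0 , ℕ.z≤n , ℕₚ.m^n>0 1 (suc k)
  iroot k (suc N) with iroot k N
  ... | D , D^≤N , N< with suc D ℕ.^ suc k ℕ.≤? suc N
  ...   | yes le = suc D , le , ℕₚ.≤-<-trans N< (ℕₚ.^-monoˡ-< (suc k) (ℕₚ.n<1+n (suc D)))
  ...   | no ≰ = D , ℕₚ.m≤n⇒m≤1+n D^≤N , ℕₚ.≰⇒> ≰

  module Sieve (k : ℕ) where
    open Zeta k

    w-* : ∀ m n .{{_ : ℕ.NonZero m}} .{{_ : ℕ.NonZero n}} → w (m ℕ.* n) ≈ w m * w n
    w-* m n = trans (^-congˡ s (1/ⁿ-* m n)) (^-distrib-* (1/ⁿ m) (1/ⁿ n) s)

    n^s*w : ∀ n .{{_ : ℕ.NonZero n}} → fromNat (n ℕ.^ s) * w n ≈ 1#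
    n^s*w n = trans (*-congʳ (fromNat-^ n s)) (trans (sym (^-distrib-* (fromNat n) (1/ⁿ n) s)) (trans (^-congˡ s (n*1/ⁿ n)) (1^n≈1 s)))

    -- ∏_{p ≤ n} (1 − p⁻ˢ)
    P : ℕ → Carrier
    P ℕ.zero  = 1#
    P (suc n) with prime? (suc n)
    ... | yes _ = P n * (1# - w (suc n))
    ... | no  _ = P n

    module Counting = Weighted s (λ _ → 1#) (λ _ _ → sym (*-identityˡ 1#))
    module Weights = Weighted 1 w w-*
    open Counting using () renaming (W to Φ)
    open Weights using () renaming (W to V)

    _÷_^s : ℕ → (e : ℕ) .{{_ : ℕ.NonZero e}} → ℕ
    N ÷ e ^s = ℕ._/_ N (e ℕ.^ s) {{ℕₚ.m^n≢0 e s}}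

    -- The error of approximating the number of multiples of eˢ up to N by N e⁻ˢ.
    β : ℕ → ℕ → Carrier
    β N ℕ.zero    = 0#
    β N e@(suc _) = ∣ fromNat (N ÷ e ^s) - fromNat N * w e ∣

    β-def : ∀ N e .{{_ : ℕ.NonZero e}} → β N e ≡ ∣ fromNat (N ÷ e ^s) - fromNat N * w e ∣
    β-def N (suc _) = ≡.refl

    squarefreeSmooth : ℕ → List ℕ
    squarefreeSmooth ℕ.zero  = 1 ∷ []
    squarefreeSmooth (suc n) with prime? (suc n)
    ... | yes _ = squarefreeSmooth n ++ map (suc n ℕ.*_) (squarefreeSmooth n)
    ... | no  _ = squarefreeSmooth n

    NoLargePrimeFactor : ℕ → ℕ → Set
    NoLargePrimeFactor n d = ℕ.NonZero d × (∀ q → Prime q → n ℕ.< q → q ∤ d)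

    NoLargePrimeFactor-suc : ∀ {n d} → NoLargePrimeFactor n d → NoLargePrimeFactor (suc n) d
    NoLargePrimeFactor-suc {n} (d≢0 , f) = d≢0 , λ q pq n<q → f q pq (ℕₚ.<-trans (ℕₚ.n<1+n n) n<q)

    squarefreeSmooth-smooth : ∀ n → All (NoLargePrimeFactor n) (squarefreeSmooth n)
    squarefreeSmooth-smooth ℕ.zero = (_ , λ q pq _ q∣1 → ℕₚ.<⇒≢ (prime>1 pq) (≡.sym (∣1⇒≡1 q∣1))) ∷ []
    squarefreeSmooth-smooth (suc n) with prime? (suc n)
    ... | no  _ = All.map NoLargePrimeFactor-suc (squarefreeSmooth-smooth n)
    ... | yes pr = All.++⁺ (All.map NoLargePrimeFactor-suc (squarefreeSmooth-smooth n)) (All.map⁺ (All.map multiply (squarefreeSmooth-smooth n)))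
      where
      multiply : ∀ {d} → NoLargePrimeFactor n d → NoLargePrimeFactor (suc n) (suc n ℕ.* d)
      multiply {d} (d≢0 , f) = ℕₚ.m*n≢0 (suc n) d {{_}} {{d≢0}} , λ q pq n<q q∣ →
        [ (λ q∣n → ℕₚ.<⇒≱ n<q (∣⇒≤ q∣n)) , f q pq (ℕₚ.<-trans (ℕₚ.n<1+n n) n<q) ]′ (euclidsLemma (suc n) d pq q∣)

    -- A new prime p divides none of the numbers listed so far, whose prime factors are all smaller.
    -- So the numbers p d are disjoint from the old ones.
    squarefreeSmooth-unique : ∀ n → Unique (squarefreeSmooth n)
    squarefreeSmooth-unique ℕ.zero = [] ∷ []
    squarefreeSmooth-unique (suc n) with prime? (suc n)
    ... | no  _ = squarefreeSmooth-unique n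
    ... | yes pr = Unique.++⁺ (squarefreeSmooth-unique n) (Unique.map⁺ (ℕₚ.*-cancelˡ-≡ _ _ (suc n)) (squarefreeSmooth-unique n)) disjoint
      where
      disjoint : ∀ {d} → ¬ (d ∈ squarefreeSmooth n × d ∈ map (suc n ℕ.*_) (squarefreeSmooth n))
      disjoint (d∈ , d∈map) with ∈-map⁻ (suc n ℕ.*_) d∈map
      ... | c , _ , ≡.refl = proj₂ (All.lookup (squarefreeSmooth-smooth n) d∈) (suc n) pr (ℕₚ.n<1+n n) (m∣m*n c)

    ÷^s-÷^s : ∀ N e p .{{_ : ℕ.NonZero e}} .{{_ : ℕ.NonZero p}} →
      ℕ._/_ (N ÷ e ^s) (p ℕ.^ s) {{ℕₚ.m^n≢0 p s}} ≡ (N ÷ e ℕ.* p ^s) {{ℕₚ.m*n≢0 e p}}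
    ÷^s-÷^s N e p = ≡.trans (m/n/o≡m/[n*o] N (e ℕ.^ s) (p ℕ.^ s) {{e^s}} {{p^s}} {{e^s*p^s}})
                            (/-congʳ {m = N} {{e^s*p^s}} {{ℕₚ.m^n≢0 (e ℕ.* p) s {{ℕₚ.m*n≢0 e p}}}} (≡.sym (^-distribʳ-* s e p)))
      where
      e^s = ℕₚ.m^n≢0 e s
      p^s = ℕₚ.m^n≢0 p s
      e^s*p^s = ℕₚ.m*n≢0 (e ℕ.^ s) (p ℕ.^ s) {{e^s}} {{p^s}}

    -- The error after sieving by the primes ≤ n; each prime p turns the error
    -- at e into the difference of the errors at e and e p.
    E : ℕ → ℕ → (e : ℕ) .{{_ : ℕ.NonZero e}} → Carrier
    E N n e = Φ n (N ÷ e ^s) - fromNat N * w e * P n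

    -- Fully expanded, the error is the sum of μ(d) (⌊N/(ed)ˢ⌋ - N/(ed)ˢ) over the squarefree
    -- n-smooth d. The triangle inequality at each prime discards the signs, so μ never has to be
    -- defined.
    sieve-error : ∀ N n e .{{_ : ℕ.NonZero e}} → ∣ E N n e ∣ ≤ sumᴸ (λ d → β N (e ℕ.* d)) (squarefreeSmooth n)
    sieve-error N ℕ.zero e = ≤-reflexive (begin-equality
      ∣ Φ 0 (N ÷ e ^s) - fromNat N * w e * 1# ∣     ≈⟨ ∣∣-cong (+-cong (trans (Counting.W-0 (N ÷ e ^s)) (∑-1 (N ÷ e ^s))) (-‿cong (*-identityʳ _))) ⟩
      ∣ fromNat (N ÷ e ^s) - fromNat N * w e ∣      ≡⟨ β-def N e ⟨
      β N e                                         ≡⟨ ≡.cong (β N) (ℕₚ.*-identityʳ e) ⟨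
      β N (e ℕ.* 1)                                 ≈⟨ +-identityʳ _ ⟨
      β N (e ℕ.* 1) + 0#                            ∎)
      where open ≤-Reasoning
    sieve-error N (suc n) e with prime? (suc n)
    ... | no ¬pr = ≤-respˡ-≈ (∣∣-cong (+-congʳ (sym (Counting.W-nonprime n (N ÷ e ^s) ¬pr)))) (sieve-error N n e)
    ... | yes pr = begin
      ∣ Φ (suc n) M - fromNat N * w e * (P n * (1# - w p)) ∣   ≈⟨ ∣∣-cong difference ⟩
      ∣ E N n e - E N n (e ℕ.* p) ∣                            ≤⟨ ∣x-y∣≤∣x∣+∣y∣ _ _ ⟩
      ∣ E N n e ∣ + ∣ E N n (e ℕ.* p) ∣                        ≤⟨ +-mono-≤ (sieve-error N n e) (sieve-error N n (e ℕ.* p)) ⟩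
      sumᴸ (λ d → β N (e ℕ.* d)) L + sumᴸ (λ d → β N (e ℕ.* p ℕ.* d)) L
                                                               ≈⟨ +-congˡ (sumᴸ-cong L (λ d → ≡.cong (β N) (ℕₚ.*-assoc e p d))) ⟩
      sumᴸ (λ d → β N (e ℕ.* d)) L + sumᴸ (λ d → β N (e ℕ.* (p ℕ.* d))) L
                                                               ≈⟨ +-congˡ (sumᴸ-map (λ d → β N (e ℕ.* d)) (p ℕ.*_) L) ⟨
      sumᴸ (λ d → β N (e ℕ.* d)) L + sumᴸ (λ d → β N (e ℕ.* d)) (map (p ℕ.*_) L)
                                                               ≈⟨ sumᴸ-++ (λ d → β N (e ℕ.* d)) L (map (p ℕ.*_) L) ⟨
      sumᴸ (λ d → β N (e ℕ.* d)) (L ++ map (p ℕ.*_) L)         ∎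
      where
      open ≤-Reasoning
      p = suc n
      M = N ÷ e ^s
      L = squarefreeSmooth n
      instance
        ep-nonZero : ℕ.NonZero (e ℕ.* p)
        ep-nonZero = ℕₚ.m*n≢0 e p
      difference : Φ (suc n) M - fromNat N * w e * (P n * (1# - w p)) ≈ E N n e - E N n (e ℕ.* p)
      difference = begin-equality
        Φ (suc n) M - fromNat N * w e * (P n * (1# - w p))
          ≈⟨ +-congʳ (Counting.W-prime n M pr) ⟩
        (Φ n M - 1# * Φ n (ℕ._/_ M (p ℕ.^ s) {{ℕₚ.m^n≢0 p s}})) - fromNat N * w e * (P n * (1# - w p))
          ≡⟨ ≡.cong (λ t → (Φ n M - 1# * Φ n t) - fromNat N * w e * (P n * (1# - w p))) (÷^s-÷^s N e p) ⟩
        (Φ n M - 1# * Φ n (N ÷ e ℕ.* p ^s)) - fromNat N * w e * (P n * (1# - w p))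
          ≈⟨ solve 6 (λ a b N e p P → (a :- con (+ 1) :* b) :- N :* e :* (P :* (con (+ 1) :- p)) := (a :- N :* e :* P) :- (b :- N :* (e :* p) :* P)) refl (Φ n M) (Φ n (N ÷ e ℕ.* p ^s)) (fromNat N) (w e) (w p) (P n) ⟩
        (Φ n M - fromNat N * w e * P n) - (Φ n (N ÷ e ℕ.* p ^s) - fromNat N * (w e * w p) * P n)
          ≈⟨ +-congˡ (-‿cong (+-congˡ (-‿cong (*-congʳ (*-congˡ (w-* e p)))))) ⟨
        E N n e - E N n (e ℕ.* p) ∎

  -- Error estimate for the number of s-th-power-free integers

  module Estimate (k : ℕ) where
    open Zeta k
    open Sieve k
    open Counting using () renaming (W to Φ)
    open Weights using () renaming (W to V)

    module _ (N e : ℕ) .{{_ : ℕ.NonZero e}} where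
      private
        instance
          q-nonZero : ℕ.NonZero (e ℕ.^ s)
          q-nonZero = ℕₚ.m^n≢0 e s
        q = e ℕ.^ s
        M = N ÷ e ^s

        multiple : ∀ m → fromNat (m ℕ.* q) * w e ≈ fromNat m
        multiple m = trans (*-congʳ (fromNat-* m q)) (trans (*-assoc _ _ _) (trans (*-congˡ (n^s*w e)) (*-identityʳ _)))

        M≤Nw : fromNat M ≤ fromNat N * w e
        M≤Nw = ≤-respˡ-≈ (multiple M) (*-monoˡ-≤ (<⇒≤ (w-pos e)) (fromNat-mono (m/n*n≤m N q)))

        N≤[1+M]q : N ℕ.≤ suc M ℕ.* q
        N≤[1+M]q = ≡.subst (ℕ._≤ suc M ℕ.* q) (≡.sym (m≡m%n+[m/n]*n N q)) (ℕₚ.+-monoˡ-≤ (M ℕ.* q) (ℕₚ.<⇒≤ (m%n<n N q)))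

        Nw≤1+M : fromNat N * w e ≤ 1# + fromNat M
        Nw≤1+M = ≤-respʳ-≈ (multiple (suc M)) (*-monoˡ-≤ (<⇒≤ (w-pos e)) (fromNat-mono N≤[1+M]q))

      0≤β : 0# ≤ β N e
      0≤β = ≤-respʳ-≈ (reflexive (≡.sym (β-def N e))) (0≤∣x∣ _)

      β≤1 : β N e ≤ 1#
      β≤1 = ≤-respˡ-≈ (reflexive (≡.sym (β-def N e))) (∣x∣≤
        (≤-trans (+-monoˡ-≤ _ M≤Nw) (≤-respˡ-≈ (sym (-‿inverseʳ _)) 0≤1))
        (begin
          - (fromNat M - fromNat N * w e)   ≈⟨ solve 2 (λ c x → :- (c :- x) := x :- c) refl (fromNat M) (fromNat N * w e) ⟩
          fromNat N * w e - fromNat M       ≤⟨ +-monoˡ-≤ (- fromNat M) Nw≤1+M ⟩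
          (1# + fromNat M) - fromNat M      ≈⟨ solve 1 (λ c → (con (+ 1) :+ c) :- c := con (+ 1)) refl (fromNat M) ⟩
          1#                                ∎))
        where open ≤-Reasoning

      β≤N*w : N ℕ.< e ℕ.^ s → β N e ≤ fromNat N * w e
      β≤N*w N<q = ≤-reflexive (begin-equality
        β N e                                        ≡⟨ β-def N e ⟩
        ∣ fromNat M - fromNat N * w e ∣              ≡⟨ ≡.cong (λ t → ∣ fromNat t - fromNat N * w e ∣) (m<n⇒m/n≡0 N<q) ⟩
        ∣ 0# - fromNat N * w e ∣                     ≈⟨ ∣∣-cong (+-identityˡ _) ⟩
        ∣ - (fromNat N * w e) ∣                      ≈⟨ antisym (∣-x∣≤∣x∣ _) (≤-respˡ-≈ (∣∣-cong (-‿involutive _)) (∣-x∣≤∣x∣ _)) ⟩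
        ∣ fromNat N * w e ∣                          ≈⟨ 0≤x⇒∣x∣≈x (*-nonNeg (fromNat-nonNeg N) (<⇒≤ (w-pos e))) ⟩
        fromNat N * w e                              ∎)
        where
        open ≤-Reasoning

    -- For e > D the hypothesis N < (D+1)ˢ makes the floor of N/eˢ vanish, so the error there is N
    -- e⁻ˢ; each of the D smaller values of e costs at most 1.
    ∑β-bound : ∀ {N D M} → N ℕ.< suc D ℕ.^ s → D ℕ.≤ M → ∑ M (β N) ≤ fromNat D + fromNat N * (Z M - Z D)
    ∑β-bound {N} {D} {M} N< D≤M = [ step M , (λ { ≡.refl → base }) ]′ (ℕₚ.m≤n⇒m<n∨m≡n D≤M)
      where
      open ≤-Reasoning
      base : ∑ D (β N) ≤ fromNat D + fromNat N * (Z D - Z D)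
      base = begin
        ∑ D (β N)                             ≤⟨ ∑-mono D (λ n → β≤1 N n) ⟩
        ∑ D (λ _ → 1#)                        ≈⟨ ∑-1 D ⟩
        fromNat D                             ≈⟨ solve 3 (λ d n z → d := d :+ n :* (z :- z)) refl (fromNat D) (fromNat N) (Z D) ⟩
        fromNat D + fromNat N * (Z D - Z D)   ∎
      step : ∀ M → D ℕ.< M → ∑ M (β N) ≤ fromNat D + fromNat N * (Z M - Z D)
      step (suc M) D<1+M = begin
        ∑ M (β N) + β N (suc M)                                       ≤⟨ +-mono-≤ (∑β-bound N< D≤M′) (β≤N*w N (suc M) (ℕₚ.<-≤-trans N< (ℕₚ.^-monoˡ-≤ s D<1+M))) ⟩
        fromNat D + fromNat N * (Z M - Z D) + fromNat N * w (suc M)   ≈⟨ solve 5 (λ d n z y w → d :+ n :* (z :- y) :+ n :* w := d :+ n :* ((z :+ w) :- y)) refl (fromNat D) (fromNat N) (Z M) (Z D) (w (suc M)) ⟩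
        fromNat D + fromNat N * (Z (suc M) - Z D)                     ∎
        where
        D≤M′ : D ℕ.≤ M
        D≤M′ = ℕₚ.≤-pred D<1+M

    -- The squarefree D-smooth numbers reach far beyond D. Any M above all of them will do, because
    -- the estimate depends on M only through Z M - Z D ≤ tail D.
    ∃-range : ∀ D {n} xs → All (NoLargePrimeFactor n) xs → ∃[ M ] (D ℕ.≤ M × All (InRange M) xs)
    ∃-range D []       []                = D , ℕₚ.≤-refl , []
    ∃-range D (x ∷ xs) ((x≢0 , _) ∷ ps) with ∃-range D xs ps
    ... | M , D≤M , rs = x ℕ.⊔ M , ℕₚ.≤-trans D≤M (ℕₚ.m≤n⊔m x M) , (x≢0 , ℕₚ.m≤m⊔n x M) ∷ All.map (λ (y≢0 , y≤M) → y≢0 , ℕₚ.≤-trans y≤M (ℕₚ.m≤n⊔m x M)) rs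

    Φ-estimate : ∀ {N D} .{{_ : ℕ.NonZero D}} → N ℕ.< suc D ℕ.^ s → ∣ Φ D N - fromNat N * P D ∣ ≤ fromNat D + fromNat N * tail D
    Φ-estimate {N} {D} N< = bound (∃-range D (squarefreeSmooth D) (squarefreeSmooth-smooth D))
      where
      open ≤-Reasoning
      N÷1≡N : N ÷ 1 ^s ≡ N
      N÷1≡N = ≡.trans (/-congʳ {m = N} {{ℕₚ.m^n≢0 1 s}} (ℕₚ.^-zeroˡ s)) (n/1≡n N)
      w1≈1 : w 1 ≈ 1#
      w1≈1 = trans (^-congˡ s 1/ⁿ-1) (1^n≈1 s)
      bound : ∃[ M ] (D ℕ.≤ M × All (InRange M) (squarefreeSmooth D)) → ∣ Φ D N - fromNat N * P D ∣ ≤ fromNat D + fromNat N * tail D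
      bound (M , D≤M , rs) = begin
        ∣ Φ D N - fromNat N * P D ∣                          ≈⟨ ∣∣-cong (+-cong (reflexive (≡.cong (Φ D) (≡.sym N÷1≡N))) (-‿cong (*-congʳ (sym (trans (*-congˡ w1≈1) (*-identityʳ _)))))) ⟩
        ∣ E N D 1 ∣                                          ≤⟨ sieve-error N D 1 ⟩
        sumᴸ (λ d → β N (1 ℕ.* d)) (squarefreeSmooth D)      ≈⟨ sumᴸ-cong (squarefreeSmooth D) (λ d → ≡.cong (β N) (ℕₚ.*-identityˡ d)) ⟩
        sumᴸ (β N) (squarefreeSmooth D)                      ≤⟨ unique-sumᴸ-≤ (β N) (λ n → 0≤β N n) (squarefreeSmooth-unique D) rs ⟩
        ∑ M (β N)                                            ≤⟨ ∑β-bound {N} {D} {M} N< D≤M ⟩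
        fromNat D + fromNat N * (Z M - Z D)                  ≤⟨ +-monoʳ-≤ (fromNat D) (*-monoʳ-≤ (fromNat-nonNeg N) ZM-ZD≤tail) ⟩
        fromNat D + fromNat N * tail D                       ∎
        where
        ZM-ZD≤tail : Z M - Z D ≤ tail D
        ZM-ZD≤tail = ≤-trans (+-monoˡ-≤ (- Z D) (Z-bound M)) (≤-reflexive (solve 2 (λ z t → (z :+ t) :- z := t) refl (Z D) (tail D)))

    -- ζ(s) P n is the sum of m⁻ˢ over the m without prime factors ≤ n.
    V→P*ζ : ∀ n ε → 0# < ε → ∃[ M₀ ] (∀ M → M₀ ℕ.≤ M → ∣ V n M - P n * ζ s ∣ ≤ ε)
    V→P*ζ ℕ.zero ε 0<ε = bound (1/ⁿ-small 0<ε)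
      where
      open ≤-Reasoning
      bound : ∃[ n₀ ] (ℕ.NonZero n₀ × (∀ n .{{_ : ℕ.NonZero n}} → n₀ ℕ.≤ n → 1/ⁿ n ≤ ε)) → ∃[ M₀ ] (∀ M → M₀ ℕ.≤ M → ∣ V 0 M - 1# * ζ s ∣ ≤ ε)
      bound (M₀ , M₀≢0 , 1/M≤ε) = M₀ , close
        where
        close : ∀ M → M₀ ℕ.≤ M → ∣ V 0 M - 1# * ζ s ∣ ≤ ε
        close ℕ.zero M₀≤0 = contradiction (ℕₚ.n≤0⇒n≡0 M₀≤0) (ℕ.≢-nonZero⁻¹ M₀ {{M₀≢0}})
        close M@(suc _) M₀≤M = begin
          ∣ V 0 M - 1# * ζ s ∣     ≈⟨ ∣∣-cong (+-cong (Weights.W-0 M) (-‿cong (*-identityˡ (ζ s)))) ⟩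
          ∣ Z M - ζ s ∣            ≤⟨ ∣x∣≤ (≤-trans (+-monoˡ-≤ (- ζ s) (Z≤ζ M)) (≤-respˡ-≈ (sym (-‿inverseʳ (ζ s))) (tail-nonNeg M))) (begin
                - (Z M - ζ s)           ≈⟨ solve 2 (λ z l → :- (z :- l) := l :- z) refl (Z M) (ζ s) ⟩
                ζ s - Z M               ≤⟨ +-monoˡ-≤ (- Z M) (ζ≤Z+tail M) ⟩
                (Z M + tail M) - Z M    ≈⟨ solve 2 (λ z t → (z :+ t) :- z := t) refl (Z M) (tail M) ⟩
                tail M                  ∎) ⟩
          tail M                   ≤⟨ *-monoʳ-≤ (<⇒≤ (1/ⁿ-pos M)) (≤-respʳ-≈ (1^n≈1 k) (^-monoˡ-≤ k (<⇒≤ (1/ⁿ-pos M)) (1/ⁿ≤1 M))) ⟩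
          1/ⁿ M * 1#               ≈⟨ *-identityʳ _ ⟩
          1/ⁿ M                    ≤⟨ 1/M≤ε M M₀≤M ⟩
          ε                        ∎
    V→P*ζ (suc n) ε 0<ε with prime? (suc n)
    ... | no ¬pr = proj₁ ih , λ M M₀≤M → ≤-respˡ-≈ (∣∣-cong (+-congʳ (sym (Weights.W-nonprime n M ¬pr)))) (proj₂ ih M M₀≤M)
      where ih = V→P*ζ n ε 0<ε
    ... | yes pr = combine (double≤ 0<ε)
      where
      open ≤-Reasoning
      p q : ℕ
      p = suc n
      q = p ℕ.^ 1
      wq≤1 : w q ≤ 1#
      wq≤1 = ≤-respʳ-≈ (1^n≈1 s) (^-monoˡ-≤ s (<⇒≤ (1/ⁿ-pos q)) (1/ⁿ≤1 q))
      combine : ∃[ δ ] (0# < δ × δ + δ ≤ ε) → ∃[ M₀ ] (∀ M → M₀ ℕ.≤ M → ∣ V p M - P n * (1# - w p) * ζ s ∣ ≤ ε)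
      combine (δ , 0<δ , 2δ≤ε) = from-ih (V→P*ζ n δ 0<δ)
        where
        from-ih : ∃[ M₀ ] (∀ M → M₀ ℕ.≤ M → ∣ V n M - P n * ζ s ∣ ≤ δ) → ∃[ M₀ ] (∀ M → M₀ ℕ.≤ M → ∣ V p M - P n * (1# - w p) * ζ s ∣ ≤ ε)
        -- From M ≥ M₀ q both M and M / q are at least M₀, so the induction hypothesis applies to
        -- both terms of the recursion, with half of ε each.
        from-ih (M₀ , close) = M₀ ℕ.* q , λ M M₀q≤M → begin
          ∣ V p M - P n * (1# - w p) * ζ s ∣
            ≈⟨ ∣∣-cong (+-cong (Weights.W-prime n M pr) (-‿cong (*-congʳ (*-congˡ (+-congˡ (-‿cong (reflexive (≡.cong w (≡.sym (ℕₚ.*-identityʳ p)))))))))) ⟩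
          ∣ (V n M - w q * V n (M ℕ./ q)) - P n * (1# - w q) * ζ s ∣
            ≈⟨ ∣∣-cong (solve 5 (λ a b w P z → (a :- w :* b) :- P :* (con (+ 1) :- w) :* z := (a :- P :* z) :- w :* (b :- P :* z)) refl (V n M) (V n (M ℕ./ q)) (w q) (P n) (ζ s)) ⟩
          ∣ (V n M - P n * ζ s) - w q * (V n (M ℕ./ q) - P n * ζ s) ∣
            ≤⟨ ∣x-y∣≤∣x∣+∣y∣ _ _ ⟩
          ∣ V n M - P n * ζ s ∣ + ∣ w q * (V n (M ℕ./ q) - P n * ζ s) ∣
            ≤⟨ +-mono-≤ (close M (ℕₚ.≤-trans (ℕₚ.m≤m*n M₀ q) M₀q≤M)) (begin
               ∣ w q * (V n (M ℕ./ q) - P n * ζ s) ∣     ≤⟨ ∣x*y∣≤x*∣y∣ _ (<⇒≤ (w-pos q)) ⟩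
               w q * ∣ V n (M ℕ./ q) - P n * ζ s ∣       ≤⟨ *-monoˡ-≤ (0≤∣x∣ _) wq≤1 ⟩
               1# * ∣ V n (M ℕ./ q) - P n * ζ s ∣        ≈⟨ *-identityˡ _ ⟩
               ∣ V n (M ℕ./ q) - P n * ζ s ∣             ≤⟨ close (M ℕ./ q) (≡.subst (ℕ._≤ M ℕ./ q) (m*n/n≡m M₀ q) (/-monoˡ-≤ q M₀q≤M)) ⟩
               δ                                         ∎) ⟩
          δ + δ  ≤⟨ 2δ≤ε ⟩
          ε      ∎

    module _ (D : ℕ) .{{_ : ℕ.NonZero D}} where

      -- Up to D only m = 1 survives: every larger m has a prime factor, which is at most m ≤ D.
      V≈1 : ∀ {M} → suc M ℕ.≤ D → V D (suc M) ≈ 1#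
      V≈1 {ℕ.zero}  _   = trans (+-identityˡ _) (trans (χ-yes-* (λ p pr _ p∣1 → ℕₚ.<⇒≢ (prime>1 pr) (≡.sym (∣1⇒≡1 (∣-trans (m∣m*n 1) p∣1))))) (trans (^-congˡ s 1/ⁿ-1) (1^n≈1 s)))
      V≈1 {suc M} 2+M≤D = trans (+-cong (V≈1 (ℕₚ.<⇒≤ 2+M≤D)) (χ-no-* not-free)) (+-identityʳ 1#)
        where
        not-free : ¬ Free 1 D (suc (suc M))
        not-free free with ∃-prime-divisor (suc (suc M)) (ℕ.s≤s (ℕ.s≤s ℕ.z≤n))
        ... | p , pr , p∣ = free p pr (ℕₚ.≤-trans (∣⇒≤ p∣) 2+M≤D) (≡.subst (_∣ suc (suc M)) (≡.sym (ℕₚ.*-identityʳ p)) p∣)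

      -- Each m beyond D adds a term between 0 and m⁻ˢ to the value 1 reached at D.
      V-bounds : ∀ M → D ℕ.≤ M → 1# ≤ V D M × V D M ≤ 1# + (Z M - Z D)
      V-bounds M D≤M = [ step M , (λ { ≡.refl → base }) ]′ (ℕₚ.m≤n⇒m<n∨m≡n D≤M)
        where
        VD≈1 : V D D ≈ 1#
        VD≈1 = ≡.subst (λ t → V D t ≈ 1#) (ℕₚ.suc-pred D) (V≈1 {ℕ.pred D} (ℕₚ.≤-reflexive (ℕₚ.suc-pred D)))
        base : 1# ≤ V D D × V D D ≤ 1# + (Z D - Z D)
        base = ≤-reflexive (sym VD≈1) , ≤-reflexive (trans VD≈1 (solve 1 (λ z → con (+ 1) := con (+ 1) :+ (z :- z)) refl (Z D)))
        step : ∀ M → D ℕ.< M → 1# ≤ V D M × V D M ≤ 1# + (Z M - Z D)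
        step (suc M) D<1+M = ≤-trans (proj₁ ih) (x≤x+y (*-nonNeg (0≤χ _) (<⇒≤ (w-pos (suc M))))) , (begin
          V D M + χ (Free 1 D (suc M)) * w (suc M)    ≤⟨ +-mono-≤ (proj₂ ih) (*-monoˡ-≤ (<⇒≤ (w-pos (suc M))) (χ≤1 _)) ⟩
          1# + (Z M - Z D) + 1# * w (suc M)           ≈⟨ solve 3 (λ z y w → con (+ 1) :+ (z :- y) :+ con (+ 1) :* w := con (+ 1) :+ ((z :+ w) :- y)) refl (Z M) (Z D) (w (suc M)) ⟩
          1# + (Z (suc M) - Z D)                      ∎)
          where
          open ≤-Reasoning
          ih = V-bounds M (ℕₚ.≤-pred D<1+M)

      -- V D M stays within tail D of 1 for all M ≥ D, and it comes arbitrarily close to P D · ζ(s)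
      -- as M grows.
      P*ζ≈1 : ∣ P D * ζ s - 1# ∣ ≤ tail D
      P*ζ≈1 = ≤-approx λ ε 0<ε → close ε (V→P*ζ D ε 0<ε)
        where
        open ≤-Reasoning
        close : ∀ ε → ∃[ M₀ ] (∀ M → M₀ ℕ.≤ M → ∣ V D M - P D * ζ s ∣ ≤ ε) → ∣ P D * ζ s - 1# ∣ ≤ tail D + ε
        close ε (M₀ , near) = begin
          ∣ P D * ζ s - 1# ∣                            ≈⟨ ∣∣-cong (solve 3 (λ x v o → x :- o := (v :- o) :- (v :- x)) refl (P D * ζ s) (V D M) 1#) ⟩
          ∣ (V D M - 1#) - (V D M - P D * ζ s) ∣        ≤⟨ ∣x-y∣≤∣x∣+∣y∣ _ _ ⟩
          ∣ V D M - 1# ∣ + ∣ V D M - P D * ζ s ∣        ≤⟨ +-mono-≤ (∣x∣≤ upper lower) (near M (ℕₚ.m≤m⊔n M₀ D)) ⟩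
          tail D + ε                                    ∎
          where
          M = M₀ ℕ.⊔ D
          bounds = V-bounds M (ℕₚ.m≤n⊔m M₀ D)
          upper : V D M - 1# ≤ tail D
          upper = begin
            V D M - 1#                   ≤⟨ +-monoˡ-≤ (- 1#) (proj₂ bounds) ⟩
            1# + (Z M - Z D) - 1#        ≤⟨ +-monoˡ-≤ (- 1#) (+-monoʳ-≤ 1# (+-monoˡ-≤ (- Z D) (Z-bound M))) ⟩
            1# + (Z D + tail D - Z D) - 1# ≈⟨ solve 2 (λ z t → con (+ 1) :+ (z :+ t :- z) :- con (+ 1) := t) refl (Z D) (tail D) ⟩
            tail D                       ∎
          lower : - (V D M - 1#) ≤ tail D
          lower = ≤-trans (neg-mono-≤ (x≤y⇒0≤y-x (proj₁ bounds))) (≤-respˡ-≈ (sym -0#≈0#) (tail-nonNeg D))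

      -- N < (D+1)ˢ ≤ (2D)ˢ, and Dˢ · D^(1-s) = D.
      N*tail≤ : ∀ {N} → N ℕ.< suc D ℕ.^ s → fromNat N * tail D ≤ fromNat (2 ℕ.^ s) * fromNat D
      N*tail≤ {N} N< = begin
        fromNat N * tail D                                          ≤⟨ *-monoˡ-≤ (tail-nonNeg D) (fromNat-mono N≤) ⟩
        fromNat (2 ℕ.^ s ℕ.* D ℕ.^ s) * tail D                      ≈⟨ *-congʳ (fromNat-* (2 ℕ.^ s) (D ℕ.^ s)) ⟩
        fromNat (2 ℕ.^ s) * fromNat (D ℕ.^ s) * tail D              ≈⟨ *-congʳ (*-congˡ (fromNat-^ D s)) ⟩
        fromNat (2 ℕ.^ s) * (fromNat D * fromNat D ^ suc k) * tail D ≈⟨ solve 4 (λ a d x t → a :* (d :* x) :* t := a :* (d :* (x :* t))) refl (fromNat (2 ℕ.^ s)) (fromNat D) (fromNat D ^ suc k) (tail D) ⟩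
        fromNat (2 ℕ.^ s) * (fromNat D * (fromNat D ^ suc k * tail D)) ≈⟨ *-congˡ (*-congˡ (trans (sym (^-distrib-* (fromNat D) (1/ⁿ D) (suc k))) (trans (^-congˡ (suc k) (n*1/ⁿ D)) (1^n≈1 (suc k))))) ⟩
        fromNat (2 ℕ.^ s) * (fromNat D * 1#)                        ≈⟨ *-congˡ (*-identityʳ (fromNat D)) ⟩
        fromNat (2 ℕ.^ s) * fromNat D                               ∎
        where
        open ≤-Reasoning
        N≤ : N ℕ.≤ 2 ℕ.^ s ℕ.* D ℕ.^ s
        N≤ = ℕₚ.≤-trans (ℕₚ.<⇒≤ N<) (ℕₚ.≤-trans (ℕₚ.^-monoˡ-≤ s (ℕₚ.+-mono-≤ (ℕ.>-nonZero⁻¹ D) (ℕₚ.≤-reflexive (≡.sym (ℕₚ.+-identityʳ D))))) (ℕₚ.≤-reflexive (^-distribʳ-* s 2 D)))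

    free-count : ℕ → Carrier
    free-count N = ∑ N (λ m → χ (¬ HasPowerDivisor s m))

    -- Sieving up to D is enough: a prime whose s-th power divides some m ≤ N < (D+1)ˢ is itself at
    -- most D.
    free-count≈Φ : ∀ {N D} → N ℕ.< suc D ℕ.^ s → free-count N ≈ Φ D N
    free-count≈Φ {N} {D} N< = ∑-cong-≤ N λ m m≤N → trans (χ-cong (to m) (from m m≤N)) (sym (*-identityʳ _))
      where
      to : ∀ m → ¬ HasPowerDivisor s m → Free s D m
      to m ¬has p pr _ p^s∣m = ¬has (p , pr , p^s∣m)
      from : ∀ m .{{_ : ℕ.NonZero m}} → m ℕ.≤ N → Free s D m → ¬ HasPowerDivisor s m
      from m m≤N free (p , pr , p^s∣m) = free p pr (ℕₚ.≤-pred (ℕₚ.≰⇒> λ 1+D≤p → ℕₚ.<⇒≱ (ℕₚ.≤-<-trans (∣⇒≤ p^s∣m) (ℕₚ.≤-<-trans m≤N N<)) (ℕₚ.^-monoˡ-≤ s 1+D≤p))) p^s∣m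

    -- The 1 accounts for the D small values of e. One 2ˢ comes from the tail in the sieve error,
    -- the other from replacing the finite product by 1/ζ(s).
    errorConstant : Carrier
    errorConstant = 1# + (fromNat (2 ℕ.^ s) + fromNat (2 ℕ.^ s))

    free-count-estimate : ∀ {N D} .{{_ : ℕ.NonZero D}} → N ℕ.< suc D ℕ.^ s →
      ∣ free-count N - fromNat N / ζ s ∣ ≤ errorConstant * fromNat D
    free-count-estimate {N} {D} N< = begin
      ∣ free-count N - fromNat N / ζ s ∣
        ≈⟨ ∣∣-cong (trans (+-congʳ (free-count≈Φ {N} {D} N<)) (solve 3 (λ a b c → a :- c := (a :- b) :+ (b :- c)) refl (Φ D N) (fromNat N * P D) (fromNat N / ζ s))) ⟩
      ∣ (Φ D N - fromNat N * P D) + (fromNat N * P D - fromNat N / ζ s) ∣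
        ≤⟨ ∣x+y∣≤∣x∣+∣y∣ _ _ ⟩
      ∣ Φ D N - fromNat N * P D ∣ + ∣ fromNat N * P D - fromNat N / ζ s ∣
        ≤⟨ +-mono-≤ (Φ-estimate {N} {D} N<) second ⟩
      (fromNat D + fromNat N * tail D) + fromNat N * tail D
        ≤⟨ +-mono-≤ (+-monoʳ-≤ (fromNat D) (N*tail≤ D N<)) (N*tail≤ D N<) ⟩
      (fromNat D + fromNat (2 ℕ.^ s) * fromNat D) + fromNat (2 ℕ.^ s) * fromNat D
        ≈⟨ solve 2 (λ d c → (d :+ c :* d) :+ c :* d := (con (+ 1) :+ (c :+ c)) :* d) refl (fromNat D) (fromNat (2 ℕ.^ s)) ⟩
      errorConstant * fromNat D ∎
      where
      open ≤-Reasoning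
      0≤N/ζ : 0# ≤ fromNat N / ζ s
      0≤N/ζ = /-nonNeg (fromNat-nonNeg N) 0<ζ
      second : ∣ fromNat N * P D - fromNat N / ζ s ∣ ≤ fromNat N * tail D
      second = begin
        ∣ fromNat N * P D - fromNat N / ζ s ∣            ≈⟨ ∣∣-cong (+-congʳ (*-congʳ (x/y*y≈x 0<ζ))) ⟨
        ∣ fromNat N / ζ s * ζ s * P D - fromNat N / ζ s ∣ ≈⟨ ∣∣-cong (solve 3 (λ x z p → x :* z :* p :- x := x :* (p :* z :- con (+ 1))) refl (fromNat N / ζ s) (ζ s) (P D)) ⟩
        ∣ fromNat N / ζ s * (P D * ζ s - 1#) ∣           ≤⟨ ∣x*y∣≤x*∣y∣ _ 0≤N/ζ ⟩
        fromNat N / ζ s * ∣ P D * ζ s - 1# ∣             ≤⟨ *-mono-≤ (0≤∣x∣ _) (fromNat-nonNeg N) N/ζ≤N (P*ζ≈1 D) ⟩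
        fromNat N * tail D                               ∎
        where
        N/ζ≤N : fromNat N / ζ s ≤ fromNat N
        N/ζ≤N = ≤*⇒/≤ 0<ζ (≤-respˡ-≈ (*-identityʳ _) (*-monoʳ-≤ (fromNat-nonNeg N) 1≤ζ))

    -- D is the integer part of Y^(1/s).
    free-count-floor : ∀ {Y} (0≤Y : 0# ≤ Y) → ∃[ D ] (fromNat D ^ s ≤ Y ×
      ∣ free-count (floor 0≤Y) - Y / ζ s ∣ ≤ errorConstant * fromNat D + 1#)
    free-count-floor {Y} 0≤Y = estimate (iroot (suc k) n)
      where
      open ≤-Reasoning
      n : ℕ
      n = floor 0≤Y
      Nζ⁻ Yζ⁻ : Carrier
      Nζ⁻ = fromNat n / ζ s
      Yζ⁻ = Y / ζ s
      -- Passing from the integer part n to Y changes the main term by less than 1/ζ(s), and ζ(s) ≥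
      -- 1.
      rounding : ∣ Nζ⁻ - Yζ⁻ ∣ ≤ 1#
      rounding = ∣x∣≤ (≤-trans (+-monoˡ-≤ (- Yζ⁻) (*-monoˡ-≤ (<⇒≤ (⁻¹-pos 0<ζ)) (floor-≤ 0≤Y))) (≤-respˡ-≈ (sym (-‿inverseʳ Yζ⁻)) 0≤1)) (begin
        - (Nζ⁻ - Yζ⁻)                    ≈⟨ solve 3 (λ n y z → :- (n :* z :- y :* z) := (y :- n) :* z) refl (fromNat n) Y (ζ s ⁻¹) ⟩
        (Y - fromNat n) / ζ s            ≤⟨ ≤*⇒/≤ 0<ζ (≤-respʳ-≈ (sym (*-identityˡ (ζ s))) (≤-trans Y-N≤1 1≤ζ)) ⟩
        1#                               ∎)
        where
        Y-N≤1 : Y - fromNat n ≤ 1#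
        Y-N≤1 = ≤-trans (+-monoˡ-≤ (- fromNat n) (<⇒≤ (<floor+1 0≤Y))) (≤-reflexive (solve 1 (λ n → (n :+ con (+ 1)) :- n := con (+ 1)) refl (fromNat n)))
      at-n : ∀ D → n ℕ.< suc D ℕ.^ s → ∣ free-count n - Nζ⁻ ∣ ≤ errorConstant * fromNat D
      at-n (suc D) N< = free-count-estimate {n} {suc D} N<
      -- D = 0 occurs when Y < 1. The estimate above involves 1/D and does not apply, but then n = 0
      -- and there is nothing to count.
      at-n ℕ.zero N<1 = ≤-reflexive (begin-equality
        ∣ free-count n - fromNat n / ζ s ∣     ≡⟨ ≡.cong (λ t → ∣ free-count t - fromNat t / ζ s ∣) (ℕₚ.n<1⇒n≡0 (≡.subst (n ℕ.<_) (ℕₚ.^-zeroˡ s) N<1)) ⟩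
        ∣ 0# - 0# * ζ s ⁻¹ ∣                   ≈⟨ ∣∣-cong (solve 1 (λ z → con (+ 0) :- con (+ 0) :* z := con (+ 0)) refl (ζ s ⁻¹)) ⟩
        ∣ 0# ∣                                 ≈⟨ 0≤x⇒∣x∣≈x ≤-refl ⟩
        0#                                     ≈⟨ zeroʳ errorConstant ⟨
        errorConstant * 0#                     ∎)
      estimate : ∃[ D ] (D ℕ.^ s ℕ.≤ n × n ℕ.< suc D ℕ.^ s) → ∃[ D ] (fromNat D ^ s ≤ Y × ∣ free-count n - Yζ⁻ ∣ ≤ errorConstant * fromNat D + 1#)
      estimate (D , D^s≤n , N<) = D , ≤-trans (≤-respˡ-≈ (fromNat-^ D s) (fromNat-mono D^s≤n)) (floor-≤ 0≤Y) , (begin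
        ∣ free-count n - Yζ⁻ ∣                          ≈⟨ ∣∣-cong (solve 3 (λ a b c → a :- c := (a :- b) :+ (b :- c)) refl (free-count n) Nζ⁻ Yζ⁻) ⟩
        ∣ (free-count n - Nζ⁻) + (Nζ⁻ - Yζ⁻) ∣          ≤⟨ ∣x+y∣≤∣x∣+∣y∣ _ _ ⟩
        ∣ free-count n - Nζ⁻ ∣ + ∣ Nζ⁻ - Yζ⁻ ∣          ≤⟨ +-mono-≤ (at-n D N<) rounding ⟩
        errorConstant * fromNat D + 1#                  ∎)

  open Equivalence using (to; from)

  -- Counting curves

  members : (ℕ → Set) → ℕ → List ℕ
  members P ℕ.zero  = []
  members P (suc N) with lem {P (suc N)}
  ... | yes _ = suc N ∷ members P N
  ... | no  _ = members P N

  ∈-members⁻ : ∀ P N {m} → m ∈ members P N → ℕ.NonZero m × m ℕ.≤ N × P m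
  ∈-members⁻ P (suc N) m∈ with lem {P (suc N)}
  ∈-members⁻ P (suc N) (here ≡.refl) | yes p = _ , ℕₚ.≤-refl , p
  ∈-members⁻ P (suc N) (there m∈)    | yes _ with ∈-members⁻ P N m∈
  ... | m≢0 , m≤N , p = m≢0 , ℕₚ.m≤n⇒m≤1+n m≤N , p
  ∈-members⁻ P (suc N) m∈ | no _ with ∈-members⁻ P N m∈
  ... | m≢0 , m≤N , p = m≢0 , ℕₚ.m≤n⇒m≤1+n m≤N , p

  ∈-members⁺ : ∀ P N {m} .{{_ : ℕ.NonZero m}} → m ℕ.≤ N → P m → m ∈ members P N
  ∈-members⁺ P (suc N) {m} m≤ p with lem {P (suc N)} | ℕₚ.m≤n⇒m<n∨m≡n m≤
  ... | yes _ | inj₁ (ℕ.s≤s m≤N) = there (∈-members⁺ P N m≤N p)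
  ... | yes _ | inj₂ ≡.refl      = here ≡.refl
  ... | no  _ | inj₁ (ℕ.s≤s m≤N) = ∈-members⁺ P N m≤N p
  ... | no ¬p | inj₂ ≡.refl      = contradiction p ¬p
  ∈-members⁺ P ℕ.zero {ℕ.suc m} () p

  members-unique : ∀ P N → Unique (members P N)
  members-unique P ℕ.zero  = []
  members-unique P (suc N) with lem {P (suc N)}
  ... | yes _ = All.tabulate (λ m∈ → ℕₚ.>⇒≢ (ℕ.s≤s (proj₁ (proj₂ (∈-members⁻ P N m∈))))) ∷ members-unique P N
  ... | no  _ = members-unique P N

  length-members : ∀ P N → fromNat (length (members P N)) ≈ ∑ N (λ m → χ (P m))
  length-members P ℕ.zero  = refl
  length-members P (suc N) with lem {P (suc N)}
  ... | yes p = trans (+-comm 1# _) (+-cong (length-members P N) (sym (χ-yes p)))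
  ... | no ¬p = trans (length-members P N) (trans (sym (+-identityʳ _)) (+-congˡ (sym (χ-no ¬p))))

  fromNat-injective : ∀ {m n} → fromNat m ≈ fromNat n → m ≡ n
  fromNat-injective eq = ℕₚ.≤-antisym (fromNat-cancel-≤ (≤-reflexive eq)) (fromNat-cancel-≤ (≤-reflexive (sym eq)))

  length-members-⊤ : ∀ N → length (members (λ _ → ⊤) N) ≡ N
  length-members-⊤ N = fromNat-injective (trans (length-members (λ _ → ⊤) N) (trans (∑-cong N (λ _ → χ-yes tt)) (∑-1 N)))

  +m≡-+n⇒m≡0 : ∀ {m n} → + m ≡ ℤ.- + n → m ≡ 0
  +m≡-+n⇒m≡0 {ℕ.zero}          eq = ≡.refl
  +m≡-+n⇒m≡0 {suc m} {ℕ.zero}  ()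
  +m≡-+n⇒m≡0 {suc m} {suc n}   ()

  module _ (φ : ℤ → Curve) (φ-injective : ∀ {k l : ℤ} → φ k ≡ φ l → k ≡ l) (P : ℕ → Set) (n : ℕ) where

    private
      ms = members P n
      pos neg : ℕ → Curve
      pos m = φ (+ m)
      neg m = φ (ℤ.- + m)

      disjoint : ∀ {E} → ¬ (E ∈ map pos ms × E ∈ map neg ms)
      disjoint (E∈⁺ , E∈⁻) with ∈-map⁻ pos E∈⁺ | ∈-map⁻ neg E∈⁻
      ... | m , m∈ , ≡.refl | l , _ , eq = ℕ.≢-nonZero⁻¹ m {{proj₁ (∈-members⁻ P n m∈)}} (+m≡-+n⇒m≡0 (φ-injective eq))

      unique : Unique (map pos ms ++ map neg ms)
      unique = Unique.++⁺ (Unique.map⁺ (ℤₚ.+-injective ∘ φ-injective) (members-unique P n))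
                          (Unique.map⁺ (ℤₚ.+-injective ∘ ℤₚ.neg-injective ∘ φ-injective) (members-unique P n)) disjoint

    -- The factor 2 is the sign of the parameter. Since `members` lists positive numbers only, no
    -- φ(m) coincides with any φ(-l).
    card-± : ∀ (S : Pred Curve 0ℓ) → (∀ E → S E ⇔ (∃[ i ] (i ≢ + 0 × ℤ.∣ i ∣ ℕ.≤ n × P ℤ.∣ i ∣ × φ i ≡ E))) → Card S (2 ℕ.* length ms)
    card-± S S⇔ = map pos ms ++ map neg ms , unique , (λ E → mk⇔ (from (S⇔ E) ∘ listed⇒ E) (listed⇐ E ∘ to (S⇔ E))) ,
      ≡.trans (length-++ (map pos ms)) (≡.cong₂ ℕ._+_ (length-map pos ms) (≡.trans (length-map neg ms) (≡.sym (ℕₚ.+-identityʳ _))))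
      where
      listed⇒ : ∀ E → E ∈ map pos ms ++ map neg ms → ∃[ i ] (i ≢ + 0 × ℤ.∣ i ∣ ℕ.≤ n × P ℤ.∣ i ∣ × φ i ≡ E)
      listed⇒ E E∈ = [ positive , negative ]′ (∈-++⁻ (map pos ms) E∈)
        where
        positive : E ∈ map pos ms → _
        positive E∈⁺ with ∈-map⁻ pos E∈⁺
        ... | m , m∈ , ≡.refl with ∈-members⁻ P n m∈
        ...   | m≢0 , m≤n , p = + m , ℕ.≢-nonZero⁻¹ m {{m≢0}} ∘ ℤₚ.+-injective , m≤n , p , ≡.refl
        negative : E ∈ map neg ms → _
        negative E∈⁻ with ∈-map⁻ neg E∈⁻
        ... | m , m∈ , ≡.refl with ∈-members⁻ P n m∈
        ...   | m≢0 , m≤n , p = ℤ.- + m , ℕ.≢-nonZero⁻¹ m {{m≢0}} ∘ ≡.trans (≡.sym (ℤₚ.∣-i∣≡∣i∣ (+ m))) ∘ ≡.cong ℤ.∣_∣ ,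
                  ≡.subst (λ t → t ℕ.≤ n × P t × φ (ℤ.- + m) ≡ neg m) (≡.sym (ℤₚ.∣-i∣≡∣i∣ (+ m))) (m≤n , p , ≡.refl)
      listed⇐ : ∀ E → ∃[ i ] (i ≢ + 0 × ℤ.∣ i ∣ ℕ.≤ n × P ℤ.∣ i ∣ × φ i ≡ E) → E ∈ map pos ms ++ map neg ms
      listed⇐ E (+ ℕ.zero , i≢0 , _) = contradiction ≡.refl i≢0
      listed⇐ E (+ suc m , _ , m≤n , p , ≡.refl) = ∈-++⁺ˡ (∈-map⁺ pos (∈-members⁺ P n m≤n p))
      listed⇐ E (-[1+ m ] , _ , m≤n , p , ≡.refl) = ∈-++⁺ʳ (map pos ms) (∈-map⁺ neg (∈-members⁺ P n m≤n p))

  1≤x⇒1≤root : ∀ n {x} → 1# ≤ x → 1# ≤ x ^1/ suc n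
  1≤x⇒1≤root n {x} 1≤x = ^-cancel-≤ n (root-nonNeg n 0≤x) (≤-respˡ-≈ (sym (1^n≈1 (suc n))) (≤-respʳ-≈ (sym (root-^ n 0≤x)) 1≤x))
    where 0≤x = ≤-trans 0≤1 1≤x

  module Family {j : ℚ} {k : ℕ} (Π : Parametrisation j (suc (suc k))) (α β : Carrier) (Y : Carrier → Carrier)
    (0≤Y : ∀ X → 1# < X → 0# ≤ Y X)
    (height : ∀ X → 1# < X → ∀ i → H α β (Parametrisation.φ Π i) ≤ X ⇔ fromNat ℤ.∣ i ∣ ≤ Y X)
    where

    open Parametrisation Π
    open Zeta k using (s)
    open Estimate k

    module _ (X : Carrier) (1<X : 1# < X) where
      private
        n : ℕ
        n = floor (0≤Y X 1<X)

        ≤n⇔ : ∀ i → ℤ.∣ i ∣ ℕ.≤ n ⇔ H α β (φ i) ≤ X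
        ≤n⇔ i = mk⇔ (λ i≤n → from (height X 1<X i) (≤-trans (fromNat-mono i≤n) (floor-≤ (0≤Y X 1<X))))
                    (λ h≤X → ≤floor (0≤Y X 1<X) (to (height X 1<X i) h≤X))

      Ẽ-card : Card ((Ẽ[ j ] ⟨ H α β ⟩) X) (2 ℕ.* n)
      Ẽ-card = ≡.subst (λ t → Card ((Ẽ[ j ] ⟨ H α β ⟩) X) (2 ℕ.* t)) (length-members-⊤ n)
        (card-± φ φ-injective (λ _ → ⊤) n _ λ E → mk⇔ (forward E) (backward E))
        where
        forward : ∀ E → (Ẽ[ j ] ⟨ H α β ⟩) X E → ∃[ i ] (i ≢ + 0 × ℤ.∣ i ∣ ℕ.≤ n × ⊤ × φ i ≡ E)
        forward E (e , h≤X) with φ-complete {E} e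
        ... | i , i≢0 , ≡.refl = i , i≢0 , from (≤n⇔ i) h≤X , tt , ≡.refl
        backward : ∀ E → ∃[ i ] (i ≢ + 0 × ℤ.∣ i ∣ ℕ.≤ n × ⊤ × φ i ≡ E) → (Ẽ[ j ] ⟨ H α β ⟩) X E
        backward E (i , i≢0 , i≤n , _ , ≡.refl) = φ-sound {i} i≢0 , to (≤n⇔ i) i≤n

      𝓔-card : Card ((𝓔[ j ] ⟨ H α β ⟩) X) (2 ℕ.* length (members (λ m → ¬ HasPowerDivisor s m) n))
      𝓔-card = card-± φ φ-injective (λ m → ¬ HasPowerDivisor s m) n _ λ E → mk⇔ (forward E) (backward E)
        where
        forward : ∀ E → (𝓔[ j ] ⟨ H α β ⟩) X E → ∃[ i ] (i ≢ + 0 × ℤ.∣ i ∣ ℕ.≤ n × ¬ HasPowerDivisor s ℤ.∣ i ∣ × φ i ≡ E)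
        forward E (((e , minimal) , j≡) , h≤X) with φ-complete {E} (e , j≡)
        ... | i , i≢0 , ≡.refl = i , i≢0 , from (≤n⇔ i) h≤X , minimal ∘ from (φ-minimal {i} i≢0) , ≡.refl
        backward : ∀ E → ∃[ i ] (i ≢ + 0 × ℤ.∣ i ∣ ℕ.≤ n × ¬ HasPowerDivisor s ℤ.∣ i ∣ × φ i ≡ E) → (𝓔[ j ] ⟨ H α β ⟩) X E
        backward E (i , i≢0 , i≤n , free , ≡.refl) = ((proj₁ e , free ∘ to (φ-minimal {i} i≢0)) , proj₂ e) , to (≤n⇔ i) i≤n
          where e = φ-sound {i} i≢0

      𝓔-error : ∃[ D ] (fromNat D ^ s ≤ Y X ×
        ∣ fromNat (2 ℕ.* length (members (λ m → ¬ HasPowerDivisor s m) n)) - fromNat 2 * (Y X / ζ s) ∣ ≤ fromNat 2 * (errorConstant * fromNat D + 1#))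
      𝓔-error = double (free-count-floor (0≤Y X 1<X))
        where
        open ≤-Reasoning
        ℓ = length (members (λ m → ¬ HasPowerDivisor s m) n)
        double : ∃[ D ] (fromNat D ^ s ≤ Y X × ∣ free-count n - Y X / ζ s ∣ ≤ errorConstant * fromNat D + 1#) → _
        double (D , D^s≤Y , close) = D , D^s≤Y , (begin
          ∣ fromNat (2 ℕ.* ℓ) - fromNat 2 * (Y X / ζ s) ∣
            ≈⟨ ∣∣-cong (trans (+-congʳ (trans (fromNat-* 2 ℓ) (*-congˡ (length-members (λ m → ¬ HasPowerDivisor s m) n)))) (solve 3 (λ a b c → a :* b :- a :* c := a :* (b :- c)) refl (fromNat 2) (free-count n) (Y X / ζ s))) ⟩
          ∣ fromNat 2 * (free-count n - Y X / ζ s) ∣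
            ≤⟨ ∣x*y∣≤x*∣y∣ _ (fromNat-nonNeg 2) ⟩
          fromNat 2 * ∣ free-count n - Y X / ζ s ∣
            ≤⟨ *-monoʳ-≤ (fromNat-nonNeg 2) close ⟩
          fromNat 2 * (errorConstant * fromNat D + 1#) ∎)

    Ẽ-count : # Ẽ[ j ] ⟨ H α β ⟩ ≡ (λ X → + 2 ℤ.* ⌊ Y X ⌋)
    Ẽ-count X 1<X = 2 ℕ.* floor (0≤Y X 1<X) , Ẽ-card X 1<X ,
      ≡.trans (ℤₚ.pos-* 2 (floor (0≤Y X 1<X))) (≡.cong (+ 2 ℤ.*_) (≡.sym (⌊⌋≡floor (0≤Y X 1<X))))

    0≤errorConstant : 0# ≤ errorConstant
    0≤errorConstant = ≤-trans 0≤1 (x≤x+y (≤-trans (fromNat-nonNeg (2 ℕ.^ s)) (x≤x+y (fromNat-nonNeg (2 ℕ.^ s)))))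

    -- The hypothesis on Y turns Dˢ ≤ Y into D ≤ K X^(1/12). The remaining constant error is
    -- absorbed because X > 1 gives X^(1/12) ≥ 1.
    𝓔-count : ∀ {main K} → 0# ≤ K → (∀ X → main X ≈ fromNat 2 * (Y X / ζ s)) →
      (∀ X → 1# < X → Y X ≤ (K * X ^1/ 12) ^ s) →
      # 𝓔[ j ] ⟨ H α β ⟩ ≈ main +O (λ X → X ^1/ 12)
    𝓔-count {main} {K} 0≤K main≈ Y≤ = fromNat 2 * (errorConstant * K + 1#) , λ X 1<X →
      ℓ X 1<X , 𝓔-card X 1<X , bound X 1<X (𝓔-error X 1<X)
      where
      ℓ : ∀ X → 1# < X → ℕ
      ℓ X 1<X = 2 ℕ.* length (members (λ m → ¬ HasPowerDivisor s m) (floor (0≤Y X 1<X)))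
      open ≤-Reasoning
      bound : ∀ X (1<X : 1# < X) → ∃[ D ] (fromNat D ^ s ≤ Y X × ∣ fromNat (ℓ X 1<X) - fromNat 2 * (Y X / ζ s) ∣ ≤ fromNat 2 * (errorConstant * fromNat D + 1#)) →
        ∣ fromNat (ℓ X 1<X) - main X ∣ ≤ fromNat 2 * (errorConstant * K + 1#) * X ^1/ 12
      bound X 1<X (D , D^s≤Y , close) = begin
        ∣ fromNat (ℓ X 1<X) - main X ∣                                 ≈⟨ ∣∣-cong (+-congˡ (-‿cong (main≈ X))) ⟩
        ∣ fromNat (ℓ X 1<X) - fromNat 2 * (Y X / ζ s) ∣                ≤⟨ close ⟩
        fromNat 2 * (errorConstant * fromNat D + 1#)           ≤⟨ *-monoʳ-≤ (fromNat-nonNeg 2) (+-mono-≤ (*-monoʳ-≤ 0≤errorConstant D≤) (1≤x⇒1≤root 11 (<⇒≤ 1<X))) ⟩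
        fromNat 2 * (errorConstant * (K * x) + x)              ≈⟨ solve 4 (λ t e k x → t :* (e :* (k :* x) :+ x) := t :* (e :* k :+ con (+ 1)) :* x) refl (fromNat 2) errorConstant K x ⟩
        fromNat 2 * (errorConstant * K + 1#) * x               ∎
        where
        x = X ^1/ 12
        D≤ : fromNat D ≤ K * x
        D≤ = ^-cancel-≤ (suc k) (*-nonNeg 0≤K (≤-trans 0≤1 (1≤x⇒1≤root 11 (<⇒≤ 1<X)))) (≤-trans D^s≤Y (Y≤ X 1<X))

  -- Heights of the parametrised curves, in the three cases

  ^-injective : ∀ n {x y} → 0# ≤ x → 0# ≤ y → x ^ suc n ≈ y ^ suc n → x ≈ y
  ^-injective n 0≤x 0≤y eq = antisym (^-cancel-≤ n 0≤y (≤-reflexive eq)) (^-cancel-≤ n 0≤x (≤-reflexive (sym eq)))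

  -- Expresses X^(1/2), X^(1/3) and X^(1/6) as powers of X^(1/12) through 12 = 6 · 2 = 4 · 3 = 2 ·
  -- 6, the first factor being s each time.
  root-of-root : ∀ m n {x} → 0# ≤ x → (x ^1/ (suc n ℕ.* suc m)) ^ suc n ≈ x ^1/ suc m
  root-of-root m n {x} 0≤x = ^-injective m (^-nonNeg (suc n) (root-nonNeg l 0≤x)) (root-nonNeg m 0≤x) (begin-equality
    ((x ^1/ suc l) ^ suc n) ^ suc m     ≈⟨ ^-assocʳ (x ^1/ suc l) (suc n) (suc m) ⟩
    (x ^1/ suc l) ^ suc l               ≈⟨ root-^ l 0≤x ⟩
    x                                   ≈⟨ root-^ m 0≤x ⟨
    (x ^1/ suc m) ^ suc m               ∎)
    where
    open ≤-Reasoning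
    l = m ℕ.+ n ℕ.* suc m

  -- Applied to sixth powers with c = α or β, d = N and e = |a|^(1/2) or |a|^(1/3); the coefficient
  -- e / (d c^(1/6)) is then one of the two terms in the minimum that defines `c`.
  ^-≤⇔≤-root : ∀ n {c d e m x} → 0# < c → 0# < d → 0# ≤ e → 0# ≤ m → 0# ≤ x →
    c * (m * d) ^ suc n ≤ x * e ^ suc n ⇔ m ≤ (e / (d * c ^1/ suc n)) * x ^1/ suc n
  ^-≤⇔≤-root n {c} {d} {e} {m} {x} 0<c 0<d 0≤e 0≤m 0≤x = mk⇔
    (λ le → ≤-respʳ-≈ rearrange (*≤⇒≤/ 0<dr (^-cancel-≤ n (*-nonNeg 0≤e (root-nonNeg n 0≤x)) (≤-respˡ-≈ (sym lhs) (≤-respʳ-≈ (sym rhs) le)))))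
    (λ le → ≤-respˡ-≈ lhs (≤-respʳ-≈ rhs (^-monoˡ-≤ (suc n) (*-nonNeg 0≤m (<⇒≤ 0<dr)) (≤/⇒*≤ 0<dr (≤-respʳ-≈ (sym rearrange) le)))))
    where
    open ≤-Reasoning
    r = c ^1/ suc n
    y = x ^1/ suc n
    0<dr : 0# < d * r
    0<dr = *-pos 0<d (root-pos n 0<c)
    rearrange : (e * y) / (d * r) ≈ (e / (d * r)) * y
    rearrange = solve 3 (λ e y i → (e :* y) :* i := (e :* i) :* y) refl e y ((d * r) ⁻¹)
    lhs : (m * (d * r)) ^ suc n ≈ c * (m * d) ^ suc n
    lhs = begin-equality
      (m * (d * r)) ^ suc n           ≈⟨ ^-congˡ (suc n) (solve 3 (λ m d r → m :* (d :* r) := r :* (m :* d)) refl m d r) ⟩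
      (r * (m * d)) ^ suc n           ≈⟨ ^-distrib-* r (m * d) (suc n) ⟩
      r ^ suc n * (m * d) ^ suc n     ≈⟨ *-congʳ (root-^ n (<⇒≤ 0<c)) ⟩
      c * (m * d) ^ suc n             ∎
    rhs : (e * y) ^ suc n ≈ x * e ^ suc n
    rhs = begin-equality
      (e * y) ^ suc n                 ≈⟨ ^-distrib-* e y (suc n) ⟩
      e ^ suc n * y ^ suc n           ≈⟨ *-congˡ (root-^ n 0≤x) ⟩
      e ^ suc n * x                   ≈⟨ *-comm _ _ ⟩
      x * e ^ suc n                   ∎

  ⊔≤⇔ : ∀ {x y z} → x ⊔ y ≤ z ⇔ (x ≤ z × y ≤ z)
  ⊔≤⇔ {x} {y} = mk⇔ (λ le → ≤-trans (x≤x⊔y x y) le , ≤-trans (x≤y⊔x x y) le) (λ (p , q) → ⊔-lub p q)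

  ≤⊓*⇔ : ∀ {m x y z} → 0# ≤ z → m ≤ (x ⊓ y) * z ⇔ (m ≤ x * z × m ≤ y * z)
  ≤⊓*⇔ {m} {x} {y} {z} 0≤z = mk⇔
    (λ le → ≤-trans le (*-monoˡ-≤ 0≤z (x⊓y≤x x y)) , ≤-trans le (*-monoˡ-≤ 0≤z (x⊓y≤y x y)))
    (λ (p , q) → [ (λ eq → ≤-respʳ-≈ (*-congʳ (sym eq)) p) , (λ eq → ≤-respʳ-≈ (*-congʳ (sym eq)) q) ]′ (⊓-sel x y))

  ⁻¹-distrib-* : ∀ {x y} → 0# < x → 0# < y → (x * y) ⁻¹ ≈ x ⁻¹ * y ⁻¹
  ⁻¹-distrib-* {x} {y} 0<x 0<y = *-cancelˡ-≈ (*-pos 0<x 0<y) (begin-equality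
    (x * y) * (x * y) ⁻¹          ≈⟨ *-inverseʳ (0<x⇒x≉0 (*-pos 0<x 0<y)) ⟩
    1#                            ≈⟨ *-identityˡ 1# ⟨
    1# * 1#                       ≈⟨ *-cong (*-inverseʳ (0<x⇒x≉0 0<x)) (*-inverseʳ (0<x⇒x≉0 0<y)) ⟨
    (x * x ⁻¹) * (y * y ⁻¹)       ≈⟨ solve 4 (λ x i y k → (x :* i) :* (y :* k) := (x :* y) :* (i :* k)) refl x (x ⁻¹) y (y ⁻¹) ⟩
    (x * y) * (x ⁻¹ * y ⁻¹)       ∎)
    where open ≤-Reasoning

  1<X⇒0≤X : ∀ {X} → 1# < X → 0# ≤ X
  1<X⇒0≤X 1<X = ≤-trans 0≤1 (<⇒≤ 1<X)

  1≤x⇒0<x : ∀ {x} → 1# ≤ x → 0# < x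
  1≤x⇒0<x = <-≤-trans 0<1

  -- Common to j = 0 and j = 1728, where one coefficient vanishes and the height is γ |k|^(n+1): γ =
  -- β with exponent 2, and γ = α with exponent 3.
  module Monomial (n : ℕ) {γ : Carrier} (1≤γ : 1# ≤ γ) where

    private
      0<γ = 1≤x⇒0<x 1≤γ
      r = γ ^1/ suc n

    0<r : 0# < r
    0<r = root-pos n 0<γ

    Y : Carrier → Carrier
    Y X = X ^1/ suc n / r

    0≤Y : ∀ X → 1# < X → 0# ≤ Y X
    0≤Y X 1<X = /-nonNeg (root-nonNeg n (1<X⇒0≤X 1<X)) 0<r

    γm^n≤X⇔m≤Y : ∀ X → 1# < X → ∀ {m} → 0# ≤ m → γ * m ^ suc n ≤ X ⇔ m ≤ Y X
    γm^n≤X⇔m≤Y X 1<X {m} 0≤m = mk⇔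
      (λ le → *≤⇒≤/ 0<r (^-cancel-≤ n (root-nonNeg n 0≤X) (≤-respˡ-≈ (sym lhs) (≤-respʳ-≈ (sym (root-^ n 0≤X)) le))))
      (λ le → ≤-respˡ-≈ lhs (≤-respʳ-≈ (root-^ n 0≤X) (^-monoˡ-≤ (suc n) (*-nonNeg 0≤m (<⇒≤ 0<r)) (≤/⇒*≤ 0<r le))))
      where
      0≤X = 1<X⇒0≤X 1<X
      lhs : (m * r) ^ suc n ≈ γ * m ^ suc n
      lhs = trans (^-distrib-* m r (suc n)) (trans (*-congˡ (root-^ n (<⇒≤ 0<γ))) (*-comm _ _))

    Y≤root : ∀ X → 1# < X → Y X ≤ X ^1/ suc n
    Y≤root X 1<X = ≤*⇒/≤ 0<r (≤-respˡ-≈ (*-identityʳ _) (*-monoʳ-≤ (root-nonNeg n (1<X⇒0≤X 1<X)) (1≤x⇒1≤root n 1≤γ)))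

    main≈ : ∀ {z} → 0# < z → ∀ X → fromNat 2 / (r * z) * X ^1/ suc n ≈ fromNat 2 * (Y X / z)
    main≈ {z} 0<z X = trans (*-congʳ (*-congˡ (⁻¹-distrib-* 0<r 0<z)))
      (solve 4 (λ t i k x → t :* (i :* k) :* x := t :* (x :* i :* k)) refl (fromNat 2) (r ⁻¹) (z ⁻¹) (X ^1/ suc n))

    Y≤^ : ∀ l X → 1# < X → Y X ≤ (1# * X ^1/ (suc l ℕ.* suc n)) ^ suc l
    Y≤^ l X 1<X = ≤-trans (Y≤root X 1<X) (≤-reflexive (sym (trans (^-congˡ (suc l) (*-identityˡ _)) (root-of-root n l (1<X⇒0≤X 1<X)))))

  x⊔0≤⇔ : ∀ {x y z} → 0# ≤ z → y ≈ 0# → x ⊔ y ≤ z ⇔ x ≤ z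
  x⊔0≤⇔ 0≤z y≈0 = mk⇔ (λ le → proj₁ (to ⊔≤⇔ le)) (λ x≤z → from ⊔≤⇔ (x≤z , ≤-respˡ-≈ (sym y≈0) 0≤z))

  0⊔y≤⇔ : ∀ {x y z} → 0# ≤ z → x ≈ 0# → x ⊔ y ≤ z ⇔ y ≤ z
  0⊔y≤⇔ 0≤z x≈0 = mk⇔ (λ le → proj₂ (to ⊔≤⇔ le)) (λ y≤z → from ⊔≤⇔ (≤-respˡ-≈ (sym x≈0) 0≤z , y≤z))

  ≤-cong-⇔ : ∀ {x y z w} → x ≈ y → z ≈ w → x ≤ z ⇔ y ≤ w
  ≤-cong-⇔ x≈y z≈w = mk⇔ (λ le → ≤-respˡ-≈ x≈y (≤-respʳ-≈ z≈w le)) (λ le → ≤-respˡ-≈ (sym x≈y) (≤-respʳ-≈ (sym z≈w) le))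

  infixr 1 _⟫_
  _⟫_ : ∀ {P Q R : Set} → P ⇔ Q → Q ⇔ R → P ⇔ R
  f ⟫ g = mk⇔ (to g ∘ to f) (from f ∘ from g)

  module Case₀ (α β : Carrier) (1≤β : 1# ≤ β) where
    open Monomial 1 1≤β public

    height : ∀ X → 1# < X → ∀ i → H α β (+ 0 , i) ≤ X ⇔ fromNat ℤ.∣ i ∣ ≤ Y X
    height X 1<X i = 0⊔y≤⇔ (1<X⇒0≤X 1<X) α0≈0 ⟫ ≤-cong-⇔ (*-congˡ (fromInt² i)) refl ⟫ γm^n≤X⇔m≤Y X 1<X (fromNat-nonNeg ℤ.∣ i ∣)
      where
      α0≈0 : α * ∣ fromInt (+ 0) ∣ ^ 3 ≈ 0#
      α0≈0 = trans (*-congˡ (trans (^-congˡ 3 (∣fromInt∣ (+ 0))) (zeroˡ _))) (zeroʳ α)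

    open Family parametrisation₀ α β Y 0≤Y height public

  module Case₁₇₂₈ (α β : Carrier) (1≤α : 1# ≤ α) where
    open Monomial 2 1≤α public

    height : ∀ X → 1# < X → ∀ i → H α β (i , + 0) ≤ X ⇔ fromNat ℤ.∣ i ∣ ≤ Y X
    height X 1<X i = x⊔0≤⇔ (1<X⇒0≤X 1<X) β0≈0 ⟫ ≤-cong-⇔ (*-congˡ (^-congˡ 3 (∣fromInt∣ i))) refl ⟫ γm^n≤X⇔m≤Y X 1<X (fromNat-nonNeg ℤ.∣ i ∣)
      where
      β0≈0 : β * fromInt (+ 0) ^ 2 ≈ 0#
      β0≈0 = trans (*-congˡ (zeroˡ _)) (zeroʳ β)

    open Family parametrisation₁₇₂₈ α β Y 0≤Y height public

  ↥∣∣ : ∀ q → ↥ ℚ.∣ q ∣ ≡ + ℤ.∣ ↥ q ∣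
  ↥∣∣ (mkℚ _ _ _) = ≡.refl

  ↧∣∣ : ∀ q → ↧ₙ ℚ.∣ q ∣ ≡ ↧ₙ q
  ↧∣∣ (mkℚ _ _ _) = ≡.refl

  fromRat-* : ∀ q → fromRat q * fromNat (↧ₙ q) ≈ fromInt (↥ q)
  fromRat-* q = x/y*y≈x (fromNat-nonZero-pos (↧ₙ q))

  fromRat-fraction : ∀ q y x → ↥ q ℤ.* y ≡ x ℤ.* ↧ q → fromRat q * fromInt y ≈ fromInt x
  fromRat-fraction q y x eq = *-cancelˡ-≈ (fromNat-nonZero-pos (↧ₙ q)) (begin-equality
    d * (fromRat q * fromInt y)      ≈⟨ solve 3 (λ d q y → d :* (q :* y) := (q :* d) :* y) refl d (fromRat q) (fromInt y) ⟩
    (fromRat q * d) * fromInt y      ≈⟨ *-congʳ (fromRat-* q) ⟩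
    fromInt (↥ q) * fromInt y        ≈⟨ fromInt-* (↥ q) y ⟨
    fromInt (↥ q ℤ.* y)              ≡⟨ ≡.cong fromInt eq ⟩
    fromInt (x ℤ.* ↧ q)              ≈⟨ fromInt-* x (↧ q) ⟩
    fromInt x * d                    ≈⟨ *-comm _ _ ⟩
    d * fromInt x                    ∎)
    where
    open ≤-Reasoning
    d = fromNat (↧ₙ q)

  x*y-pos⇒x-pos : ∀ {x y z} → 0# < y → 0# < z → x * y ≈ z → 0# < x
  x*y-pos⇒x-pos {x} {y} {z} 0<y 0<z xy≈z = ≰⇒> λ x≤0 → <⇒≱ 0<z (≤-respˡ-≈ xy≈z (≤-respʳ-≈ (zeroˡ y) (*-monoˡ-≤ (<⇒≤ 0<y) x≤0)))

  module CaseGeneric (j : ℚ) (j≢0 : j ≢ 0ℚ) (j≢1728 : j ≢ 1728ℚ) (α β : Carrier) (1≤α : 1# ≤ α) (1≤β : 1# ≤ β) where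
    open Generic j j≢0 j≢1728

    private
      ā n̄ : Carrier
      ā = fromRat ℚ.∣ a ∣
      n̄ = fromRat (N a)

      ā*v≈u : ā * fromNat v ≈ fromNat u
      ā*v≈u = trans (*-congˡ (reflexive (≡.cong fromNat (≡.sym (↧∣∣ a))))) (trans (fromRat-* ℚ.∣ a ∣) (reflexive (≡.cong fromInt (↥∣∣ a))))

      0<ā : 0# < ā
      0<ā = x*y-pos⇒x-pos (fromNat-nonZero-pos v) (fromNat-nonZero-pos u) ā*v≈u

      n̄*n₂≈n₁ : n̄ * fromNat n₂ ≈ fromNat n₁
      n̄*n₂≈n₁ = fromRat-fraction (N a) (+ n₂) (+ n₁) (N-fraction a a≢0)

      0<n̄ : 0# < n̄
      0<n̄ = x*y-pos⇒x-pos (fromNat-nonZero-pos n₂) (fromNat-nonZero-pos n₁) n̄*n₂≈n₁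

      -- Multiplication by n₂² clears the denominator of N² and completes w n₂ to w n₂³ = v; then
      -- |a| v = u, and r u = n₁².
      ∣A₁∣*ā≈n̄² : fromNat ℤ.∣ A₁ ∣ * ā ≈ n̄ ^ 2
      ∣A₁∣*ā≈n̄² = *-cancelˡ-≈ (^-pos 2 (fromNat-nonZero-pos n₂)) (begin-equality
        N₂ ^ 2 * (fromNat ℤ.∣ A₁ ∣ * ā)     ≈⟨ *-congˡ (*-congʳ (trans (reflexive (≡.cong fromNat ∣A₁∣≡)) (trans (fromNat-* (r ℕ.* w) n₂) (*-congʳ (fromNat-* r w))))) ⟩
        N₂ ^ 2 * (R * W * N₂ * ā)           ≈⟨ solve 4 (λ n r w a → n :^ 2 :* (r :* w :* n :* a) := r :* (a :* (w :* n :^ 3))) refl N₂ R W ā ⟩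
        R * (ā * (W * N₂ ^ 3))              ≈⟨ *-congˡ (*-congˡ (trans (reflexive (≡.cong fromNat v≡w*n₂³)) (trans (fromNat-* w (n₂ ℕ.^ 3)) (*-congˡ (fromNat-^ n₂ 3))))) ⟨
        R * (ā * fromNat v)                 ≈⟨ *-congˡ ā*v≈u ⟩
        R * fromNat u                       ≈⟨ fromNat-* r u ⟨
        fromNat (r ℕ.* u)                   ≡⟨ ≡.cong fromNat n₁²≡r*u ⟨
        fromNat (n₁ ℕ.^ 2)                  ≈⟨ fromNat-^ n₁ 2 ⟩
        fromNat n₁ ^ 2                      ≈⟨ ^-congˡ 2 n̄*n₂≈n₁ ⟨
        (n̄ * N₂) ^ 2                        ≈⟨ solve 2 (λ x y → (x :* y) :^ 2 := y :^ 2 :* x :^ 2) refl n̄ N₂ ⟩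
        N₂ ^ 2 * n̄ ^ 2                      ∎)
        where
        open ≤-Reasoning
        R = fromNat r
        W = fromNat w
        N₂ = fromNat n₂

      ∣B₁∣*ā≈n̄³ : fromNat ℤ.∣ B₁ ∣ * ā ≈ n̄ ^ 3
      ∣B₁∣*ā≈n̄³ = begin-equality
        fromNat ℤ.∣ B₁ ∣ * ā                    ≈⟨ *-congʳ (trans (reflexive (≡.cong fromNat ∣B₁∣≡)) (fromNat-* (r ℕ.* w) n₁)) ⟩
        fromNat (r ℕ.* w) * fromNat n₁ * ā      ≈⟨ *-congʳ (*-congˡ n̄*n₂≈n₁) ⟨
        fromNat (r ℕ.* w) * (n̄ * fromNat n₂) * ā ≈⟨ solve 4 (λ p x y a → p :* (x :* y) :* a := x :* (p :* y :* a)) refl (fromNat (r ℕ.* w)) n̄ (fromNat n₂) ā ⟩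
        n̄ * (fromNat (r ℕ.* w) * fromNat n₂ * ā) ≈⟨ *-congˡ (*-congʳ (trans (reflexive (≡.cong fromNat ∣A₁∣≡)) (fromNat-* (r ℕ.* w) n₂))) ⟨
        n̄ * (fromNat ℤ.∣ A₁ ∣ * ā)              ≈⟨ *-congˡ ∣A₁∣*ā≈n̄² ⟩
        n̄ * n̄ ^ 2                               ∎
        where open ≤-Reasoning

    c′ : Carrier
    c′ = c j j≢0 α β

    Y : Carrier → Carrier
    Y X = c′ * X ^1/ 6

    private
      cα cβ : Carrier
      cα = ā ^1/ 2 / (n̄ * α ^1/ 6)
      cβ = ā ^1/ 3 / (n̄ * β ^1/ 6)

      0≤cα : 0# ≤ cα
      0≤cα = /-nonNeg (root-nonNeg 1 (<⇒≤ 0<ā)) (*-pos 0<n̄ (root-pos 5 (1≤x⇒0<x 1≤α)))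

      0≤cβ : 0# ≤ cβ
      0≤cβ = /-nonNeg (root-nonNeg 2 (<⇒≤ 0<ā)) (*-pos 0<n̄ (root-pos 5 (1≤x⇒0<x 1≤β)))

    0≤c′ : 0# ≤ c′
    0≤c′ = ⊓-glb 0≤cα 0≤cβ

    0≤Y : ∀ X → 1# < X → 0# ≤ Y X
    0≤Y X 1<X = *-nonNeg 0≤c′ (root-nonNeg 5 (1<X⇒0≤X 1<X))

    private
      scale-⇔ : ∀ {x y z w u} → 0# < u → x * u ≈ z → y * u ≈ w → x ≤ y ⇔ z ≤ w
      scale-⇔ 0<u xu≈z yu≈w = mk⇔ (λ le → ≤-respˡ-≈ xu≈z (≤-respʳ-≈ yu≈w (*-monoˡ-≤ (<⇒≤ 0<u) le)))
                                  (λ le → *-cancelʳ-≤ 0<u (≤-respˡ-≈ (sym xu≈z) (≤-respʳ-≈ (sym yu≈w) le)))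

      -- Multiplying by |a|³ replaces A₁ by N² and makes both sides multiples of sixth powers, of
      -- |k| N and of |a|^(1/2). This is the origin of the exponent 1/2 of |a| in `c`.
      height-A : ∀ X → 1# < X → ∀ i → α * ∣ fromInt (i ℤ.^ 2 ℤ.* A₁) ∣ ^ 3 ≤ X ⇔ fromNat ℤ.∣ i ∣ ≤ cα * X ^1/ 6
      height-A X 1<X i = scale-⇔ (^-pos 3 0<ā) lhs rhs ⟫
        ^-≤⇔≤-root 5 (1≤x⇒0<x 1≤α) 0<n̄ (root-nonNeg 1 (<⇒≤ 0<ā)) (fromNat-nonNeg ℤ.∣ i ∣) (1<X⇒0≤X 1<X)
        where
        open ≤-Reasoning
        m = fromNat ℤ.∣ i ∣
        e = ā ^1/ 2
        lhs : α * ∣ fromInt (i ℤ.^ 2 ℤ.* A₁) ∣ ^ 3 * ā ^ 3 ≈ α * (m * n̄) ^ 6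
        lhs = begin-equality
          α * ∣ fromInt (i ℤ.^ 2 ℤ.* A₁) ∣ ^ 3 * ā ^ 3    ≈⟨ *-congʳ (*-congˡ (^-congˡ 3 (trans (∣fromInt∣ (i ℤ.^ 2 ℤ.* A₁)) (trans (reflexive (≡.cong fromNat (∣i^n*j∣ i 2 A₁))) (trans (fromNat-* (ℤ.∣ i ∣ ℕ.^ 2) ℤ.∣ A₁ ∣) (*-congʳ (fromNat-^ ℤ.∣ i ∣ 2))))))) ⟩
          α * (m ^ 2 * fromNat ℤ.∣ A₁ ∣) ^ 3 * ā ^ 3      ≈⟨ solve 4 (λ c m x a → c :* (m :^ 2 :* x) :^ 3 :* a :^ 3 := c :* (m :^ 6 :* (x :* a) :^ 3)) refl α m (fromNat ℤ.∣ A₁ ∣) ā ⟩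
          α * (m ^ 6 * (fromNat ℤ.∣ A₁ ∣ * ā) ^ 3)        ≈⟨ *-congˡ (*-congˡ (^-congˡ 3 ∣A₁∣*ā≈n̄²)) ⟩
          α * (m ^ 6 * (n̄ ^ 2) ^ 3)                       ≈⟨ solve 3 (λ c m n → c :* (m :^ 6 :* (n :^ 2) :^ 3) := c :* (m :* n) :^ 6) refl α m n̄ ⟩
          α * (m * n̄) ^ 6                                 ∎
        rhs : X * ā ^ 3 ≈ X * e ^ 6
        rhs = *-congˡ (trans (^-congˡ 3 (sym (root-^ 1 (<⇒≤ 0<ā)))) (^-assocʳ e 2 3))

      -- Here the factor is |a|², which replaces B₁ by N³ and is the sixth power of |a|^(1/3).
      height-B : ∀ X → 1# < X → ∀ i → β * fromInt (i ℤ.^ 3 ℤ.* B₁) ^ 2 ≤ X ⇔ fromNat ℤ.∣ i ∣ ≤ cβ * X ^1/ 6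
      height-B X 1<X i = scale-⇔ (^-pos 2 0<ā) lhs rhs ⟫
        ^-≤⇔≤-root 5 (1≤x⇒0<x 1≤β) 0<n̄ (root-nonNeg 2 (<⇒≤ 0<ā)) (fromNat-nonNeg ℤ.∣ i ∣) (1<X⇒0≤X 1<X)
        where
        open ≤-Reasoning
        m = fromNat ℤ.∣ i ∣
        e = ā ^1/ 3
        lhs : β * fromInt (i ℤ.^ 3 ℤ.* B₁) ^ 2 * ā ^ 2 ≈ β * (m * n̄) ^ 6
        lhs = begin-equality
          β * fromInt (i ℤ.^ 3 ℤ.* B₁) ^ 2 * ā ^ 2        ≈⟨ *-congʳ (*-congˡ (trans (fromInt² (i ℤ.^ 3 ℤ.* B₁)) (^-congˡ 2 (trans (reflexive (≡.cong fromNat (∣i^n*j∣ i 3 B₁))) (trans (fromNat-* (ℤ.∣ i ∣ ℕ.^ 3) ℤ.∣ B₁ ∣) (*-congʳ (fromNat-^ ℤ.∣ i ∣ 3))))))) ⟩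
          β * (m ^ 3 * fromNat ℤ.∣ B₁ ∣) ^ 2 * ā ^ 2      ≈⟨ solve 4 (λ c m x a → c :* (m :^ 3 :* x) :^ 2 :* a :^ 2 := c :* (m :^ 6 :* (x :* a) :^ 2)) refl β m (fromNat ℤ.∣ B₁ ∣) ā ⟩
          β * (m ^ 6 * (fromNat ℤ.∣ B₁ ∣ * ā) ^ 2)        ≈⟨ *-congˡ (*-congˡ (^-congˡ 2 ∣B₁∣*ā≈n̄³)) ⟩
          β * (m ^ 6 * (n̄ ^ 3) ^ 2)                       ≈⟨ solve 3 (λ c m n → c :* (m :^ 6 :* (n :^ 3) :^ 2) := c :* (m :* n) :^ 6) refl β m n̄ ⟩
          β * (m * n̄) ^ 6                                 ∎
        rhs : X * ā ^ 2 ≈ X * e ^ 6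
        rhs = *-congˡ (trans (^-congˡ 2 (sym (root-^ 2 (<⇒≤ 0<ā)))) (^-assocʳ e 3 2))

    height : ∀ X → 1# < X → ∀ i → H α β (φ i) ≤ X ⇔ fromNat ℤ.∣ i ∣ ≤ Y X
    height X 1<X i = mk⇔
      (λ h≤X → from (≤⊓*⇔ 0≤x) (to (height-A X 1<X i) (proj₁ (to ⊔≤⇔ h≤X)) , to (height-B X 1<X i) (proj₂ (to ⊔≤⇔ h≤X))))
      (λ m≤Y → from ⊔≤⇔ (from (height-A X 1<X i) (proj₁ (to (≤⊓*⇔ 0≤x) m≤Y)) , from (height-B X 1<X i) (proj₂ (to (≤⊓*⇔ 0≤x) m≤Y))))
      where 0≤x = root-nonNeg 5 (1<X⇒0≤X 1<X)

    main≈ : ∀ z X → (fromNat 2 * c′) / z * X ^1/ 6 ≈ fromNat 2 * (Y X / z)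
    main≈ z X = solve 4 (λ t c i x → t :* c :* i :* x := t :* (c :* x :* i)) refl (fromNat 2) c′ (z ⁻¹) (X ^1/ 6)

    Y≤^ : ∀ X → 1# < X → Y X ≤ ((c′ + 1#) * X ^1/ 12) ^ 2
    Y≤^ X 1<X = begin
      -- Using c′ ≤ (c′ + 1)² gives a constant that works for small c′ as well, without taking a
      -- square root of c′.
      c′ * X ^1/ 6                          ≤⟨ *-monoˡ-≤ (root-nonNeg 5 (1<X⇒0≤X 1<X)) (x≤[x+1]^n 1 0≤c′) ⟩
      (c′ + 1#) ^ 2 * X ^1/ 6               ≈⟨ *-congˡ (root-of-root 5 1 (1<X⇒0≤X 1<X)) ⟨
      (c′ + 1#) ^ 2 * (X ^1/ 12) ^ 2        ≈⟨ ^-distrib-* (c′ + 1#) (X ^1/ 12) 2 ⟨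
      ((c′ + 1#) * X ^1/ 12) ^ 2            ∎
      where open ≤-Reasoning

    open Family parametrisation α β Y 0≤Y height public

theorem2p3 : (lem : ExcludedMiddle 0ℓ) (ℝ : CompleteOrderedField) →
    let open Real lem ℝ in
    (α β : Carrier) → 1# ≤ α → 1# ≤ β → (j : ℚ) →
    ( (j ≡ 0ℚ →
    # 𝓔[ j ] ⟨ H α β ⟩
    ≈ (λ X → fromNat 2 / (β ^1/ 2 * ζ 6) * X ^1/ 2) +O (λ X → X ^1/ 12))
    × (j ≡ 1728ℚ →
    # 𝓔[ j ] ⟨ H α β ⟩
    ≈ (λ X → fromNat 2 / (α ^1/ 3 * ζ 4) * X ^1/ 3) +O (λ X → X ^1/ 12))
    × ((j≢0 : j ≢ 0ℚ) → j ≢ 1728ℚ →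
    # 𝓔[ j ] ⟨ H α β ⟩
    ≈ (λ X → (fromNat 2 * c j j≢0 α β) / ζ 2 * X ^1/ 6) +O (λ X → X ^1/ 12)))
    ×
    ( (j ≡ 0ℚ →
    # Ẽ[ j ] ⟨ H α β ⟩
    ≡ (λ X → + 2 ℤ.* ⌊ X ^1/ 2 / β ^1/ 2 ⌋))
    × (j ≡ 1728ℚ →
    # Ẽ[ j ] ⟨ H α β ⟩
    ≡ (λ X → + 2 ℤ.* ⌊ X ^1/ 3 / α ^1/ 3 ⌋))
    × ((j≢0 : j ≢ 0ℚ) → j ≢ 1728ℚ →
    # Ẽ[ j ] ⟨ H α β ⟩
    ≡ (λ X → + 2 ℤ.* ⌊ c j j≢0 α β * X ^1/ 6 ⌋)))
theorem2p3 lem ℝ α β 1≤α 1≤β j =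
  -- The indices are shifted: `Zeta.0<ζ 4` and `Zeta.0<ζ 2` concern ζ(6) and ζ(4), and the arguments
  -- 5 and 3 stand for s = 6 and s = 4, with 6 · 2 = 4 · 3 = 12. The constant K is 1 in both cases.
  ( (λ { ≡.refl → Z.𝓔-count 0≤1 (Z.main≈ (Zeta.0<ζ 4)) (Z.Y≤^ 5) })
  , (λ { ≡.refl → S.𝓔-count 0≤1 (S.main≈ (Zeta.0<ζ 2)) (S.Y≤^ 3) })
  , λ j≢0 j≢1728 → let open CaseGeneric j j≢0 j≢1728 α β 1≤α 1≤β in
      𝓔-count (≤-trans 0≤c′ (x≤x+y 0≤1)) (main≈ (ζ 2)) Y≤^ ) ,
  ( (λ { ≡.refl → Z.Ẽ-count })
  , (λ { ≡.refl → S.Ẽ-count })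
  , λ j≢0 j≢1728 → CaseGeneric.Ẽ-count j j≢0 j≢1728 α β 1≤α 1≤β )
  where
  open Real lem ℝ using (ζ)
  open CompleteOrderedField ℝ using (isTotalOrder)
  open import Relation.Binary using (IsTotalOrder)
  open IsTotalOrder isTotalOrder using () renaming (trans to ≤-trans)
  open Analysis lem ℝ using (0≤1; x≤x+y; module Zeta; module Case₀; module Case₁₇₂₈; module CaseGeneric)
  module Z = Case₀ α β 1≤β
  module S = Case₁₇₂₈ α β 1≤α
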